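{- Let $q=r^3$, where $r$ is a prime power which is not a square. There are exactly $r(r^5+r^4+r^3+r^2+r+1)$ extremal Peisert-type graphs defined over $\mathbb{F}_{q^2}$. Moreover, if $X$ is such an extremal graph, then $X$ is unique up to isomorphism (any two such graphs are isomorphic), and $X$ has exactly $r^2+1$ canonical cliques containing $0$ and exactly $r^2+r+1$ non-canonical (maximum) cliques containing $0$.
   Context: For an abelian group $G$ and $S\subseteq G\setminus\{0\}$ with $S=-S$, $\operatorname{Cay}(G,S)$ is the graph on $G$ with $g\sim h$ iff $g-h\in S$. A Peisert-type graph of type $(m,q)$ (defined over $\mathbb{F}_{q^2}$) is $\operatorname{Cay}(\mathbb{F}_{q^2}^+,S)$ with $S=c_1\mathbb{F}_q^*\cup\cdots\cup c_m\mathbb{F}_q^*$ a union of $m\le q$ distinct cosets of $\mathbb{F}_q^*$ in $\mathbb{F}_{q^2}^*$. Its clique number is $q$; maximum cliques have size $q$. Canonical cliques are the sets $x+c_i\mathbb{F}_q$ ($x\in\mathbb{F}_{q^2}$); a non-canonical clique is a maximum clique that is not canonical. The strict-EKR property means all maximum cliques are canonical. A Peisert-type graph of type $(m,q)$ is extremal if it lacks the strict-EKR property while all Peisert-type graphs of type $(m-1,q)$ have it. -}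

module Defs where

open import Level using (0ℓ)
open import Data.Nat as ℕ using (ℕ; zero; suc; _≤_)
open import Data.Nat.Primality using (Prime)
open import Data.Bool using (Bool; true; false)
open import Data.Fin using (Fin)
open import Data.List using (List; length; filterᵇ)
open import Data.List.Relation.Unary.All using (All)
open import Data.List.Relation.Unary.Any using (Any)
open import Data.List.Relation.Unary.AllPairs using (AllPairs)
open import Data.List.Relation.Unary.Unique.Propositional using (Unique)
open import Data.List.Membership.Propositional using (_∈_)
open import Data.Product using (Σ; Σ-syntax; ∃; ∃-syntax; _×_; _,_)
open import Relation.Nullary using (¬_; Dec)
open import Relation.Binary.PropositionalEquality using (_≡_; _≢_)
open import Algebra.Structures using (IsCommutativeRing)
open import Function.Bundles using (_⇔_)
open import Function.Base using (_∘_)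

IsPrimePower : ℕ → Set
IsPrimePower r = ∃[ p ] ∃[ k ] (Prime p × 1 ≤ k × r ≡ p ℕ.^ k)

IsSquare : ℕ → Set
IsSquare r = ∃[ s ] (r ≡ s ℕ.* s)

record FiniteField : Set₁ where
  field
    Carrier   : Set
    _+_ _*_   : Carrier → Carrier → Carrier
    -_        : Carrier → Carrier
    0# 1#     : Carrier
    isCommutativeRing : IsCommutativeRing _≡_ _+_ _*_ -_ 0# 1#
    0≢1       : 0# ≢ 1#
    inverse   : ∀ x → x ≢ 0# → ∃[ y ] (x * y ≡ 1#)
    _≟_       : (x y : Carrier) → Dec (x ≡ y)
    elements  : List Carrier
    unique    : Unique elements
    complete  : ∀ x → x ∈ elements

  order : ℕ
  order = length elements

  _-_ : Carrier → Carrier → Carrier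
  x - y = x + (- y)

  _^_ : Carrier → ℕ → Carrier
  x ^ zero  = 1#
  x ^ suc n = x * (x ^ n)

-- Peisert-type graphs over a field F of order q², with parameter q

module Peisert (F : FiniteField) (q : ℕ) where
  open FiniteField F

  Subset : Set
  Subset = Carrier → Bool

  _∈ˢ_ : Carrier → Subset → Set
  x ∈ˢ P = P x ≡ true

  _≈ˢ_ : Subset → Subset → Set
  P ≈ˢ Q = ∀ x → P x ≡ Q x

  size : Subset → ℕ
  size P = length (filterᵇ P elements)

  InFq : Carrier → Set
  InFq t = t ^ q ≡ t

  InFq* : Carrier → Set
  InFq* t = InFq t × t ≢ 0#

  InCoset : Carrier → Carrier → Set
  InCoset c x = ∃[ t ] (InFq* t × x ≡ c * t)

  SameCoset : Carrier → Carrier → Set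
  SameCoset c d = ∀ x → (InCoset c x ⇔ InCoset d x)

  PeisertType : ℕ → Subset → Set
  PeisertType m S =
    m ≤ q ×
    (Σ[ c ∈ (Fin m → Carrier) ] ((∀ (i : Fin m) → c i ≢ 0#) ×
            (∀ (i j : Fin m) → SameCoset (c i) (c j) → i ≡ j) ×
            (∀ x → (x ∈ˢ S ⇔ (∃[ i ] InCoset (c i) x)))))

  Adj : Subset → Carrier → Carrier → Set
  Adj S x y = (x - y) ∈ˢ S

  IsClique : Subset → Subset → Set
  IsClique S C = ∀ x y → x ∈ˢ C → y ∈ˢ C → x ≢ y → Adj S x y

  IsMaxClique : Subset → Subset → Set
  IsMaxClique S C = IsClique S C × (∀ D → IsClique S D → size D ≤ size C)

  -- canonical cliques: x + c𝔽_q where c𝔽_q^* is one of the cosets of S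
  -- (i.e. c ∈ S)
  IsCanonical : Subset → Subset → Set
  IsCanonical S C =
    ∃[ x ] ∃[ c ] (c ∈ˢ S × (∀ y → (y ∈ˢ C ⇔ (∃[ t ] (InFq t × y ≡ x + (c * t))))))

  IsNonCanonical : Subset → Subset → Set
  IsNonCanonical S C = IsMaxClique S C × ¬ IsCanonical S C

  StrictEKR : Subset → Set
  StrictEKR S = ∀ C → IsMaxClique S C → IsCanonical S C

  Extremal : Subset → Set
  Extremal S = ∃[ k ] (PeisertType (suc k) S × ¬ StrictEKR S ×
                        (∀ S' → PeisertType k S' → StrictEKR S'))

  Isomorphic : Subset → Subset → Set
  Isomorphic S S' =
    Σ[ f ∈ (Carrier → Carrier) ] Σ[ g ∈ (Carrier → Carrier) ] ((∀ x → g (f x) ≡ x) × (∀ y → f (g y) ≡ y) ×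
                   (∀ x y → (Adj S x y ⇔ Adj S' (f x) (f y))))

  ExactlyN : ℕ → (Subset → Set) → Set
  ExactlyN n Φ =
    Σ[ L ∈ List Subset ] (length L ≡ n × All Φ L × AllPairs (λ P Q → ¬ (P ≈ˢ Q)) L ×
            (∀ P → Φ P → Any (λ Q → P ≈ˢ Q) L))

{-# OPTIONS --safe #-}

-- Write K = 𝔽_q, q = r³. A maximum clique through 0 in a Peisert-type graph is a set U of q elements of 𝔽_{q²}
-- whose differences have slopes (values of x ↦ x^(q-1), one for each K-line through 0) in a set of m slopes.
-- For m ≤ r² + 1 the coefficients of the Rédei polynomials P_z = ∏_{u ∈ U} (X - (uz - u^q)) are polynomials in z
-- with too many zeros, so P_z = X^q + g with deg g ≤ r² for every slope z. Such fully reducible lacunary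
-- polynomials are classified by Rédei's argument: writing P_z = h^s with h not a p-th power, h divides B h′ for
-- every B vanishing at its roots, and a suitable B has degree too small. As r is not a square, the outcome is
-- that the root set of P_z, that is the projection of U along slope z, is always an 𝔽_r-subspace. A point all of
-- whose q + 1 projections lie in those of U lies in U, hence U is an 𝔽_r-subspace itself.
-- Counting slopes, U is either a K-line or a club cT + u𝔽_r, where c, u are independent over K and T ⊂ K is the
-- trace-zero hyperplane. A club has exactly r² + 1 slopes, so the extremal graphs are those whose slopes are the
-- slopes of a club. Hua's identity shows that T is not closed under inversion up to scalars, so the slopes
-- determine the head cK, and then determine the club up to multiplication by K*. All counts follow from the
-- sizes of these equivalence classes.

module Submission where

open import Defs
open import Level using (0ℓ)
open import Algebra.Bundles using (CommutativeRing)
open import Algebra.Structures using (IsCommutativeMonoid)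
import Algebra.Properties.CommutativeSemiring.Binomial
import Algebra.Properties.Ring
import Algebra.Solver.Ring
open import Algebra.Solver.Ring.AlmostCommutativeRing using (fromCommutativeRing; _-Raw-AlmostCommutative⟶_)
open import Data.Bool as Bool using (Bool; true; false)
open import Data.Empty using (⊥; ⊥-elim)
open import Data.Fin as Fin using (Fin; toℕ; fromℕ; inject₁)
import Data.Fin.Properties as Finₚ
open import Data.Integer as ℤ using (ℤ; -[1+_]; _⊖_)
import Data.Integer.Properties as ℤₚ
open import Data.List using (List; []; _∷_; length; map; filter; filterᵇ; foldr; _++_; take; lookup; tabulate;
         deduplicate; cartesianProduct; cartesianProductWith)
open import Data.List.Properties using (length-map; length-++; length-filter; length-take; length-tabulate;
         filter-accept; filter-reject; map-∘)
open import Data.List.Membership.Propositional using (_∈_; _∉_; find; lose)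
open import Data.List.Membership.Propositional.Properties
open import Data.List.Membership.Propositional.Properties.WithK using (unique∧set⇒bag)
open import Data.List.Relation.Binary.BagAndSetEquality using (∼bag⇒↭)
open import Data.List.Relation.Binary.Permutation.Propositional using (↭⇒↭ₛ)
import Data.List.Relation.Binary.Permutation.Setoid.Properties as Perm
open import Data.List.Relation.Unary.All as All using (All; []; _∷_)
import Data.List.Relation.Unary.All.Properties as Allₚ
open import Data.List.Relation.Unary.AllPairs using (AllPairs; []; _∷_)
import Data.List.Relation.Unary.AllPairs.Properties as AllPairsₚ
open import Data.List.Relation.Unary.Any as Any using (Any; here; there; any?)
import Data.List.Relation.Unary.Any.Properties as Anyₚ
open import Data.List.Relation.Unary.Unique.Propositional using (Unique)
open import Data.List.Relation.Unary.Unique.Propositional.Properties using (map⁺; ++⁺; filter⁺; take⁺; tabulate⁺;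
         cartesianProduct⁺; Unique[x∷xs]⇒x∉xs)
open import Data.Maybe using (Maybe; just; nothing)
open import Data.Nat as ℕ using (ℕ; zero; suc; _≤_; _<_; z≤n; s≤s; _∸_; _!)
import Data.Nat.Properties as ℕₚ
open import Data.Nat.Combinatorics using (nCk≡n!/k![n-k]!; k![n∸k]!∣n!; nCn≡1) renaming (_C_ to _choose_)
open import Data.Nat.Coprimality using (prime⇒coprime; coprime-Bézout)
open import Data.Nat.Divisibility using (_∣_; divides; _∣0; ∣⇒≤; ∣1⇒≡1; ∣-refl; m∣m*n; n∣m*n; ∣m+n∣m⇒∣n; ∣m∣n⇒∣m+n)
open import Data.Nat.DivMod using (m≡m%n+[m/n]*n; m%n<n; m/n*n≡m)
open import Data.Nat.GCD using (module Bézout)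
open import Data.Nat.Primality using (Prime; euclidsLemma; prime⇒nonTrivial; prime⇒nonZero)
open import Data.Nat.Tactic.RingSolver using (solve-∀)
open import Data.Product using (∃; ∃-syntax; _×_; _,_; proj₁; proj₂)
open import Data.Sum using (_⊎_; inj₁; inj₂)
open import Function.Base using (_∘_)
open import Function.Bundles using (mk⇔; Equivalence)
open import Relation.Binary.Definitions using (Tri; tri<; tri≈; tri>)
open import Relation.Binary.PropositionalEquality using (_≡_; _≢_; refl; sym; trans; cong; cong₂; subst; subst₂;
         setoid; module ≡-Reasoning)
open import Relation.Nullary using (¬_; Dec; yes; no; does; ¬?)
open import Relation.Nullary.Decidable using (_×-dec_; dec-true; T?)
open import Relation.Unary using (Decidable)

-- The polynomials B come from two relations at once: a root w of P_z satisfies w^q = ζw with ζ =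
-- -z^q, and a root of h = X^m + g satisfies w^m = -g(w). Substituting the second into the first
-- trades w^q for a polynomial in w of low degree. If B = 0, then g can be read off, or there is a
-- contradiction, or g′ = 0 follows by differentiation; if g′ = 0, a p-th root comes out of h and s
-- grows by the factor p. The case that resists is m² = q: there ζX meets g^[m](-g) without any
-- further p-th power, so neither the coefficient of X nor a derivative gives information.
-- Identities between polynomials are checked on values: F has q² elements and all degrees stay
-- below q². Dimensions are replaced by lengths of duplicate-free lists. The number of extremal
-- graphs is the number (q² - 1)(q² - q) of bases (c, u) divided by the number (q - 1)(r - 1)r² of
-- bases with the same slopes. The non-canonical cliques through 0 correspond to K* modulo 𝔽_r*,
-- hence (q - 1)/(r - 1) = r² + r + 1 of them.

private
  variable
    X Y : Set

-- Counting with duplicate-free lists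

unique-⊆-length : {xs ys : List X} → Unique xs → (∀ {x} → x ∈ xs → x ∈ ys) → length xs ≤ length ys
unique-⊆-length {xs = []} _ _ = z≤n
unique-⊆-length {xs = x ∷ xs} {ys} uxs@(_ ∷ u) sub
  with ys₁ , ys₂ , refl ← ∈-∃++ (sub (here refl)) =
  subst (suc (length xs) ≤_) (sym len) (s≤s (unique-⊆-length u sub′))
  where
  len : length (ys₁ ++ x ∷ ys₂) ≡ suc (length (ys₁ ++ ys₂))
  len = trans (length-++ ys₁) (trans (ℕₚ.+-suc _ _) (cong suc (sym (length-++ ys₁))))
  sub′ : ∀ {y} → y ∈ xs → y ∈ ys₁ ++ ys₂
  sub′ y∈ with ∈-++⁻ ys₁ (sub (there y∈))
  ... | inj₁ a = ∈-++⁺ˡ a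
  ... | inj₂ (here refl) = ⊥-elim (Unique[x∷xs]⇒x∉xs uxs y∈)
  ... | inj₂ (there b) = ∈-++⁺ʳ ys₁ b

unique-⊆-length-≡ : {xs ys : List X} → Unique xs → Unique ys →
  (∀ {x} → x ∈ xs → x ∈ ys) → (∀ {x} → x ∈ ys → x ∈ xs) → length xs ≡ length ys
unique-⊆-length-≡ ux uy s t = ℕₚ.≤-antisym (unique-⊆-length ux s) (unique-⊆-length uy t)

module _ (_≟_ : (x y : X) → Dec (x ≡ y)) where
  open import Data.List.Membership.DecPropositional _≟_ using (_∈?_)

  -- One inclusion and a comparison of lengths replace the second inclusion; most equalities of
  -- finite sets below are obtained in this way. A missing `y` could be prepended to `xs`, against
  -- the pigeonhole bound.
  unique-⊆-full : {xs ys : List X} → Unique xs → (∀ {x} → x ∈ xs → x ∈ ys) →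
    length ys ≤ length xs → ∀ {y} → y ∈ ys → y ∈ xs
  unique-⊆-full {xs = xs} {ys} ux sub le {y} y∈ with y ∈? xs
  ... | yes p = p
  ... | no y∉ = ⊥-elim (ℕₚ.<⇒≱ (s≤s le) (unique-⊆-length {xs = y ∷ xs} (all ∷ ux) sub′))
    where
    all : All (y ≢_) xs
    all = All.tabulate λ z∈ y≡z → y∉ (subst (_∈ xs) (sym y≡z) z∈)
    sub′ : ∀ {x} → x ∈ y ∷ xs → x ∈ ys
    sub′ (here refl) = y∈
    sub′ (there p) = sub p

map-unique-on : (f : X → Y) {xs : List X} →
  (∀ {x y} → x ∈ xs → y ∈ xs → f x ≡ f y → x ≡ y) → Unique xs → Unique (map f xs)
map-unique-on f {[]} inj [] = []
map-unique-on f {x ∷ xs} inj (a ∷ u) =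
  All.tabulate (λ fy∈ fx≡ → let (y , y∈ , eq) = ∈-map⁻ f fy∈ in
     All.lookup a y∈ (inj (here refl) (there y∈) (trans fx≡ eq)))
  ∷ map-unique-on f (λ p q → inj (there p) (there q)) u

length-cartesianProductWith : {C : Set} (f : X → Y → C) (xs : List X) (ys : List Y) →
  length (cartesianProductWith f xs ys) ≡ length xs ℕ.* length ys
length-cartesianProductWith f [] ys = refl
length-cartesianProductWith f (x ∷ xs) ys = trans (length-++ (map (f x) ys))
  (cong₂ ℕ._+_ (length-map (f x) ys) (length-cartesianProductWith f xs ys))

cartesianProductWith-unique-on : {C : Set} (f : X → Y → C) (xs : List X) (ys : List Y) →
  (∀ {a b a′ b′} → a ∈ xs → b ∈ ys → a′ ∈ xs → b′ ∈ ys → f a b ≡ f a′ b′ → a ≡ a′ × b ≡ b′) →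
  Unique xs → Unique ys → Unique (cartesianProductWith f xs ys)
cartesianProductWith-unique-on f [] ys _ _ _ = []
cartesianProductWith-unique-on f (x ∷ xs) ys inj (x∉ ∷ ux) uy = ++⁺
  (map-unique-on (f x) (λ p q e → proj₂ (inj (here refl) p (here refl) q e)) uy)
  (cartesianProductWith-unique-on f xs ys (λ p q p′ q′ → inj (there p) q (there p′) q′) ux uy) disjoint
  where
  disjoint : ∀ {v} → ¬ (v ∈ map (f x) ys × v ∈ cartesianProductWith f xs ys)
  disjoint (v∈ , v∈′) with ∈-map⁻ (f x) v∈ | ∈-cartesianProductWith⁻ f xs ys v∈′
  ... | y , y∈ , refl | x′ , y′ , x′∈ , y′∈ , e = All.lookup x∉ x′∈ (proj₁ (inj (here refl) y∈ (there x′∈) y′∈ e))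

-- The list of second components may depend on the first: later the vectors u completing c to a
-- basis depend on c.
pairsWith : (X → List Y) → List X → List (X × Y)
pairsWith f [] = []
pairsWith f (x ∷ xs) = map (x ,_) (f x) ++ pairsWith f xs

∈-pairsWith⁺ : (f : X → List Y) {xs : List X} {x : X} {y : Y} → x ∈ xs → y ∈ f x → (x , y) ∈ pairsWith f xs
∈-pairsWith⁺ f {x ∷ xs} (here refl) y∈ = ∈-++⁺ˡ (∈-map⁺ (x ,_) y∈)
∈-pairsWith⁺ f {z ∷ xs} (there x∈) y∈ = ∈-++⁺ʳ (map (z ,_) (f z)) (∈-pairsWith⁺ f x∈ y∈)

∈-pairsWith⁻ : (f : X → List Y) {xs : List X} {x : X} {y : Y} → (x , y) ∈ pairsWith f xs → x ∈ xs × y ∈ f x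
∈-pairsWith⁻ f {z ∷ xs} xy∈ with ∈-++⁻ (map (z ,_) (f z)) xy∈
... | inj₂ p = let (x∈ , y∈) = ∈-pairsWith⁻ f p in there x∈ , y∈
... | inj₁ p with ∈-map⁻ (z ,_) p
...   | y , y∈ , refl = here refl , y∈

pairsWith-unique : (f : X → List Y) → (∀ x → Unique (f x)) → {xs : List X} → Unique xs → Unique (pairsWith f xs)
pairsWith-unique f uf [] = []
pairsWith-unique f uf {x ∷ xs} (x∉ ∷ u) = ++⁺ (map⁺ (cong proj₂) (uf x)) (pairsWith-unique f uf u) disjoint
  where
  disjoint : ∀ {v} → ¬ (v ∈ map (x ,_) (f x) × v ∈ pairsWith f xs)
  disjoint (p , p′) with ∈-map⁻ (x ,_) p
  ... | y , y∈ , refl = All.lookup x∉ (proj₁ (∈-pairsWith⁻ f p′)) refl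

length-pairsWith : (f : X → List Y) (n : ℕ) {xs : List X} → (∀ {x} → x ∈ xs → length (f x) ≡ n) →
  length (pairsWith f xs) ≡ length xs ℕ.* n
length-pairsWith f n {[]} _ = refl
length-pairsWith f n {x ∷ xs} e = trans (length-++ (map (x ,_) (f x)))
  (cong₂ ℕ._+_ (trans (length-map (x ,_) (f x)) (e (here refl))) (length-pairsWith f n (e ∘ there)))

filter-count : {P : X → Set} (P? : Decidable P) (xs : List X) →
  length (filter P? xs) ℕ.+ length (filter (¬? ∘ P?) xs) ≡ length xs
filter-count P? [] = refl
filter-count P? (x ∷ xs) with P? x
... | yes p = cong suc (filter-count P? xs)
... | no ¬p = trans (ℕₚ.+-suc _ _) (cong suc (filter-count P? xs))

module _ (_≟_ : (x y : Y) → Dec (x ≡ y)) (f : X → Y) where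

  -- Removing the fibre over the first point of `zs` leaves elements that map into the rest. This
  -- inequality yields the number of slopes, the sizes of K, 𝔽_r and T, and a K-line rich in points
  -- of a clique.
  fibre-bound : (a : ℕ) (zs : List Y) (xs : List X) → (∀ {x} → x ∈ xs → f x ∈ zs) →
    (∀ z → length (filter (λ x → f x ≟ z) xs) ≤ a) → length xs ≤ length zs ℕ.* a
  fibre-bound a [] [] _ _ = z≤n
  fibre-bound a [] (x ∷ xs) into _ with () ← into (here refl)
  fibre-bound a (z ∷ zs) xs into fib =
    subst (_≤ a ℕ.+ length zs ℕ.* a) (filter-count (λ x → f x ≟ z) xs)
      (ℕₚ.+-mono-≤ (fib z) (fibre-bound a zs rest into′ fib′))
    where
    rest = filter (λ x → ¬? (f x ≟ z)) xs
    into′ : ∀ {x} → x ∈ rest → f x ∈ zs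
    into′ x∈ with ∈-filter⁻ (λ x → ¬? (f x ≟ z)) x∈
    ... | x∈xs , fx≢z with into x∈xs
    ... | here eq = ⊥-elim (fx≢z eq)
    ... | there p = p
    fib′ : ∀ w → length (filter (λ x → f x ≟ w) rest) ≤ a
    fib′ w = ℕₚ.≤-trans (go xs) (fib w)
      where
      go : ∀ xs → length (filter (λ x → f x ≟ w) (filter (λ x → ¬? (f x ≟ z)) xs)) ≤ length (filter (λ x → f x ≟ w) xs)
      go [] = z≤n
      go (x ∷ xs) with f x ≟ z | f x ≟ w
      ... | yes _ | yes _ = ℕₚ.m≤n⇒m≤1+n (go xs)
      ... | yes _ | no _ = go xs
      ... | no _ | yes p rewrite filter-accept (λ x → f x ≟ w) {x} {filter (λ x → ¬? (f x ≟ z)) xs} p = s≤s (go xs)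
      ... | no _ | no ¬p rewrite filter-reject (λ x → f x ≟ w) {x} {filter (λ x → ¬? (f x ≟ z)) xs} ¬p = go xs

module Classes {X : Set} {_~_ : X → X → Set} (_~?_ : (x y : X) → Dec (x ~ y))
  (~-refl : ∀ x → x ~ x) (~-sym : ∀ {x y} → x ~ y → y ~ x) (~-trans : ∀ {x y z} → x ~ y → y ~ z → x ~ z) where

  record Representatives (xs : List X) (a : ℕ) : Set where
    field
      reps : List X
      reps⊆ : ∀ {y} → y ∈ reps → y ∈ xs
      distinct : AllPairs (λ x y → ¬ (x ~ y)) reps
      covers : ∀ {x} → x ∈ xs → Any (x ~_) reps
      count : length reps ℕ.* a ≡ length xs
  open Representatives

  -- Removing the class of the first element does not touch the classes of the others, so the
  -- hypothesis on class sizes persists and the classes can be peeled off one by one. In `go`, the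
  -- bound n on the length is the recursion measure.
  representatives : (a : ℕ) (xs : List X) →
    (∀ {x} → x ∈ xs → length (filter (x ~?_) xs) ≡ a) → Representatives xs a
  representatives a xs = go (length xs) xs ℕₚ.≤-refl
    where
    go : (n : ℕ) (xs : List X) → length xs ≤ n →
      (∀ {x} → x ∈ xs → length (filter (x ~?_) xs) ≡ a) → Representatives xs a
    go n [] _ _ = record { reps = [] ; reps⊆ = λ () ; distinct = [] ; covers = λ () ; count = refl }
    go (suc n) (x ∷ xs) (s≤s le) size = record
      { reps = x ∷ reps ih
      ; reps⊆ = λ { (here refl) → here refl ; (there p) → proj₁ (∈-filter⁻ far? (reps⊆ ih p)) }
      ; distinct = All.tabulate (λ p → proj₂ (∈-filter⁻ far? {xs = x ∷ xs} (reps⊆ ih p))) ∷ distinct ih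
      ; covers = cov
      ; count = trans (cong₂ ℕ._+_ (sym (size (here refl))) (count ih)) (filter-count (x ~?_) (x ∷ xs))
      }
      where
      far? = ¬? ∘ (x ~?_)
      rest = filter far? (x ∷ xs)
      rest-short : length rest ≤ n
      rest-short with x ~? x
      ... | yes _ = ℕₚ.≤-trans (length-filter far? xs) le
      ... | no ¬p = ⊥-elim (¬p (~-refl x))
      size′ : ∀ {y} → y ∈ rest → length (filter (y ~?_) rest) ≡ a
      size′ {y} y∈ with ∈-filter⁻ far? {xs = x ∷ xs} y∈
      ... | y∈xs , x≁y = trans (gen (x ∷ xs)) (size y∈xs)
        where
        gen : ∀ zs → length (filter (y ~?_) (filter far? zs)) ≡ length (filter (y ~?_) zs)
        gen [] = refl
        gen (z ∷ zs) with x ~? z | y ~? z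
        ... | yes p | yes q = ⊥-elim (x≁y (~-trans p (~-sym q)))
        ... | yes _ | no _ = gen zs
        ... | no _ | yes q rewrite filter-accept (y ~?_) {z} {filter far? zs} q = cong suc (gen zs)
        ... | no _ | no ¬q rewrite filter-reject (y ~?_) {z} {filter far? zs} ¬q = gen zs
      ih = go n rest rest-short size′
      cov : ∀ {y} → y ∈ x ∷ xs → Any (y ~_) (x ∷ reps ih)
      cov {y} y∈ with x ~? y
      ... | yes p = here (~-sym p)
      ... | no ¬p = there (covers ih (∈-filter⁺ far? y∈ ¬p))

-- Arithmetic of a finite field and its Frobenius maps

module FieldTheory (F : FiniteField) where

  open FiniteField F public
    using (Carrier; 0#; 1#; isCommutativeRing; 0≢1; inverse; elements; unique; complete; order)
    renaming (_≟_ to infix 4 _≟_; _+_ to infixl 6 _+_; _*_ to infixl 7 _*_; -_ to infix 8 -_; _-_ to infixl 6 _-_; _^_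
      to infixr 9 _^_)

  ring : CommutativeRing 0ℓ 0ℓ
  ring = record { isCommutativeRing = isCommutativeRing }

  open CommutativeRing ring public
    using (+-assoc; +-comm; +-identityˡ; +-identityʳ; *-assoc; *-comm; *-identityˡ; *-identityʳ;
           distribˡ; distribʳ; zeroˡ; zeroʳ; -‿inverseˡ; -‿inverseʳ)
  open Algebra.Properties.Ring (CommutativeRing.ring ring) public
    using (-‿involutive; -0#≈0#; -‿+-comm; -‿distribˡ-*; -‿distribʳ-*)

  -- The separate clause for 1 lets `natF 1` reduce to `1#` instead of `1# + 0#`, so that the
  -- constant `:1` of the ring solver denotes `1#` itself.
  natF : ℕ → Carrier
  natF zero = 0#
  natF (suc zero) = 1#
  natF (suc (suc n)) = 1# + natF (suc n)

  natF-suc : ∀ n → natF (suc n) ≡ 1# + natF n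
  natF-suc zero = sym (+-identityʳ 1#)
  natF-suc (suc n) = refl

  natF-+ : ∀ m n → natF (m ℕ.+ n) ≡ natF m + natF n
  natF-+ zero n = sym (+-identityˡ _)
  natF-+ (suc m) n = begin
    natF (suc (m ℕ.+ n))     ≡⟨ natF-suc (m ℕ.+ n) ⟩
    1# + natF (m ℕ.+ n)      ≡⟨ cong (1# +_) (natF-+ m n) ⟩
    1# + (natF m + natF n)   ≡⟨ +-assoc _ _ _ ⟨
    (1# + natF m) + natF n   ≡⟨ cong (_+ natF n) (natF-suc m) ⟨
    natF (suc m) + natF n    ∎
    where open ≡-Reasoning

  natF-* : ∀ m n → natF (m ℕ.* n) ≡ natF m * natF n
  natF-* zero n = sym (zeroˡ _)
  natF-* (suc m) n = begin
    natF (n ℕ.+ m ℕ.* n)           ≡⟨ natF-+ n (m ℕ.* n) ⟩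
    natF n + natF (m ℕ.* n)        ≡⟨ cong₂ _+_ (sym (*-identityˡ _)) (natF-* m n) ⟩
    (1# * natF n) + (natF m * natF n)  ≡⟨ distribʳ _ _ _ ⟨
    (1# + natF m) * natF n       ≡⟨ cong (_* natF n) (natF-suc m) ⟨
    natF (suc m) * natF n        ∎
    where open ≡-Reasoning

  intF : ℤ → Carrier
  intF (ℤ.+ n) = natF n
  intF -[1+ n ] = - natF (suc n)

  private
    cancel₁ : ∀ a b → (1# + a) - (1# + b) ≡ a - b
    cancel₁ a b = begin
      (1# + a) + (- (1# + b))        ≡⟨ cong₂ _+_ (+-comm 1# a) (sym (-‿+-comm 1# b)) ⟩
      (a + 1#) + ((- 1#) + (- b))    ≡⟨ +-assoc a 1# _ ⟩
      a + (1# + ((- 1#) + (- b)))    ≡⟨ cong (a +_) (+-assoc 1# _ _) ⟨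
      a + ((1# + (- 1#)) + (- b))    ≡⟨ cong (λ t → a + (t + (- b))) (-‿inverseʳ 1#) ⟩
      a + (0# + (- b))               ≡⟨ cong (a +_) (+-identityˡ _) ⟩
      a - b                          ∎
      where open ≡-Reasoning

  intF-⊖ : ∀ m n → intF (m ⊖ n) ≡ natF m - natF n
  intF-⊖ zero zero = sym (-‿inverseʳ 0#)
  intF-⊖ zero (suc n) = sym (+-identityˡ _)
  intF-⊖ (suc m) zero = trans (sym (+-identityʳ _)) (cong (natF (suc m) +_) (sym -0#≈0#))
  intF-⊖ (suc m) (suc n) = begin
    intF (suc m ⊖ suc n)           ≡⟨ cong intF (ℤₚ.[1+m]⊖[1+n]≡m⊖n m n) ⟩
    intF (m ⊖ n)                   ≡⟨ intF-⊖ m n ⟩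
    natF m - natF n                ≡⟨ cancel₁ _ _ ⟨
    (1# + natF m) - (1# + natF n)  ≡⟨ cong₂ _-_ (natF-suc m) (natF-suc n) ⟨
    natF (suc m) - natF (suc n)    ∎
    where open ≡-Reasoning

  intF-neg : ∀ i → intF (ℤ.- i) ≡ - intF i
  intF-neg (ℤ.+ zero) = sym -0#≈0#
  intF-neg (ℤ.+ suc n) = refl
  intF-neg -[1+ n ] = sym (-‿involutive _)

  intF-+ : ∀ i j → intF (i ℤ.+ j) ≡ intF i + intF j
  intF-+ (ℤ.+ m) (ℤ.+ n) = natF-+ m n
  intF-+ (ℤ.+ m) -[1+ n ] = intF-⊖ m (suc n)
  intF-+ -[1+ m ] (ℤ.+ n) = trans (intF-⊖ n (suc m)) (+-comm _ _)
  intF-+ -[1+ m ] -[1+ n ] = begin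
    - natF (suc (suc (m ℕ.+ n)))       ≡⟨ cong (λ k → - natF (suc k)) (ℕₚ.+-suc m n) ⟨
    - natF (suc m ℕ.+ suc n)           ≡⟨ cong -_ (natF-+ (suc m) (suc n)) ⟩
    - (natF (suc m) + natF (suc n))    ≡⟨ -‿+-comm _ _ ⟨
    (- natF (suc m)) + (- natF (suc n)) ∎
    where open ≡-Reasoning

  private
    intF-*-pos : ∀ m j → intF (ℤ.+ m ℤ.* j) ≡ natF m * intF j
    intF-*-pos m (ℤ.+ n) = trans (cong intF (sym (ℤₚ.pos-* m n))) (natF-* m n)
    intF-*-pos m -[1+ n ] = begin
      intF (ℤ.+ m ℤ.* ℤ.- (ℤ.+ suc n))     ≡⟨ cong intF (ℤₚ.neg-distribʳ-* (ℤ.+ m) (ℤ.+ suc n)) ⟨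
      intF (ℤ.- (ℤ.+ m ℤ.* ℤ.+ suc n))     ≡⟨ intF-neg (ℤ.+ m ℤ.* ℤ.+ suc n) ⟩
      - intF (ℤ.+ m ℤ.* ℤ.+ suc n)         ≡⟨ cong -_ (intF-*-pos m (ℤ.+ suc n)) ⟩
      - (natF m * natF (suc n))        ≡⟨ -‿distribʳ-* _ _ ⟩
      natF m * (- natF (suc n))        ∎
      where open ≡-Reasoning

  intF-* : ∀ i j → intF (i ℤ.* j) ≡ intF i * intF j
  intF-* (ℤ.+ m) j = intF-*-pos m j
  intF-* -[1+ m ] j = begin
    intF (ℤ.- (ℤ.+ suc m) ℤ.* j)     ≡⟨ cong intF (ℤₚ.neg-distribˡ-* (ℤ.+ suc m) j) ⟨
    intF (ℤ.- (ℤ.+ suc m ℤ.* j))     ≡⟨ intF-neg (ℤ.+ suc m ℤ.* j) ⟩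
    - intF (ℤ.+ suc m ℤ.* j)         ≡⟨ cong -_ (intF-*-pos (suc m) j) ⟩
    - (natF (suc m) * intF j)      ≡⟨ -‿distribˡ-* _ _ ⟩
    (- natF (suc m)) * intF j      ∎
    where open ≡-Reasoning

  private
    morphism : ℤ.+-*-rawRing -Raw-AlmostCommutative⟶ fromCommutativeRing ring
    morphism = record
      { ⟦_⟧ = intF ; +-homo = intF-+ ; *-homo = intF-* ; -‿homo = intF-neg ; 0-homo = refl ; 1-homo = refl }

    _coeff≟_ : ∀ i j → Maybe (intF i ≡ intF j)
    i coeff≟ j with i ℤ.≟ j
    ... | yes eq = just (cong intF eq)
    ... | no _ = nothing

  module Solver = Algebra.Solver.Ring ℤ.+-*-rawRing (fromCommutativeRing ring) morphism _coeff≟_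
  open Solver public using (solve; _:+_; _:*_; _:-_; :-_; _:=_; con)

  :0 :1 : ∀ {n} → Solver.Polynomial n
  :0 = con (ℤ.+ 0)
  :1 = con (ℤ.+ 1)

  1≢0 : 1# ≢ 0#
  1≢0 e = 0≢1 (sym e)

  -- The default `inv 0# = 0#` makes inversion total, and subfields are closed under it without a
  -- side condition.
  inv : Carrier → Carrier
  inv x with x ≟ 0#
  ... | yes _ = 0#
  ... | no x≢0 = proj₁ (inverse x x≢0)

  inv-r : ∀ {x} → x ≢ 0# → x * inv x ≡ 1#
  inv-r {x} x≢0 with x ≟ 0#
  ... | yes e = ⊥-elim (x≢0 e)
  ... | no ne = proj₂ (inverse x ne)

  inv-l : ∀ {x} → x ≢ 0# → inv x * x ≡ 1#
  inv-l x≢0 = trans (*-comm _ _) (inv-r x≢0)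

  inv≢0 : ∀ {x} → x ≢ 0# → inv x ≢ 0#
  inv≢0 {x} x≢0 e = 1≢0 (trans (sym (inv-r x≢0)) (trans (cong (x *_) e) (zeroʳ x)))

  inv-unique : ∀ {x y} → x * y ≡ 1# → inv x ≡ y
  inv-unique {x} {y} e = begin
    inv x            ≡⟨ *-identityʳ _ ⟨
    inv x * 1#       ≡⟨ cong (inv x *_) e ⟨
    inv x * (x * y)  ≡⟨ *-assoc _ _ _ ⟨
    (inv x * x) * y  ≡⟨ cong (_* y) (inv-l x≢0) ⟩
    1# * y           ≡⟨ *-identityˡ y ⟩
    y ∎
    where
    open ≡-Reasoning
    x≢0 : x ≢ 0#
    x≢0 x0 = 0≢1 (trans (sym (zeroˡ y)) (trans (cong (_* y) (sym x0)) e))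

  *-cancelˡ : ∀ {a x y} → a ≢ 0# → a * x ≡ a * y → x ≡ y
  *-cancelˡ {a} {x} {y} a≢0 e = begin
    x                ≡⟨ *-identityˡ x ⟨
    1# * x           ≡⟨ cong (_* x) (inv-l a≢0) ⟨
    (inv a * a) * x  ≡⟨ *-assoc _ _ _ ⟩
    inv a * (a * x)  ≡⟨ cong (inv a *_) e ⟩
    inv a * (a * y)  ≡⟨ *-assoc _ _ _ ⟨
    (inv a * a) * y  ≡⟨ cong (_* y) (inv-l a≢0) ⟩
    1# * y           ≡⟨ *-identityˡ y ⟩
    y ∎
    where open ≡-Reasoning

  *-zero : ∀ {x y} → x * y ≡ 0# → x ≡ 0# ⊎ y ≡ 0#
  *-zero {x} {y} e with x ≟ 0#
  ... | yes x0 = inj₁ x0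
  ... | no x≢0 = inj₂ (*-cancelˡ x≢0 (trans e (sym (zeroʳ x))))

  *-≢0 : ∀ {x y} → x ≢ 0# → y ≢ 0# → x * y ≢ 0#
  *-≢0 nx ny e with *-zero e
  ... | inj₁ p = nx p
  ... | inj₂ p = ny p

  -‿≡0 : ∀ {x y} → x - y ≡ 0# → x ≡ y
  -‿≡0 {x} {y} e = begin
    x            ≡⟨ solve 2 (λ x y → x := (x :- y) :+ y) refl x y ⟩
    (x - y) + y  ≡⟨ cong (_+ y) e ⟩
    0# + y       ≡⟨ +-identityˡ y ⟩
    y ∎
    where open ≡-Reasoning

  ≡⇒-‿0 : ∀ {x y} → x ≡ y → x - y ≡ 0#
  ≡⇒-‿0 {x} refl = -‿inverseʳ x

  +≡0⇒ : ∀ {x y} → x + y ≡ 0# → x ≡ - y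
  +≡0⇒ {x} {y} e = -‿≡0 (trans (cong (x +_) (-‿involutive y)) e)

  neg-≢0 : ∀ {x} → x ≢ 0# → - x ≢ 0#
  neg-≢0 {x} n e = n (trans (sym (-‿involutive x)) (trans (cong -_ e) -0#≈0#))

  ^-+ : ∀ x m n → x ^ (m ℕ.+ n) ≡ (x ^ m) * (x ^ n)
  ^-+ x zero n = sym (*-identityˡ _)
  ^-+ x (suc m) n = trans (cong (x *_) (^-+ x m n)) (sym (*-assoc _ _ _))

  ^-mul : ∀ x y n → (x * y) ^ n ≡ (x ^ n) * (y ^ n)
  ^-mul x y zero = sym (*-identityˡ _)
  ^-mul x y (suc n) = trans (cong ((x * y) *_) (^-mul x y n))
    (solve 4 (λ x y a b → (x :* y) :* (a :* b) := (x :* a) :* (y :* b)) refl x y (x ^ n) (y ^ n))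

  1^ : ∀ n → 1# ^ n ≡ 1#
  1^ zero = refl
  1^ (suc n) = trans (*-identityˡ _) (1^ n)

  ^-1 : ∀ x → x ^ 1 ≡ x
  ^-1 = *-identityʳ

  ^-* : ∀ x m n → x ^ (m ℕ.* n) ≡ (x ^ m) ^ n
  ^-* x zero n = sym (1^ n)
  ^-* x (suc m) n = trans (^-+ x n (m ℕ.* n))
    (trans (cong ((x ^ n) *_) (^-* x m n)) (sym (^-mul x (x ^ m) n)))

  ^-≢0 : ∀ {x} n → x ≢ 0# → x ^ n ≢ 0#
  ^-≢0 zero _ = 1≢0
  ^-≢0 (suc n) x≢0 = *-≢0 x≢0 (^-≢0 n x≢0)

  ^-≡0 : ∀ {x} n → x ^ n ≡ 0# → x ≡ 0#
  ^-≡0 {x} n e with x ≟ 0#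
  ... | yes p = p
  ... | no ne = ⊥-elim (^-≢0 n ne e)

  0^ : ∀ n → 0 < n → 0# ^ n ≡ 0#
  0^ (suc n) _ = zeroˡ _

  ^-inv : ∀ {x} n → x ≢ 0# → inv x ^ n ≡ inv (x ^ n)
  ^-inv {x} n x≢0 = sym (inv-unique (trans (sym (^-mul x (inv x) n)) (trans (cong (_^ n) (inv-r x≢0)) (1^ n))))

  private
    module R = CommutativeRing ring

  fold-sameSet : {_∙_ : Carrier → Carrier → Carrier} {ε : Carrier} → IsCommutativeMonoid _≡_ _∙_ ε →
    {xs ys : List Carrier} → Unique xs → Unique ys →
    (∀ {x} → x ∈ xs → x ∈ ys) → (∀ {x} → x ∈ ys → x ∈ xs) → foldr _∙_ ε xs ≡ foldr _∙_ ε ys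
  fold-sameSet cm ux uy s t =
    Perm.foldr-commMonoid (setoid Carrier) cm (↭⇒↭ₛ (∼bag⇒↭ (unique∧set⇒bag ux uy (mk⇔ s t))))

  -- Translating by 1 permutes the field, so summing all elements gives order · 1 = 0.
  natF-order : natF order ≡ 0#
  natF-order = begin
    natF order                       ≡⟨ solve 2 (λ n s → n := (n :+ s) :- s) refl (natF order) s ⟩
    (natF order + s) - s             ≡⟨ cong (_- s) (shift elements) ⟨
    foldr _+_ 0# (map (1# +_) elements) - s
      ≡⟨ cong (_- s) (fold-sameSet R.+-isCommutativeMonoid (map⁺ inj unique) unique (λ {x} _ → complete x) back) ⟩
    s - s                            ≡⟨ -‿inverseʳ s ⟩
    0# ∎
    where
    open ≡-Reasoning
    s = foldr _+_ 0# elements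
    inj : ∀ {x y} → 1# + x ≡ 1# + y → x ≡ y
    inj {x} {y} e = trans (solve 1 (λ x → x := (:1 :+ x) :- :1) refl x)
      (trans (cong (_- 1#) e) (sym (solve 1 (λ x → x := (:1 :+ x) :- :1) refl y)))
    back : ∀ {x} → x ∈ elements → x ∈ map (1# +_) elements
    back {x} _ = subst (_∈ map (1# +_) elements) (solve 1 (λ x → :1 :+ (x :- :1) := x) refl x)
      (∈-map⁺ (1# +_) (complete (x - 1#)))
    shift : ∀ xs → foldr _+_ 0# (map (1# +_) xs) ≡ natF (length xs) + foldr _+_ 0# xs
    shift [] = sym (+-identityˡ 0#)
    shift (x ∷ xs) = begin
      (1# + x) + foldr _+_ 0# (map (1# +_) xs)         ≡⟨ cong ((1# + x) +_) (shift xs) ⟩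
      (1# + x) + (natF (length xs) + foldr _+_ 0# xs)  ≡⟨ solve 3
        (λ x n s → (:1 :+ x) :+ (n :+ s) := (:1 :+ n) :+ (x :+ s)) refl x (natF (length xs)) _ ⟩
      (1# + natF (length xs)) + (x + foldr _+_ 0# xs)  ≡⟨ cong (_+ (x + foldr _+_ 0# xs)) (natF-suc (length xs)) ⟨
      natF (suc (length xs)) + (x + foldr _+_ 0# xs)   ∎

  nonzeros : List Carrier → List Carrier
  nonzeros = filter (λ x → ¬? (x ≟ 0#))

  ∈nonzeros⁻ : ∀ {xs x} → x ∈ nonzeros xs → x ∈ xs × x ≢ 0#
  ∈nonzeros⁻ {xs} = ∈-filter⁻ (λ x → ¬? (x ≟ 0#)) {xs = xs}

  ∈nonzeros : ∀ {xs x} → x ∈ xs → x ≢ 0# → x ∈ nonzeros xs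
  ∈nonzeros = ∈-filter⁺ (λ x → ¬? (x ≟ 0#))

  nonzeros-unique : ∀ {xs} → Unique xs → Unique (nonzeros xs)
  nonzeros-unique = filter⁺ _

  length-nonzeros : ∀ {xs} → Unique xs → 0# ∈ xs → suc (length (nonzeros xs)) ≡ length xs
  length-nonzeros {xs} u 0∈ = unique-⊆-length-≡ {xs = 0# ∷ nonzeros xs} {xs}
    (All.tabulate (λ p e → proj₂ (∈nonzeros⁻ {xs} p) (sym e)) ∷ nonzeros-unique u) u into back
    where
    into : ∀ {x} → x ∈ 0# ∷ nonzeros xs → x ∈ xs
    into (here refl) = 0∈
    into (there p) = proj₁ (∈nonzeros⁻ {xs} p)
    back : ∀ {x} → x ∈ xs → x ∈ 0# ∷ nonzeros xs
    back {x} p with x ≟ 0#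
    ... | yes e = here e
    ... | no n = there (∈nonzeros p n)

  elements* : List Carrier
  elements* = nonzeros elements

  ∈* : ∀ {x} → x ≢ 0# → x ∈ elements*
  ∈* {x} = ∈nonzeros (complete x)

  ∈*⁻ : ∀ {x} → x ∈ elements* → x ≢ 0#
  ∈*⁻ p = proj₂ (∈nonzeros⁻ {elements} p)

  unique* : Unique elements*
  unique* = nonzeros-unique unique

  length* : suc (length elements*) ≡ order
  length* = length-nonzeros unique (complete 0#)

  -- Multiplication by x permutes the nonzero elements, so their product absorbs x^(order-1).
  fermat : ∀ x → x ^ order ≡ x
  fermat x with x ≟ 0#
  ... | yes refl = subst (λ n → 0# ^ n ≡ 0#) length* (zeroˡ _)
  ... | no x≢0 = subst (λ n → x ^ n ≡ x) length* (trans (cong (x *_) pow) (*-identityʳ x))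
    where
    open ≡-Reasoning
    P = foldr _*_ 1# elements*
    prod≢0 : ∀ xs → (∀ {y} → y ∈ xs → y ≢ 0#) → foldr _*_ 1# xs ≢ 0#
    prod≢0 [] _ = 1≢0
    prod≢0 (y ∷ ys) n = *-≢0 (n (here refl)) (prod≢0 ys (n ∘ there))
    scale : ∀ xs → foldr _*_ 1# (map (x *_) xs) ≡ x ^ length xs * foldr _*_ 1# xs
    scale [] = sym (*-identityˡ 1#)
    scale (y ∷ ys) = trans (cong (x * y *_) (scale ys))
      (solve 4 (λ x y a b → (x :* y) :* (a :* b) := (x :* a) :* (y :* b)) refl x y _ _)
    into : ∀ {y} → y ∈ map (x *_) elements* → y ∈ elements*
    into p with ∈-map⁻ (x *_) p
    ... | y , y∈ , refl = ∈* (*-≢0 x≢0 (∈*⁻ y∈))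
    back : ∀ {y} → y ∈ elements* → y ∈ map (x *_) elements*
    back {y} p = subst (_∈ map (x *_) elements*)
      (trans (sym (*-assoc x (inv x) y)) (trans (cong (_* y) (inv-r x≢0)) (*-identityˡ y)))
      (∈-map⁺ (x *_) (∈* (*-≢0 (inv≢0 x≢0) (∈*⁻ p))))
    pow : x ^ length elements* ≡ 1#
    pow = *-cancelˡ (prod≢0 elements* ∈*⁻) (begin
      P * x ^ length elements*          ≡⟨ *-comm _ _ ⟩
      x ^ length elements* * P          ≡⟨ scale elements* ⟨
      foldr _*_ 1# (map (x *_) elements*) ≡⟨ fold-sameSet R.*-isCommutativeMonoid (map⁺ (*-cancelˡ x≢0) unique*)
        unique* into back ⟩
      P                                 ≡⟨ *-identityʳ P ⟨
      P * 1#                            ∎)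

  natF-^ : ∀ m n → natF (m ℕ.^ n) ≡ natF m ^ n
  natF-^ m zero = refl
  natF-^ m (suc n) = trans (natF-* m (m ℕ.^ n)) (cong (natF m *_) (natF-^ m n))

  -- The element p^n·1 = order·1 is zero, and a field has no nilpotent elements.
  char-from-order : ∀ p n → order ≡ p ℕ.^ n → natF p ≡ 0#
  char-from-order p n e = ^-≡0 n (trans (sym (natF-^ p n)) (trans (cong natF (sym e)) natF-order))

  prime∤! : ∀ {p} → Prime p → ∀ k → k < p → ¬ (p ∣ k !)
  prime∤! {p} pp zero _ d = ℕₚ.<⇒≢ (ℕ.nonTrivial⇒n>1 p {{prime⇒nonTrivial pp}}) (sym (∣1⇒≡1 d))
  prime∤! {p} pp (suc k) lt d with euclidsLemma (suc k) (k !) pp d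
  ... | inj₁ d₁ = ℕₚ.<⇒≱ lt (∣⇒≤ d₁)
  ... | inj₂ d₂ = prime∤! pp k (ℕₚ.<-trans (ℕₚ.n<1+n k) lt) d₂

  -- The prime p divides p! = C(p,k)·k!·(p-k)!, but neither of the two smaller factorials.
  prime∣C : ∀ {p} → Prime p → ∀ k → 0 < k → k < p → p ∣ p choose k
  prime∣C {suc p} pp k 0<k k<p with euclidsLemma (suc p choose k) (k ! ℕ.* (suc p ∸ k) !) pp
    (subst (suc p ∣_) (sym eq) (m∣m*n (p !)))
    where
    instance _ = k ℕₚ.!* (suc p ∸ k) !≢0
    eq : (suc p choose k) ℕ.* (k ! ℕ.* (suc p ∸ k) !) ≡ suc p !
    eq = trans (cong (ℕ._* (k ! ℕ.* (suc p ∸ k) !)) (nCk≡n!/k![n-k]! (ℕₚ.<⇒≤ k<p)))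
      (m/n*n≡m (k![n∸k]!∣n! (ℕₚ.<⇒≤ k<p)))
  ... | inj₁ d = d
  ... | inj₂ d with euclidsLemma (k !) ((suc p ∸ k) !) pp d
  ...   | inj₁ d₁ = ⊥-elim (prime∤! pp k k<p d₁)
  ...   | inj₂ d₂ = ⊥-elim (prime∤! pp (suc p ∸ k) (ℕₚ.∸-monoʳ-< 0<k (ℕₚ.<⇒≤ k<p)) d₂)

  module Frobenius {p : ℕ} (pp : Prime p) (natF-p : natF p ≡ 0#) where

    private
      module Bin = Algebra.Properties.CommutativeSemiring.Binomial R.commutativeSemiring
      open import Algebra.Properties.Semiring.Exp R.semiring using () renaming (_^_ to _^′_)
      open import Algebra.Properties.Semiring.Sum R.semiring using (sum; sum-init-last; sum-cong-≗; sum-replicate-zero)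
      open import Algebra.Properties.Semiring.Mult R.semiring using () renaming (_×_ to _×′_)

      ^≡ : ∀ x n → x ^′ n ≡ x ^ n
      ^≡ x zero = refl
      ^≡ x (suc n) = cong (x *_) (^≡ x n)

      ×≡ : ∀ n x → n ×′ x ≡ natF n * x
      ×≡ zero x = sym (zeroˡ x)
      ×≡ (suc n) x = trans (cong (x +_) (×≡ n x))
        (trans (solve 2 (λ x a → x :+ a :* x := (:1 :+ a) :* x) refl x (natF n)) (cong (_* x) (sym (natF-suc n))))

      natF-∣ : ∀ {n} → p ∣ n → natF n ≡ 0#
      natF-∣ (divides m refl) = trans (natF-* m p) (trans (cong (natF m *_) natF-p) (zeroʳ _))

    frob-+ : ∀ x y → (x + y) ^ p ≡ x ^ p + y ^ p
    frob-+ x y = go p pp natF-∣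
      where
      open ≡-Reasoning
      -- The prime becomes a variable that can be matched with a successor; the binomial sum then
      -- splits into its two end terms and the middle ones, which the characteristic kills.
      go : ∀ n → Prime n → (∀ {m} → n ∣ m → natF m ≡ 0#) → (x + y) ^ n ≡ x ^ n + y ^ n
      go zero pn _ = ⊥-elim (ℕ.≢-nonZero⁻¹ 0 {{prime⇒nonZero pn}} refl)
      go n@(suc n′) pn div = begin
        (x + y) ^ n                   ≡⟨ ^≡ (x + y) n ⟨
        (x + y) ^′ n                  ≡⟨ Bin.theorem n x y ⟩
        f Fin.zero + sum (λ k → f (Fin.suc k)) ≡⟨ cong₂ _+_ first (sum-init-last (λ k → f (Fin.suc k))) ⟩
        y ^ n + (sum (λ k → f (Fin.suc (inject₁ k))) + f (Fin.suc (fromℕ n′)))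
          ≡⟨ cong (y ^ n +_) (cong₂ _+_ (trans (sum-cong-≗ mid) (sum-replicate-zero n′)) final) ⟩
        y ^ n + (0# + x ^ n)          ≡⟨ solve 2 (λ a b → a :+ (:0 :+ b) := b :+ a) refl (y ^ n) (x ^ n) ⟩
        x ^ n + y ^ n ∎
        where
        f : Fin (suc n) → Carrier
        f = Bin.binomialTerm x y n
        first : f Fin.zero ≡ y ^ n
        first = trans (×≡ 1 _) (trans (*-identityˡ _) (trans (*-identityˡ _) (^≡ y n)))
        final : f (Fin.suc (fromℕ n′)) ≡ x ^ n
        final rewrite Finₚ.toℕ-fromℕ n′ | nCn≡1 n | ℕₚ.n∸n≡0 n′ =
          trans (×≡ 1 _) (trans (*-identityˡ _) (trans (*-identityʳ _) (^≡ x n)))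
        mid : ∀ k → f (Fin.suc (inject₁ k)) ≡ 0#
        mid k = trans (×≡ (n choose toℕ (Fin.suc (inject₁ k))) _)
          (trans (cong (_* Bin.binomial x y n (Fin.suc (inject₁ k))) (div (prime∣C pn _ (s≤s z≤n)
          (s≤s (subst (_< n′) (sym (Finₚ.toℕ-inject₁ k)) (Finₚ.toℕ<n k)))))) (zeroˡ _))

    frob-+^ : ∀ e x y → (x + y) ^ (p ℕ.^ e) ≡ x ^ (p ℕ.^ e) + y ^ (p ℕ.^ e)
    frob-+^ zero x y = trans (^-1 _) (sym (cong₂ _+_ (^-1 x) (^-1 y)))
    frob-+^ (suc e) x y = begin
      (x + y) ^ (p ℕ.* p ℕ.^ e)                    ≡⟨ ^-* (x + y) p (p ℕ.^ e) ⟩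
      ((x + y) ^ p) ^ (p ℕ.^ e)                    ≡⟨ cong (_^ (p ℕ.^ e)) (frob-+ x y) ⟩
      (x ^ p + y ^ p) ^ (p ℕ.^ e)                  ≡⟨ frob-+^ e (x ^ p) (y ^ p) ⟩
      (x ^ p) ^ (p ℕ.^ e) + (y ^ p) ^ (p ℕ.^ e)    ≡⟨ cong₂ _+_ (^-* x p (p ℕ.^ e)) (^-* y p (p ℕ.^ e)) ⟨
      x ^ (p ℕ.* p ℕ.^ e) + y ^ (p ℕ.* p ℕ.^ e)    ∎
      where open ≡-Reasoning

    private
      0<p : 0 < p
      0<p = ℕ.>-nonZero⁻¹ p {{prime⇒nonZero pp}}

    -- The exponent cannot be recovered from n by unification, so it is carried along. This lets one
    -- set of lemmas serve p, r, q and every m and s between them.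
    record FrobExp (n : ℕ) : Set where
      field
        exponent : ℕ
        n≡ : n ≡ p ℕ.^ exponent

    module _ {n : ℕ} (fe : FrobExp n) where
      open FrobExp fe
      frob+ : ∀ x y → (x + y) ^ n ≡ x ^ n + y ^ n
      frob+ x y = subst (λ n → (x + y) ^ n ≡ x ^ n + y ^ n) (sym n≡) (frob-+^ exponent x y)
      frob>0 : 0 < n
      frob>0 = subst (0 <_) (sym n≡) (ℕₚ.m^n>0 p {{ℕ.>-nonZero 0<p}} exponent)
      frob0 : 0# ^ n ≡ 0#
      frob0 = 0^ n frob>0
      frob-neg : ∀ x → (- x) ^ n ≡ - (x ^ n)
      frob-neg x = +≡0⇒ (trans (sym (frob+ (- x) x)) (trans (cong (_^ n) (-‿inverseˡ x)) frob0))
      frob-sub : ∀ x y → (x - y) ^ n ≡ x ^ n - y ^ n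
      frob-sub x y = trans (frob+ x (- y)) (cong (x ^ n +_) (frob-neg y))
      frob-inj : ∀ {x y} → x ^ n ≡ y ^ n → x ≡ y
      frob-inj {x} {y} e = -‿≡0 (^-≡0 n (trans (frob-sub x y) (≡⇒-‿0 e)))

-- Polynomials, their roots and derivatives

module Polynomials (F : FiniteField) where

  open FieldTheory F

  -- Polynomials are coefficient lists, constant term first; trailing zeros are allowed.
  Poly : Set
  Poly = List Carrier

  eval : Poly → Carrier → Carrier
  eval [] x = 0#
  eval (c ∷ cs) x = c + x * eval cs x

  coef : Poly → ℕ → Carrier
  coef [] _ = 0#
  coef (c ∷ cs) zero = c
  coef (c ∷ cs) (suc i) = coef cs i

  Zero : Poly → Set
  Zero f = ∀ i → coef f i ≡ 0#

  _≋_ : Poly → Poly → Set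
  f ≋ g = ∀ i → coef f i ≡ coef g i

  coef-≥ : ∀ f {i} → length f ≤ i → coef f i ≡ 0#
  coef-≥ [] _ = refl
  coef-≥ (c ∷ f) (s≤s le) = coef-≥ f le

  eval-Zero : ∀ f → Zero f → ∀ x → eval f x ≡ 0#
  eval-Zero [] _ x = refl
  eval-Zero (c ∷ f) z x = trans (cong₂ _+_ (z 0) (trans (cong (x *_) (eval-Zero f (z ∘ suc) x)) (zeroʳ x)))
    (+-identityˡ 0#)

  eval-≋ : ∀ f g → f ≋ g → ∀ x → eval f x ≡ eval g x
  eval-≋ [] g e x = sym (eval-Zero g (sym ∘ e) x)
  eval-≋ (c ∷ f) [] e x = eval-Zero (c ∷ f) e x
  eval-≋ (c ∷ f) (d ∷ g) e x = cong₂ (λ a b → a + x * b) (e 0) (eval-≋ f g (e ∘ suc) x)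

  addP : Poly → Poly → Poly
  addP [] g = g
  addP f@(_ ∷ _) [] = f
  addP (c ∷ f) (d ∷ g) = (c + d) ∷ addP f g

  scaleP : Carrier → Poly → Poly
  scaleP a = map (a *_)

  negP : Poly → Poly
  negP = map (λ x → - x)

  mulP : Poly → Poly → Poly
  mulP [] g = []
  mulP (c ∷ f) g = addP (scaleP c g) (0# ∷ mulP f g)

  padP : ℕ → Poly → Poly
  padP zero f = f
  padP (suc n) f = 0# ∷ padP n f

  mono : ℕ → Poly
  mono n = padP n (1# ∷ [])

  length-addP : ∀ f g {n} → length f ≤ n → length g ≤ n → length (addP f g) ≤ n
  length-addP [] g _ b = b
  length-addP (c ∷ f) [] a _ = a
  length-addP (c ∷ f) (d ∷ g) (s≤s a) (s≤s b) = s≤s (length-addP f g a b)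

  length-scaleP : ∀ a f {n} → length f ≤ n → length (scaleP a f) ≤ n
  length-scaleP a f = subst (_≤ _) (sym (length-map _ f))

  length-negP : ∀ f {n} → length f ≤ n → length (negP f) ≤ n
  length-negP f = subst (_≤ _) (sym (length-map _ f))

  length-mulP : ∀ f g a b → length f ≤ suc a → length g ≤ suc b → length (mulP f g) ≤ suc (a ℕ.+ b)
  length-mulP [] g a b _ _ = z≤n
  length-mulP (c ∷ []) g a b _ lg = length-addP (scaleP c g) (0# ∷ [])
    (length-scaleP c g (ℕₚ.≤-trans lg (s≤s (ℕₚ.m≤n+m b a)))) (s≤s z≤n)
  length-mulP (c ∷ f@(_ ∷ _)) g (suc a) b (s≤s lf) lg = length-addP (scaleP c g) (0# ∷ mulP f g)
    (length-scaleP c g (ℕₚ.≤-trans lg (s≤s (ℕₚ.m≤n+m b (suc a))))) (s≤s (length-mulP f g a b lf lg))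

  length-padP : ∀ n f → length (padP n f) ≡ n ℕ.+ length f
  length-padP zero f = refl
  length-padP (suc n) f = cong suc (length-padP n f)

  length-mono : ∀ n → length (mono n) ≡ suc n
  length-mono n = trans (length-padP n _) (ℕₚ.+-comm n 1)

  eval-addP : ∀ f g x → eval (addP f g) x ≡ eval f x + eval g x
  eval-addP [] g x = sym (+-identityˡ _)
  eval-addP (c ∷ f) [] x = sym (+-identityʳ _)
  eval-addP (c ∷ f) (d ∷ g) x = trans (cong (λ t → c + d + x * t) (eval-addP f g x))
    (solve 5 (λ c d x a b → c :+ d :+ x :* (a :+ b) := (c :+ x :* a) :+ (d :+ x :* b)) refl c d x _ _)

  eval-scaleP : ∀ a f x → eval (scaleP a f) x ≡ a * eval f x
  eval-scaleP a [] x = sym (zeroʳ a)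
  eval-scaleP a (c ∷ f) x = trans (cong (λ t → a * c + x * t) (eval-scaleP a f x))
    (solve 4 (λ a c x e → a :* c :+ x :* (a :* e) := a :* (c :+ x :* e)) refl a c x _)

  eval-negP : ∀ f x → eval (negP f) x ≡ - eval f x
  eval-negP [] x = sym -0#≈0#
  eval-negP (c ∷ f) x = trans (cong (λ t → - c + x * t) (eval-negP f x))
    (solve 3 (λ c x e → :- c :+ x :* (:- e) := :- (c :+ x :* e)) refl c x _)

  eval-mulP : ∀ f g x → eval (mulP f g) x ≡ eval f x * eval g x
  eval-mulP [] g x = sym (zeroˡ _)
  eval-mulP (c ∷ f) g x = trans (eval-addP (scaleP c g) _ x)
    (trans (cong₂ (λ s t → s + (0# + x * t)) (eval-scaleP c g x) (eval-mulP f g x))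
      (solve 4 (λ c x a b → c :* b :+ (:0 :+ x :* (a :* b)) := (c :+ x :* a) :* b) refl c x _ _))

  eval-padP : ∀ n f x → eval (padP n f) x ≡ x ^ n * eval f x
  eval-padP zero f x = sym (*-identityˡ _)
  eval-padP (suc n) f x = trans (+-identityˡ _) (trans (cong (x *_) (eval-padP n f x)) (sym (*-assoc _ _ _)))

  eval-mono : ∀ n x → eval (mono n) x ≡ x ^ n
  eval-mono n x = trans (eval-padP n (1# ∷ []) x) (solve 2 (λ a x → a :* (:1 :+ x :* :0) := a) refl (x ^ n) x)

  coef-addP : ∀ f g i → coef (addP f g) i ≡ coef f i + coef g i
  coef-addP [] g i = sym (+-identityˡ _)
  coef-addP (c ∷ f) [] i = sym (+-identityʳ _)
  coef-addP (c ∷ f) (d ∷ g) zero = refl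
  coef-addP (c ∷ f) (d ∷ g) (suc i) = coef-addP f g i

  coef-scaleP : ∀ a f i → coef (scaleP a f) i ≡ a * coef f i
  coef-scaleP a [] i = sym (zeroʳ a)
  coef-scaleP a (c ∷ f) zero = refl
  coef-scaleP a (c ∷ f) (suc i) = coef-scaleP a f i

  coef-negP : ∀ f i → coef (negP f) i ≡ - coef f i
  coef-negP [] i = sym -0#≈0#
  coef-negP (c ∷ f) zero = refl
  coef-negP (c ∷ f) (suc i) = coef-negP f i

  coef-padP-< : ∀ n f {i} → i < n → coef (padP n f) i ≡ 0#
  coef-padP-< (suc n) f {zero} _ = refl
  coef-padP-< (suc n) f {suc i} (s≤s lt) = coef-padP-< n f lt

  coef-mono-≢ : ∀ n {i} → i ≢ n → coef (mono n) i ≡ 0#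
  coef-mono-≢ zero {zero} ne = ⊥-elim (ne refl)
  coef-mono-≢ zero {suc i} _ = refl
  coef-mono-≢ (suc n) {zero} _ = refl
  coef-mono-≢ (suc n) {suc i} ne = coef-mono-≢ n (ne ∘ cong suc)

  coef-mono-≡ : ∀ n → coef (mono n) n ≡ 1#
  coef-mono-≡ zero = refl
  coef-mono-≡ (suc n) = coef-mono-≡ n

  -- Synthetic division: Horner's tails evaluated at z are the coefficients of the quotient by X - z.
  quotP : Carrier → Poly → Poly
  quotP z [] = []
  quotP z (c ∷ cs) = eval (c ∷ cs) z ∷ quotP z cs

  length-quotP : ∀ z f → length (quotP z f) ≡ length f
  length-quotP z [] = refl
  length-quotP z (c ∷ f) = cong suc (length-quotP z f)

  eval-quotP : ∀ z c f x → eval (c ∷ f) x ≡ eval (c ∷ f) z + (x - z) * eval (quotP z f) x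
  eval-quotP z c [] x = solve 3 (λ z c x → c :+ x :* :0 := (c :+ z :* :0) :+ (x :- z) :* :0) refl z c x
  eval-quotP z c f@(d ∷ f′) x = begin
    c + x * eval f x                                    ≡⟨ cong (λ t → c + x * t) (eval-quotP z d f′ x) ⟩
    c + x * (eval f z + (x - z) * eval (quotP z f′) x)  ≡⟨ solve 5
      (λ c x z e w → c :+ x :* (e :+ (x :- z) :* w) := (c :+ z :* e) :+ (x :- z) :* (e :+ x :* w)) refl c x z
      (eval f z) _ ⟩
    (c + z * eval f z) + (x - z) * (eval f z + x * eval (quotP z f′) x) ∎
    where open ≡-Reasoning

  quotP-Zero : ∀ z f → Zero (quotP z f) → Zero f
  quotP-Zero z [] _ i = refl
  quotP-Zero z (c ∷ f) q zero = begin
    c                                    ≡⟨ solve 2 (λ c e → c := (c :+ e) :- e) refl c (z * eval f z) ⟩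
    (c + z * eval f z) - z * eval f z    ≡⟨ cong₂ _-_ (q 0)
      (trans (cong (z *_) (eval-Zero f (quotP-Zero z f (q ∘ suc)) z)) (zeroʳ z)) ⟩
    0# - 0#                              ≡⟨ -‿inverseʳ 0# ⟩
    0# ∎
    where open ≡-Reasoning
  quotP-Zero z (c ∷ f) q (suc i) = quotP-Zero z f (q ∘ suc) i

  -- Divide by X - z for the first root z: every other root survives in the quotient. Degrees are
  -- measured by list lengths, a list of length n having degree below n.
  roots⇒Zero : ∀ f {zs} → Unique zs → (∀ {z} → z ∈ zs → eval f z ≡ 0#) → length f ≤ length zs → Zero f
  roots⇒Zero [] _ _ _ i = refl
  roots⇒Zero (c ∷ f) {z ∷ zs} (z∉ ∷ u) root (s≤s le) = zero-at
    where
    quot0 : Zero (quotP z f)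
    quot0 = roots⇒Zero (quotP z f) u (λ {w} w∈ → root′ w∈) (subst (_≤ length zs) (sym (length-quotP z f)) le)
      where
      root′ : ∀ {w} → w ∈ zs → eval (quotP z f) w ≡ 0#
      root′ {w} w∈ with *-zero {w - z} {eval (quotP z f) w} (begin
          (w - z) * eval (quotP z f) w                    ≡⟨ +-identityˡ _ ⟨
          0# + (w - z) * eval (quotP z f) w               ≡⟨ cong (_+ (w - z) * eval (quotP z f) w) (root (here refl)) ⟨
          eval (c ∷ f) z + (w - z) * eval (quotP z f) w   ≡⟨ eval-quotP z c f w ⟨
          eval (c ∷ f) w                                  ≡⟨ root (there w∈) ⟩
          0# ∎)
        where open ≡-Reasoning
      ... | inj₁ e = ⊥-elim (All.lookup z∉ w∈ (sym (-‿≡0 e)))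
      ... | inj₂ e = e
    zero-at : Zero (c ∷ f)
    zero-at = quotP-Zero z (c ∷ f) λ { zero → root (here refl) ; (suc i) → quot0 i }

  evalAll0⇒Zero : ∀ f → length f ≤ order → (∀ x → eval f x ≡ 0#) → Zero f
  evalAll0⇒Zero f le e = roots⇒Zero f unique (λ {z} _ → e z) le

  -- This licenses arguing with values instead of coefficients, and it is why later lemmas carry
  -- bounds by `order`.
  eval⇒≋ : ∀ f g → length f ≤ order → length g ≤ order → (∀ x → eval f x ≡ eval g x) → f ≋ g
  eval⇒≋ f g lf lg e i = -‿≡0 (trans (cong (coef f i +_) (sym (coef-negP g i)))
    (trans (sym (coef-addP f (negP g) i))
      (evalAll0⇒Zero (addP f (negP g)) (length-addP f (negP g) lf (length-negP g lg))
      (λ x → trans (eval-addP f (negP g) x) (trans (cong₂ _+_ (e x) (eval-negP g x)) (-‿inverseʳ _))) i)))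

  -- Either f has at least `length f` zeros, or so many points remain outside them that g, which
  -- vanishes there, has at least `length g` zeros. No leading coefficients are involved.
  mul-Zero : ∀ f g → length f ℕ.+ length g ≤ order → (∀ x → eval f x * eval g x ≡ 0#) → Zero f ⊎ Zero g
  mul-Zero f g le e with length f ℕ.≤? length (filter (λ x → eval f x ≟ 0#) elements)
  ... | yes p = inj₁ (roots⇒Zero f (filter⁺ _ unique)
    (λ z∈ → proj₂ (∈-filter⁻ (λ x → eval f x ≟ 0#) {xs = elements} z∈)) p)
  ... | no ¬p = inj₂ (roots⇒Zero g (filter⁺ _ unique) root le′)
    where
    zs = filter (λ x → eval f x ≟ 0#) elements
    ws = filter (λ x → ¬? (eval f x ≟ 0#)) elements
    root : ∀ {z} → z ∈ ws → eval g z ≡ 0#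
    root {z} z∈ with *-zero (e z)
    ... | inj₁ e₁ = ⊥-elim (proj₂ (∈-filter⁻ (λ x → ¬? (eval f x ≟ 0#)) {xs = elements} z∈) e₁)
    ... | inj₂ e₂ = e₂
    le′ : length g ≤ length ws
    le′ = ℕₚ.+-cancelˡ-≤ (length zs) _ _ (ℕₚ.≤-trans (ℕₚ.+-monoˡ-≤ (length g) (ℕₚ.<⇒≤ (ℕₚ.≰⇒> ¬p)))
      (subst (length f ℕ.+ length g ≤_) (sym (filter-count (λ x → eval f x ≟ 0#) elements)) le))

  -- As a formal expression this is X^(1-n)·(X^n f)′. The start 1 serves the tail of a list being
  -- differentiated, and the start 0 gives X f′.
  derivFrom : ℕ → Poly → Poly
  derivFrom n [] = []
  derivFrom n (c ∷ cs) = natF n * c ∷ derivFrom (suc n) cs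

  deriv : Poly → Poly
  deriv [] = []
  deriv (c ∷ cs) = derivFrom 1 cs

  length-derivFrom : ∀ n f → length (derivFrom n f) ≡ length f
  length-derivFrom n [] = refl
  length-derivFrom n (c ∷ f) = cong suc (length-derivFrom (suc n) f)

  length-deriv : ∀ f {n} → length f ≤ suc n → length (deriv f) ≤ n
  length-deriv [] _ = z≤n
  length-deriv (c ∷ f) (s≤s le) = subst (_≤ _) (sym (length-derivFrom 1 f)) le

  coef-derivFrom : ∀ n f i → coef (derivFrom n f) i ≡ natF (i ℕ.+ n) * coef f i
  coef-derivFrom n [] i = sym (zeroʳ _)
  coef-derivFrom n (c ∷ f) zero = refl
  coef-derivFrom n (c ∷ f) (suc i) = trans (coef-derivFrom (suc n) f i) (cong (λ k → natF k * coef f i) (ℕₚ.+-suc i n))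

  coef-deriv : ∀ f i → coef (deriv f) i ≡ natF (suc i) * coef f (suc i)
  coef-deriv [] i = sym (zeroʳ _)
  coef-deriv (c ∷ f) i = trans (coef-derivFrom 1 f i) (cong (λ k → natF k * coef f i) (ℕₚ.+-comm i 1))

  deriv-≋ : ∀ f g → f ≋ g → deriv f ≋ deriv g
  deriv-≋ f g e i = trans (coef-deriv f i) (trans (cong (natF (suc i) *_) (e (suc i))) (sym (coef-deriv g i)))

  private
    eval-derivFrom : ∀ n f x → eval (derivFrom (suc n) f) x ≡ eval f x + eval (derivFrom n f) x
    eval-derivFrom n [] x = sym (+-identityˡ 0#)
    eval-derivFrom n (c ∷ f) x = trans (cong₂ (λ a b → a * c + x * b) (natF-suc n) (eval-derivFrom (suc n) f x))
      (solve 5 (λ n c x a b → (:1 :+ n) :* c :+ x :* (a :+ b) := (c :+ x :* a) :+ (n :* c :+ x :* b)) refl (natF n) c x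
        _ _)

    eval-derivFrom0 : ∀ f x → eval (derivFrom 0 f) x ≡ x * eval (deriv f) x
    eval-derivFrom0 [] x = sym (zeroʳ x)
    eval-derivFrom0 (c ∷ f) x = trans (cong (_+ x * eval (derivFrom 1 f) x) (zeroˡ c)) (+-identityˡ _)

  eval-deriv-∷ : ∀ c f x → eval (deriv (c ∷ f)) x ≡ eval f x + x * eval (deriv f) x
  eval-deriv-∷ c f x = trans (eval-derivFrom 0 f x) (cong (eval f x +_) (eval-derivFrom0 f x))

  eval-deriv-addP : ∀ f g x → eval (deriv (addP f g)) x ≡ eval (deriv f) x + eval (deriv g) x
  eval-deriv-addP f g x = trans (eval-≋ (deriv (addP f g)) (addP (deriv f) (deriv g)) eq x)
    (eval-addP (deriv f) (deriv g) x)
    where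
    eq : deriv (addP f g) ≋ addP (deriv f) (deriv g)
    eq i = trans (coef-deriv (addP f g) i) (trans (cong (natF (suc i) *_) (coef-addP f g (suc i)))
      (trans (distribˡ _ _ _) (sym (trans (coef-addP (deriv f) (deriv g) i)
        (cong₂ _+_ (coef-deriv f i) (coef-deriv g i))))))

  eval-deriv-scaleP : ∀ a f x → eval (deriv (scaleP a f)) x ≡ a * eval (deriv f) x
  eval-deriv-scaleP a f x = trans (eval-≋ (deriv (scaleP a f)) (scaleP a (deriv f)) eq x) (eval-scaleP a (deriv f) x)
    where
    eq : deriv (scaleP a f) ≋ scaleP a (deriv f)
    eq i = trans (coef-deriv (scaleP a f) i) (trans (cong (natF (suc i) *_) (coef-scaleP a f (suc i)))
      (trans (solve 3 (λ n a c → n :* (a :* c) := a :* (n :* c)) refl _ a _)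
        (sym (trans (coef-scaleP a (deriv f) i) (cong (a *_) (coef-deriv f i))))))

  eval-deriv-negP : ∀ f x → eval (deriv (negP f)) x ≡ - eval (deriv f) x
  eval-deriv-negP f x = trans (eval-≋ (deriv (negP f)) (negP (deriv f)) eq x) (eval-negP (deriv f) x)
    where
    eq : deriv (negP f) ≋ negP (deriv f)
    eq i = trans (coef-deriv (negP f) i) (trans (cong (natF (suc i) *_) (coef-negP f (suc i)))
      (trans (solve 2 (λ n c → n :* (:- c) := :- (n :* c)) refl _ _)
        (sym (trans (coef-negP (deriv f) i) (cong -_ (coef-deriv f i))))))

  eval-deriv-mulP : ∀ f g x → eval (deriv (mulP f g)) x ≡ eval (deriv f) x * eval g x + eval f x * eval (deriv g) x
  eval-deriv-mulP [] g x = solve 2 (λ a b → :0 := :0 :* a :+ :0 :* b) refl _ _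
  eval-deriv-mulP (c ∷ f) g x = begin
    eval (deriv (addP (scaleP c g) (0# ∷ mulP f g))) x
      ≡⟨ eval-deriv-addP (scaleP c g) (0# ∷ mulP f g) x ⟩
    eval (deriv (scaleP c g)) x + eval (deriv (0# ∷ mulP f g)) x
      ≡⟨ cong₂ _+_ (eval-deriv-scaleP c g x)
        (trans (eval-deriv-∷ 0# (mulP f g) x) (cong₂ (λ a b → a + x * b) (eval-mulP f g x) (eval-deriv-mulP f g x))) ⟩
    c * g′ + (f₀ * g₀ + x * (f′ * g₀ + f₀ * g′))
      ≡⟨ solve 6 (λ c x f₀ g₀ f′ g′ → c :* g′ :+ (f₀ :* g₀ :+ x :* (f′ :* g₀ :+ f₀ :* g′)) := (f₀ :+ x :* f′) :* g₀ :+
        (c :+ x :* f₀) :* g′) refl c x f₀ g₀ f′ g′ ⟩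
    (f₀ + x * f′) * g₀ + (c + x * f₀) * g′
      ≡⟨ cong (λ t → t * g₀ + (c + x * f₀) * g′) (eval-deriv-∷ c f x) ⟨
    eval (deriv (c ∷ f)) x * g₀ + (c + x * f₀) * g′ ∎
    where
    open ≡-Reasoning
    f₀ = eval f x
    g₀ = eval g x
    f′ = eval (deriv f) x
    g′ = eval (deriv g) x

  compP : Poly → Poly → Poly
  compP [] g = []
  compP (c ∷ f) g = addP (c ∷ []) (mulP (compP f g) g)

  eval-compP : ∀ f g x → eval (compP f g) x ≡ eval f (eval g x)
  eval-compP [] g x = refl
  eval-compP (c ∷ f) g x = trans (eval-addP (c ∷ []) (mulP (compP f g) g) x)
    (cong₂ _+_ (trans (cong (c +_) (zeroʳ x)) (+-identityʳ c))
      (trans (eval-mulP (compP f g) g x) (trans (*-comm _ _) (cong (eval g x *_) (eval-compP f g x)))))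

  length-compP : ∀ f g a b → length f ≤ suc a → length g ≤ suc b → length (compP f g) ≤ suc (a ℕ.* b)
  length-compP [] g a b _ _ = z≤n
  length-compP (c ∷ []) g zero b (s≤s z≤n) lg = s≤s z≤n
  length-compP (c ∷ f) g (suc a) b (s≤s lf) lg = length-addP (c ∷ []) (mulP (compP f g) g) (s≤s z≤n)
    (subst (λ n → length (mulP (compP f g) g) ≤ suc n) (ℕₚ.+-comm (a ℕ.* b) b)
      (length-mulP (compP f g) g (a ℕ.* b) b (length-compP f g a b lf lg) lg))

  eval-deriv-compP : ∀ f g x → eval (deriv (compP f g)) x ≡ eval (deriv f) (eval g x) * eval (deriv g) x
  eval-deriv-compP [] g x = sym (zeroˡ _)
  eval-deriv-compP (c ∷ f) g x = begin
    eval (deriv (addP (c ∷ []) (mulP (compP f g) g))) x  ≡⟨ eval-deriv-addP (c ∷ []) (mulP (compP f g) g) x ⟩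
    0# + eval (deriv (mulP (compP f g) g)) x             ≡⟨ cong (0# +_) (eval-deriv-mulP (compP f g) g x) ⟩
    0# + (eval (deriv (compP f g)) x * g₀ + eval (compP f g) x * g′)
      ≡⟨ cong₂ (λ a b → 0# + (b * g₀ + a * g′)) (eval-compP f g x) (eval-deriv-compP f g x) ⟩
    0# + ((eval (deriv f) g₀ * g′) * g₀ + eval f g₀ * g′)
      ≡⟨ solve 4 (λ g′ g₀ a b → :0 :+ ((b :* g′) :* g₀ :+ a :* g′) := (a :+ g₀ :* b) :* g′) refl g′ g₀ _ _ ⟩
    (eval f g₀ + g₀ * eval (deriv f) g₀) * g′            ≡⟨ cong (_* g′) (eval-deriv-∷ c f g₀) ⟨
    eval (deriv (c ∷ f)) g₀ * g′ ∎
    where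
    open ≡-Reasoning
    g₀ = eval g x
    g′ = eval (deriv g) x

  linP : Carrier → Poly → Poly
  linP v f = addP (0# ∷ f) (scaleP (- v) f)

  eval-linP : ∀ v f x → eval (linP v f) x ≡ (x - v) * eval f x
  eval-linP v f x = trans (eval-addP (0# ∷ f) (scaleP (- v) f) x)
    (trans (cong (0# + x * eval f x +_) (eval-scaleP (- v) f x))
    (solve 3 (λ v x e → :0 :+ x :* e :+ (:- v) :* e := (x :- v) :* e) refl v x _))

  length-linP : ∀ v f {n} → length f ≤ n → length (linP v f) ≤ suc n
  length-linP v f le = length-addP (0# ∷ f) (scaleP (- v) f) (s≤s le) (length-scaleP (- v) f (ℕₚ.m≤n⇒m≤1+n le))

  eval-deriv-linP : ∀ v f x → eval (deriv (linP v f)) x ≡ eval f x + (x - v) * eval (deriv f) x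
  eval-deriv-linP v f x = trans (eval-deriv-addP (0# ∷ f) (scaleP (- v) f) x)
    (trans (cong₂ _+_ (eval-deriv-∷ 0# f x) (eval-deriv-scaleP (- v) f x))
      (solve 4 (λ v x e d → e :+ x :* d :+ (:- v) :* d := e :+ (x :- v) :* d) refl v x _ _))

  linsP : List Carrier → Poly → Poly
  linsP vs f = foldr linP f vs

  linProd : List Carrier → Carrier → Carrier
  linProd vs x = foldr (λ v a → (x - v) * a) 1# vs

  eval-linsP : ∀ vs f x → eval (linsP vs f) x ≡ linProd vs x * eval f x
  eval-linsP [] f x = sym (*-identityˡ _)
  eval-linsP (v ∷ vs) f x = trans (eval-linP v (linsP vs f) x)
    (trans (cong ((x - v) *_) (eval-linsP vs f x)) (sym (*-assoc _ _ _)))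

  length-linsP : ∀ vs f {n} → length f ≤ n → length (linsP vs f) ≤ length vs ℕ.+ n
  length-linsP [] f le = le
  length-linsP (v ∷ vs) f le = length-linP v (linsP vs f) (length-linsP vs f le)

  prodP : List Carrier → Poly
  prodP vs = linsP vs (1# ∷ [])

  eval-prodP : ∀ vs x → eval (prodP vs) x ≡ linProd vs x
  eval-prodP vs x = trans (eval-linsP vs (1# ∷ []) x) (solve 2 (λ a x → a :* (:1 :+ x :* :0) := a) refl _ x)

  length-prodP : ∀ vs → length (prodP vs) ≤ suc (length vs)
  length-prodP vs = subst (length (prodP vs) ≤_) (ℕₚ.+-comm (length vs) 1) (length-linsP vs (1# ∷ []) (s≤s z≤n))

  coef-prodP-top : ∀ vs → coef (prodP vs) (length vs) ≡ 1#
  coef-prodP-top [] = refl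
  coef-prodP-top (v ∷ vs) = trans (coef-addP (0# ∷ prodP vs) (scaleP (- v) (prodP vs)) (suc (length vs)))
    (trans (cong₂ _+_ (coef-prodP-top vs)
      (coef-≥ (scaleP (- v) (prodP vs)) (length-scaleP (- v) (prodP vs) (length-prodP vs)))) (+-identityʳ 1#))

  linProd-root : ∀ {v} vs → v ∈ vs → linProd vs v ≡ 0#
  linProd-root (v ∷ vs) (here refl) = trans (cong (_* linProd vs v) (-‿inverseʳ v)) (zeroˡ _)
  linProd-root {v} (w ∷ vs) (there p) = trans (cong ((v - w) *_) (linProd-root vs p)) (zeroʳ _)

  linProd-∈ : ∀ {v} vs → linProd vs v ≡ 0# → v ∈ vs
  linProd-∈ [] e = ⊥-elim (1≢0 e)
  linProd-∈ (w ∷ vs) e with *-zero e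
  ... | inj₁ e₁ = here (-‿≡0 e₁)
  ... | inj₂ e₂ = there (linProd-∈ vs e₂)

  -- The coefficient of X^(i+1) in (X - v)f is `coef f i` minus v times `coef f (i+1)`. Hence
  -- vanishing descends from beyond the length of f down to n; in `go`, k measures the distance to
  -- that length.
  linP-low : ∀ v f n → (∀ {i} → suc n ≤ i → coef (linP v f) i ≡ 0#) → ∀ {i} → n ≤ i → coef f i ≡ 0#
  linP-low v f n high {i} n≤i = go (length f) i (ℕₚ.m≤n+m (length f) i) n≤i
    where
    open ≡-Reasoning
    go : ∀ k i → length f ≤ i ℕ.+ k → n ≤ i → coef f i ≡ 0#
    go zero i le _ = coef-≥ f (subst (length f ≤_) (ℕₚ.+-identityʳ i) le)
    go (suc k) i le n≤i = begin
      coef f i                                          ≡⟨ solve 2 (λ a v → a := a :+ (:- v) :* :0) refl _ v ⟩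
      coef f i + - v * 0#                               ≡⟨ cong (λ t → coef f i + - v * t)
        (go k (suc i) (subst (length f ≤_) (ℕₚ.+-suc i k) le) (ℕₚ.m≤n⇒m≤1+n n≤i)) ⟨
      coef f i + - v * coef f (suc i)                   ≡⟨ cong (coef f i +_) (coef-scaleP (- v) f (suc i)) ⟨
      coef f i + coef (scaleP (- v) f) (suc i)          ≡⟨ coef-addP (0# ∷ f) (scaleP (- v) f) (suc i) ⟨
      coef (linP v f) (suc i)                           ≡⟨ high (s≤s n≤i) ⟩
      0# ∎

  linsP-low : ∀ vs f → (∀ {i} → length vs ≤ i → coef (linsP vs f) i ≡ 0#) → Zero f
  linsP-low [] f high i = high z≤n
  linsP-low (v ∷ vs) f high = linsP-low vs f (linP-low v (linsP vs f) (length vs) high)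

  divide-root : ∀ B v {n} → length B ≤ suc n → eval B v ≡ 0# →
    ∃[ B₁ ] (length B₁ ≤ n × (∀ x → eval B x ≡ (x - v) * eval B₁ x))
  divide-root [] v _ _ = [] , z≤n , λ x → sym (zeroʳ _)
  divide-root (c ∷ f) v (s≤s le) e = quotP v f , subst (_≤ _) (sym (length-quotP v f)) le ,
    λ x → trans (eval-quotP v c f x) (trans (cong (_+ (x - v) * eval (quotP v f) x) e) (+-identityˡ _))

  -- If B vanishes at all roots of h = ∏(X - v) then h divides B h′: in each summand ∏_{j≠i}(X - v_j)
  -- of h′ the missing factor is supplied by B, whatever the multiplicities.
  divides-B·deriv : ∀ B vs → (∀ {v} → v ∈ vs → eval B v ≡ 0#) →
    ∃[ t ] (length t ≤ length B × (∀ x → eval B x * eval (deriv (prodP vs)) x ≡ linProd vs x * eval t x))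
  divides-B·deriv B [] _ = [] , z≤n , λ x → trans (zeroʳ _) (sym (zeroʳ _))
  divides-B·deriv B (v ∷ vs) root
    with divides-B·deriv B vs (root ∘ there) | divide-root B v (ℕₚ.n≤1+n (length B)) (root (here refl))
  ... | t , lt , et | B₁ , l₁ , e₁ = addP B₁ t , length-addP B₁ t l₁ lt , λ x → begin
    eval B x * eval (deriv (linP v (prodP vs))) x
      ≡⟨ cong (eval B x *_) (eval-deriv-linP v (prodP vs) x) ⟩
    eval B x * (eval (prodP vs) x + (x - v) * eval (deriv (prodP vs)) x)
      ≡⟨ cong (λ t → eval B x * (t + (x - v) * eval (deriv (prodP vs)) x)) (eval-prodP vs x) ⟩
    eval B x * (linProd vs x + (x - v) * eval (deriv (prodP vs)) x)
      ≡⟨ solve 4 (λ b p w d → b :* (p :+ w :* d) := b :* p :+ w :* (b :* d)) refl _ _ _ _ ⟩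
    eval B x * linProd vs x + (x - v) * (eval B x * eval (deriv (prodP vs)) x)
      ≡⟨ cong₂ (λ a b → a * linProd vs x + (x - v) * b) (e₁ x) (et x) ⟩
    (x - v) * eval B₁ x * linProd vs x + (x - v) * (linProd vs x * eval t x)
      ≡⟨ solve 4 (λ b p w t → w :* b :* p :+ w :* (p :* t) := w :* p :* (b :+ t)) refl _ _ _ _ ⟩
    (x - v) * linProd vs x * (eval B₁ x + eval t x)
      ≡⟨ cong ((x - v) * linProd vs x *_) (eval-addP B₁ t x) ⟨
    (x - v) * linProd vs x * eval (addP B₁ t) x ∎
    where open ≡-Reasoning

  -- Write h for `prodP vs`. By `divides-B·deriv`, h divides B h′, while a + b ≤ deg h makes B h′
  -- too short for a nonzero multiple of h, so B h′ = 0. `D` is a shorter list with the values of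
  -- h′. The last hypothesis keeps the product of h with the quotient within `order` coefficients.
  vanishing-dichotomy : ∀ vs B D → (∀ {v} → v ∈ vs → eval B v ≡ 0#) →
    (∀ x → eval D x ≡ eval (deriv (prodP vs)) x) →
    ∀ a b → length B ≤ suc a → length D ≤ b → a ℕ.+ b ≤ length vs → length vs ℕ.+ suc a ≤ order → Zero B ⊎ Zero D
  vanishing-dichotomy vs B [] _ _ _ _ _ _ _ _ = inj₂ λ _ → refl
  vanishing-dichotomy vs B D@(_ ∷ _) root eD a (suc b) lB lD small big with divides-B·deriv B vs root
  ... | t , lt , et = mul-Zero B D lBD λ x → trans (sym (eval-mulP B D x)) (eval-Zero W W0 x)
    where
    open ℕₚ.≤-Reasoning
    W = mulP B D
    G = linsP vs t
    lBD : length B ℕ.+ length D ≤ order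
    lBD = begin
      length B ℕ.+ length D ≤⟨ ℕₚ.+-mono-≤ lB lD ⟩
      suc (a ℕ.+ suc b)     ≤⟨ s≤s small ⟩
      suc (length vs)       ≤⟨ s≤s (ℕₚ.m≤m+n (length vs) a) ⟩
      suc (length vs ℕ.+ a) ≡⟨ ℕₚ.+-suc (length vs) a ⟨
      length vs ℕ.+ suc a   ≤⟨ big ⟩
      order ∎
    lW : length W ≤ length vs
    lW = ℕₚ.≤-trans (length-mulP B D a b lB lD) (subst (_≤ length vs) (ℕₚ.+-suc a b) small)
    lG : length G ≤ order
    lG = ℕₚ.≤-trans (length-linsP vs t (ℕₚ.≤-trans lt lB)) big
    W≋G : W ≋ G
    W≋G = eval⇒≋ W G (ℕₚ.≤-trans lW (ℕₚ.≤-trans (ℕₚ.m≤m+n _ _) big)) lG λ x →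
      trans (eval-mulP B D x) (trans (cong (eval B x *_) (eD x)) (trans (et x) (sym (eval-linsP vs t x))))
    t0 : Zero t
    t0 = linsP-low vs t λ {i} le → trans (sym (W≋G i)) (coef-≥ W (ℕₚ.≤-trans lW le))
    W0 : Zero W
    W0 = evalAll0⇒Zero W (ℕₚ.≤-trans lW (ℕₚ.≤-trans (ℕₚ.m≤m+n _ _) big))
      λ x → trans (eval-≋ W G W≋G x) (trans (eval-linsP vs t x) (trans (cong (linProd vs x *_) (eval-Zero t t0 x))
        (zeroʳ _)))

  -- The hypothesis is void at x = v, so that value has to come from the polynomial identity; the 2
  -- in the bounds is the length of X - v.
  cancel-lin : ∀ v f g → length f ℕ.+ 2 ≤ order → length g ℕ.+ 2 ≤ order →
    (∀ x → (x - v) * eval f x ≡ (x - v) * eval g x) → ∀ x → eval f x ≡ eval g x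
  cancel-lin v f g lf lg e x with mul-Zero d (- v ∷ 1# ∷ []) ld (λ y → begin
      eval d y * (- v + y * (1# + y * 0#))     ≡⟨ cong (_* (- v + y * (1# + y * 0#))) (ed y) ⟩
      (eval f y - eval g y) * (- v + y * (1# + y * 0#))
        ≡⟨ solve 4 (λ a b v y → (a :- b) :* (:- v :+ y :* (:1 :+ y :* :0)) := (y :- v) :* a :- (y :- v) :* b) refl _ _
          v y ⟩
      (y - v) * eval f y - (y - v) * eval g y  ≡⟨ ≡⇒-‿0 (e y) ⟩
      0# ∎)
    where
    open ≡-Reasoning
    d = addP f (negP g)
    ed : ∀ y → eval d y ≡ eval f y - eval g y
    ed y = trans (eval-addP f (negP g) y) (cong (eval f y +_) (eval-negP g y))
    ld : length d ℕ.+ 2 ≤ order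
    ld = ℕₚ.≤-trans (ℕₚ.+-monoˡ-≤ 2 (length-addP f (negP g) (ℕₚ.m≤m⊔n _ _) (length-negP g (ℕₚ.m≤n⊔m (length f) _)))) lem
      where
      lem : (length f ℕ.⊔ length g) ℕ.+ 2 ≤ order
      lem with ℕₚ.⊔-sel (length f) (length g)
      ... | inj₁ p rewrite p = lf
      ... | inj₂ p rewrite p = lg
  ... | inj₁ z = -‿≡0 (trans (sym (trans (eval-addP f (negP g) x) (cong (eval f x +_) (eval-negP g x))))
    (eval-Zero (addP f (negP g)) z x))
  ... | inj₂ z = ⊥-elim (1≢0 (z 1))

  length-const : ∀ k → length k ≤ 1 → ∃[ c ] (∀ x → eval k x ≡ c)
  length-const [] _ = 0# , λ _ → refl
  length-const (c ∷ []) _ = c , λ x → solve 2 (λ c x → c :+ x :* :0 := c) refl c x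
  length-const (_ ∷ _ ∷ _) (s≤s ())

  Splits : ℕ → Poly → Set
  Splits n k = ∃[ ws ] ∃[ c ] (length ws ≤ n × (∀ x → eval k x ≡ c * linProd ws x))

  const-splits : ∀ k {n} → length k ≤ 1 → Splits n k
  const-splits k lk = let (c , ec) = length-const k lk in [] , c , z≤n , λ x → trans (ec x) (sym (*-identityʳ c))

  cancel-factor : ∀ v vs k l a b → length k ≤ suc a → length l ≤ suc b → a ℕ.+ b ≡ length vs →
    suc (length vs) ℕ.+ 3 ≤ order →
    (∀ x → (x - v) * linProd vs x ≡ (x - v) * (eval k x * eval l x)) → ∀ x → linProd vs x ≡ eval k x * eval l x
  cancel-factor v vs k l a b lk ll ab big e x = trans (sym (eval-prodP vs x)) (trans (cancel-lin v (prodP vs) (mulP k l)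
    (small (prodP vs) (length-prodP vs))
      (small (mulP k l) (subst (λ n → length (mulP k l) ≤ suc n) ab (length-mulP k l a b lk ll)))
    (λ y → trans (cong ((y - v) *_) (eval-prodP vs y)) (trans (e y) (cong ((y - v) *_) (sym (eval-mulP k l y))))) x)
      (eval-mulP k l x))
    where
    small : ∀ f → length f ≤ suc (length vs) → length f ℕ.+ 2 ≤ order
    small f lf = ℕₚ.≤-trans (ℕₚ.+-mono-≤ lf (ℕₚ.n≤1+n 2)) big

  -- Unique factorisation is avoided by removing one root v at a time: one of the two factors
  -- vanishes at v and is divided by X - v, and the product loses the same factor.
  factor-splits : ∀ vs k l a b → length k ≤ suc a → length l ≤ suc b → a ℕ.+ b ≡ length vs → length vs ℕ.+ 3 ≤ order →
    (∀ x → linProd vs x ≡ eval k x * eval l x) → Splits (length vs) k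
  factor-splits [] k l zero zero lk _ _ _ e = const-splits k lk
  factor-splits (v ∷ vs) k l a b lk ll ab big e with *-zero (trans (sym (e v)) (linProd-root (v ∷ vs) (here refl)))
  ... | inj₁ kv = fromK a lk ab
    where
    fromK : ∀ a → length k ≤ suc a → a ℕ.+ b ≡ suc (length vs) → Splits (suc (length vs)) k
    fromK zero lk ab = const-splits k lk
    fromK (suc a) lk ab =
      let (k₁ , lk₁ , ek) = divide-root k v lk kv
          ab′ = ℕₚ.suc-injective ab
          (ws , c , lw , ew) = factor-splits vs k₁ l a b lk₁ ll ab′ (ℕₚ.<⇒≤ big)
            (cancel-factor v vs k₁ l a b lk₁ ll ab′ big
            (λ x → trans (e x) (trans (cong (_* eval l x) (ek x)) (*-assoc _ _ _))))
      in v ∷ ws , c , s≤s lw , λ x → trans (ek x) (trans (cong ((x - v) *_) (ew x))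
        (solve 3 (λ w c p → w :* (c :* p) := c :* (w :* p)) refl _ c _))
  ... | inj₂ lv = fromL b ll ab
    where
    fromL : ∀ b → length l ≤ suc b → a ℕ.+ b ≡ suc (length vs) → Splits (suc (length vs)) k
    -- A constant l that vanishes at v is zero, whereas the product of the X - v is monic.
    fromL zero ll ab = ⊥-elim (1≢0 (trans (sym (coef-prodP-top (v ∷ vs)))
      (evalAll0⇒Zero (prodP (v ∷ vs))
        (ℕₚ.≤-trans (length-prodP (v ∷ vs))
        (ℕₚ.≤-trans (ℕₚ.≤-reflexive (ℕₚ.+-comm 1 _)) (ℕₚ.≤-trans (ℕₚ.+-monoʳ-≤ (suc (length vs)) (s≤s z≤n)) big)))
        (λ x → trans (eval-prodP (v ∷ vs) x) (trans (e x) (trans (cong (eval k x *_) (l0 x)) (zeroʳ _))))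
          (suc (length vs)))))
      where
      l0 : ∀ x → eval l x ≡ 0#
      l0 x = let (c , ec) = length-const l ll in trans (ec x) (trans (sym (ec v)) lv)
    fromL (suc b) ll ab =
      let (l₁ , ll₁ , el) = divide-root l v ll lv
          ab′ = ℕₚ.suc-injective (trans (sym (ℕₚ.+-suc a b)) ab)
          (ws , c , lw , ew) = factor-splits vs k l₁ a b lk ll₁ ab′ (ℕₚ.<⇒≤ big)
            (cancel-factor v vs k l₁ a b lk ll₁ ab′ big
            (λ x → trans (e x) (trans (cong (eval k x *_) (el x)) (solve 3 (λ k w l → k :* (w :* l) := w :* (k :* l))
              refl _ _ _))))
      in ws , c , ℕₚ.m≤n⇒m≤1+n lw , ew

  powP : Poly → ℕ → Poly
  powP f zero = 1# ∷ []
  powP f (suc n) = mulP (powP f n) f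

  eval-powP : ∀ f n x → eval (powP f n) x ≡ eval f x ^ n
  eval-powP f zero x = solve 1 (λ x → :1 :+ x :* :0 := :1) refl x
  eval-powP f (suc n) x = trans (eval-mulP (powP f n) f x) (trans (*-comm _ _) (cong (eval f x *_) (eval-powP f n x)))

  length-powP : ∀ f n a → length f ≤ suc a → length (powP f n) ≤ suc (n ℕ.* a)
  length-powP f zero a _ = s≤s z≤n
  length-powP f (suc n) a lf = subst (λ k → length (powP f (suc n)) ≤ suc k) (ℕₚ.+-comm (n ℕ.* a) a)
    (length-mulP (powP f n) f (n ℕ.* a) a (length-powP f n a lf) lf)

  -- X^m + g divides its own s-th power, so it splits; comparing leading coefficients shows that
  -- there are exactly m roots and that the constant factor is 1.
  root-splits : ∀ vs m s g → 0 < s → 0 < m → length g ≤ m → m ℕ.* s ≡ length vs → length vs ℕ.+ 3 ≤ order →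
    (∀ x → linProd vs x ≡ (x ^ m + eval g x) ^ s) →
    ∃[ ws ] (length ws ≡ m × (∀ x → x ^ m + eval g x ≡ linProd ws x) × (∀ {w} → w ∈ ws → w ∈ vs))
  root-splits vs m (suc s) g _ 0<m lg ms big e
    with factor-splits vs h (powP h s) m (s ℕ.* m) lh (length-powP h s m lh) (trans (ℕₚ.*-comm (suc s) m) ms) big
           (λ x → trans (e x) (trans (cong (_^ suc s) (sym (eh x))) (cong (eval h x *_) (sym (eval-powP h s x)))))
    where
    h = addP (mono m) g
    lh : length h ≤ suc m
    lh = length-addP (mono m) g (ℕₚ.≤-reflexive (length-mono m)) (ℕₚ.m≤n⇒m≤1+n lg)
    eh : ∀ x → eval h x ≡ x ^ m + eval g x
    eh x = trans (eval-addP (mono m) g x) (cong (_+ eval g x) (eval-mono m x))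
  ... | ws , c , lw , ew = ws , len , ex , λ {w} w∈ →
    linProd-∈ vs (trans (e w) (trans (cong (_^ suc s) (trans (ex w) (linProd-root ws w∈))) (zeroˡ _)))
    where
    open ≡-Reasoning
    h = addP (mono m) g
    lh : length h ≤ suc m
    lh = length-addP (mono m) g (ℕₚ.≤-reflexive (length-mono m)) (ℕₚ.m≤n⇒m≤1+n lg)
    eh : ∀ x → eval h x ≡ x ^ m + eval g x
    eh x = trans (eval-addP (mono m) g x) (cong (_+ eval g x) (eval-mono m x))
    m≤vs : m ≤ length vs
    m≤vs = subst (m ≤_) ms (ℕₚ.m≤m*n m (suc s))
    ≤ord : ∀ {k} → k ≤ length vs → suc k ≤ order
    ≤ord le = ℕₚ.≤-trans (s≤s le) (ℕₚ.≤-trans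
      (subst (ℕ._≤ length vs ℕ.+ 3) (ℕₚ.+-comm _ 1) (ℕₚ.+-monoʳ-≤ (length vs) (s≤s z≤n))) big)
    p = scaleP c (prodP ws)
    h≋p : h ≋ p
    h≋p = eval⇒≋ h p (ℕₚ.≤-trans lh (≤ord m≤vs)) (ℕₚ.≤-trans (length-scaleP c (prodP ws) (length-prodP ws)) (≤ord lw))
      λ x → trans (ew x) (sym (trans (eval-scaleP c (prodP ws) x) (cong (c *_) (eval-prodP ws x))))
    htop : coef h m ≡ 1#
    htop = trans (coef-addP (mono m) g m) (trans (cong₂ _+_ (coef-mono-≡ m) (coef-≥ g lg)) (+-identityʳ 1#))
    c≢0 : c ≢ 0#
    c≢0 c0 = 1≢0 (begin
      1#                      ≡⟨ htop ⟨
      coef h m                ≡⟨ h≋p m ⟩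
      coef p m                ≡⟨ coef-scaleP c (prodP ws) m ⟩
      c * coef (prodP ws) m   ≡⟨ cong (_* coef (prodP ws) m) c0 ⟩
      0# * coef (prodP ws) m  ≡⟨ zeroˡ _ ⟩
      0# ∎)
    ptop : coef p (length ws) ≡ c
    ptop = trans (coef-scaleP c (prodP ws) (length ws)) (trans (cong (c *_) (coef-prodP-top ws)) (*-identityʳ c))
    len : length ws ≡ m
    len with ℕₚ.<-cmp (length ws) m
    ... | tri≈ _ eq _ = eq
    ... | tri< lt _ _ = ⊥-elim (1≢0
      (trans (sym htop) (trans (h≋p m) (coef-≥ p (length-scaleP c (prodP ws) (ℕₚ.≤-trans (length-prodP ws) lt))))))
    ... | tri> _ _ gt = ⊥-elim (c≢0 (trans (sym ptop) (trans (sym (h≋p (length ws))) (coef-≥ h (ℕₚ.≤-trans lh gt)))))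
    c1 : c ≡ 1#
    c1 = trans (sym ptop) (trans (cong (coef p) len) (trans (sym (h≋p m)) htop))
    ex : ∀ x → x ^ m + eval g x ≡ linProd ws x
    ex x = trans (sym (eh x)) (trans (ew x) (trans (cong (_* linProd ws x) c1) (*-identityˡ _)))

-- Characteristic p: conjugate polynomials, p-th roots and zero derivatives

module PrimePower (F : FiniteField) (p N : ℕ) (pp : Prime p) (N>0 : 0 < N) (order≡ : FiniteField.order F ≡ p ℕ.^ N)
  where

  open FieldTheory F
  open Polynomials F

  natF-p : natF p ≡ 0#
  natF-p = char-from-order p N order≡

  open Frobenius pp natF-p public

  1<p : 1 < p
  1<p = ℕ.nonTrivial⇒n>1 p {{prime⇒nonTrivial pp}}

  0<p : 0 < p
  0<p = ℕₚ.<-trans (s≤s z≤n) 1<p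

  frobExp : ∀ e → FrobExp (p ℕ.^ e)
  frobExp e = record { exponent = e ; n≡ = refl }

  natF-∣ : ∀ {n} → p ∣ n → natF n ≡ 0#
  natF-∣ (divides m refl) = trans (natF-* m p) (trans (cong (natF m *_) natF-p) (zeroʳ _))

  -- By Bézout, 1 is an integer combination of i and p, and otherwise both would be zero in the
  -- field.
  natF-small : ∀ {i} → 0 < i → i < p → natF i ≢ 0#
  natF-small {i} 0<i i<p i0 with coprime-Bézout (prime⇒coprime pp {{ℕ.>-nonZero 0<i}} i<p)
  ... | Bézout.+- x y eq = 1≢0 (begin
    1#                      ≡⟨ trans (sym (+-identityʳ 1#))
      (cong (1# +_) (sym (trans (natF-* y i) (trans (cong (natF y *_) i0) (zeroʳ _))))) ⟩
    1# + natF (y ℕ.* i)     ≡⟨ natF-suc (y ℕ.* i) ⟨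
    natF (suc (y ℕ.* i))    ≡⟨ cong natF eq ⟩
    natF (x ℕ.* p)          ≡⟨ natF-∣ (n∣m*n x) ⟩
    0# ∎)
    where open ≡-Reasoning
  ... | Bézout.-+ x y eq = 1≢0 (begin
    1#                      ≡⟨ trans (sym (+-identityʳ 1#)) (cong (1# +_) (sym (natF-∣ (n∣m*n x)))) ⟩
    1# + natF (x ℕ.* p)     ≡⟨ natF-suc (x ℕ.* p) ⟨
    natF (suc (x ℕ.* p))    ≡⟨ cong natF eq ⟩
    natF (y ℕ.* i)          ≡⟨ trans (natF-* y i) (trans (cong (natF y *_) i0) (zeroʳ _)) ⟩
    0# ∎)
    where open ≡-Reasoning

  natF-∤ : ∀ n → ¬ (p ∣ n) → natF n ≢ 0#
  natF-∤ n p∤n e = natF-small 0<i (m%n<n n p) (begin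
    natF (n ℕ.% p)                                   ≡⟨ +-identityʳ _ ⟨
    natF (n ℕ.% p) + 0#                              ≡⟨ cong (natF (n ℕ.% p) +_)
      (natF-∣ {n ℕ./ p ℕ.* p} (n∣m*n (n ℕ./ p))) ⟨
    natF (n ℕ.% p) + natF (n ℕ./ p ℕ.* p)            ≡⟨ natF-+ (n ℕ.% p) (n ℕ./ p ℕ.* p) ⟨
    natF (n ℕ.% p ℕ.+ n ℕ./ p ℕ.* p)                 ≡⟨ cong natF (m≡m%n+[m/n]*n n p) ⟨
    natF n                                           ≡⟨ e ⟩
    0# ∎)
    where
    open ≡-Reasoning
    instance _ = prime⇒nonZero pp
    0<i : 0 < n ℕ.% p
    0<i with n ℕ.% p in eq
    ... | zero = ⊥-elim (p∤n (divides (n ℕ./ p) (trans (m≡m%n+[m/n]*n n p) (cong (ℕ._+ n ℕ./ p ℕ.* p) eq))))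
    ... | suc _ = s≤s z≤n

  -- The inverse of the Frobenius map, since c^(p^N) = c by `fermat`.
  proot : Carrier → Carrier
  proot c = c ^ (p ℕ.^ (N ∸ 1))

  proot-^ : ∀ c → proot c ^ p ≡ c
  proot-^ c = trans (sym (^-* c (p ℕ.^ (N ∸ 1)) p))
    (trans (cong (c ^_) (trans (ℕₚ.*-comm _ p) (trans (lem N N>0) (sym order≡)))) (fermat c))
    where
    lem : ∀ n → 0 < n → p ℕ.* p ℕ.^ (n ∸ 1) ≡ p ℕ.^ n
    lem (suc n) _ = refl

  -- The conjugate f^[n], for which f(X)^n = f^[n](X^n) when n is a power of p.
  mapPow : ℕ → Poly → Poly
  mapPow n = map (_^ n)

  eval-mapPow : ∀ {n} → FrobExp n → ∀ f x → eval f x ^ n ≡ eval (mapPow n f) (x ^ n)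
  eval-mapPow fe [] x = frob0 fe
  eval-mapPow {n} fe (c ∷ f) x = trans (frob+ fe c (x * eval f x))
    (cong (c ^ n +_) (trans (^-mul x _ n) (cong (x ^ n *_) (eval-mapPow fe f x))))

  coef-mapPow : ∀ {n} → FrobExp n → ∀ f i → coef (mapPow n f) i ≡ coef f i ^ n
  coef-mapPow fe [] i = sym (frob0 fe)
  coef-mapPow fe (c ∷ f) zero = refl
  coef-mapPow fe (c ∷ f) (suc i) = coef-mapPow fe f i

  -- Substitution X ↦ X^(s+1).
  spread : ℕ → Poly → Poly
  spread s [] = []
  spread s (c ∷ []) = c ∷ []
  spread s (c ∷ f@(_ ∷ _)) = c ∷ padP s (spread s f)

  eval-spread : ∀ s f x → eval (spread s f) x ≡ eval f (x ^ suc s)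
  eval-spread s [] x = refl
  eval-spread s (c ∷ []) x = cong (c +_) (trans (zeroʳ x) (sym (zeroʳ _)))
  eval-spread s (c ∷ f@(_ ∷ _)) x =
    cong (c +_) (trans (cong (x *_) (trans (eval-padP s (spread s f) x) (cong (x ^ s *_) (eval-spread s f x))))
    (sym (*-assoc _ _ _)))

  length-spread : ∀ s f {d} → length f ≤ suc d → length (spread s f) ≤ suc (d ℕ.* suc s)
  length-spread s [] _ = z≤n
  length-spread s (c ∷ []) _ = s≤s z≤n
  length-spread s (c ∷ f@(_ ∷ _)) {suc d} (s≤s le) = s≤s (subst (_≤ suc d ℕ.* suc s) (sym (length-padP s (spread s f)))
    (ℕₚ.≤-trans (ℕₚ.+-monoʳ-≤ s (length-spread s f le)) (ℕₚ.≤-reflexive (ℕₚ.+-suc s _))))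

  coef-spread : ∀ s f {i} → i < s → coef (spread s f) (suc i) ≡ 0#
  coef-spread s [] _ = refl
  coef-spread s (c ∷ []) _ = refl
  coef-spread s (c ∷ f@(_ ∷ _)) lt = coef-padP-< s (spread s f) lt

  -- thin j f keeps the coefficients j, j + p, j + 2p, …
  thin : ℕ → Poly → Poly
  thin j [] = []
  thin zero (c ∷ f) = c ∷ thin (p ∸ 1) f
  thin (suc j) (c ∷ f) = thin j f

  -- Here n is the exponent, modulo p, of the first coefficient of f, and j counts the coefficients
  -- before the next exponent divisible by p. The skipped exponents are invertible in the field, so
  -- the vanishing of `derivFrom n f` kills their coefficients.
  eval-thin : ∀ n j f → j < p → p ∣ n ℕ.+ j → Zero (derivFrom n f) → ∀ x → eval f x ≡ x ^ j * eval (thin j f) (x ^ p)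
  eval-thin n j [] _ _ _ x = sym (zeroʳ _)
  eval-thin n zero (c ∷ f) j<p d z x =
    -- A kept coefficient is followed by p - 1 skipped ones.
    trans (cong (λ t → c + x * t) (eval-thin (suc n) (p ∸ 1) f (ℕₚ.≤-reflexive sp) d′ (z ∘ suc) x))
    (trans (solve 4 (λ c x a b → c :+ x :* (a :* b) := :1 :* (c :+ (x :* a) :* b)) refl c x _
      (eval (thin (p ∸ 1) f) (x ^ p)))
      (cong (λ k → 1# * (c + x ^ k * eval (thin (p ∸ 1) f) (x ^ p))) sp))
    where
    sp : suc (p ∸ 1) ≡ p
    sp = ℕₚ.m+[n∸m]≡n 0<p
    d′ : p ∣ suc n ℕ.+ (p ∸ 1)
    d′ = subst (p ∣_) (trans (cong (n ℕ.+_) (sym sp)) (ℕₚ.+-suc n (p ∸ 1)))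
      (∣m∣n⇒∣m+n (subst (p ∣_) (ℕₚ.+-identityʳ n) d) ∣-refl)
  eval-thin n (suc j) (c ∷ f) j<p d z x = begin
    c + x * eval f x                              ≡⟨ cong₂ (λ a b → a + x * b) c0
      (eval-thin (suc n) j f (ℕₚ.<-trans (ℕₚ.n<1+n j) j<p) (subst (p ∣_) (ℕₚ.+-suc n j) d) (z ∘ suc) x) ⟩
    0# + x * (x ^ j * eval (thin j f) (x ^ p))    ≡⟨ solve 3 (λ x a b → :0 :+ x :* (a :* b) := (x :* a) :* b) refl x _
      _ ⟩
    x * x ^ j * eval (thin j f) (x ^ p) ∎
    where
    open ≡-Reasoning
    c0 : c ≡ 0#
    c0 with *-zero (z 0)
    ... | inj₂ e = e
    ... | inj₁ e = ⊥-elim (natF-∤ n (λ p∣n → ℕₚ.<⇒≱ j<p (∣⇒≤ (∣m+n∣m⇒∣n d p∣n))) e)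

  length-thin : ∀ f j d → length f ≤ suc j ℕ.+ d ℕ.* p → length (thin j f) ≤ suc d
  length-thin [] j d _ = z≤n
  length-thin (c ∷ f) (suc j) d (s≤s le) = length-thin f j d le
  length-thin (c ∷ []) zero d (s≤s le) = s≤s z≤n
  length-thin (c ∷ f@(_ ∷ _)) zero (suc d) (s≤s le) =
    s≤s (length-thin f (p ∸ 1) d (subst (λ k → length f ≤ k ℕ.+ d ℕ.* p) (sym (ℕₚ.m+[n∸m]≡n 0<p)) le))

  -- Only exponents divisible by p survive, and every coefficient has a p-th root, so g(X) = k(X)^p
  -- by the additivity of the Frobenius map.
  deriv-Zero⇒pth-power : ∀ g d → length g ≤ suc (d ℕ.* p) → Zero (deriv g) →
    ∃[ k ] (length k ≤ suc d × (∀ x → eval g x ≡ eval k x ^ p))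
  deriv-Zero⇒pth-power g d le z = map proot (thin 0 g) ,
    subst (_≤ suc d) (sym (length-map proot (thin 0 g))) (length-thin g 0 d le) , λ x → begin
    eval g x                                       ≡⟨ eval-thin 0 0 g 0<p (p ∣0) (from0 g z) x ⟩
    1# * eval (thin 0 g) (x ^ p)                   ≡⟨ *-identityˡ _ ⟩
    eval (thin 0 g) (x ^ p)                        ≡⟨ cong (λ f → eval f (x ^ p)) (roots (thin 0 g)) ⟨
    eval (mapPow p (map proot (thin 0 g))) (x ^ p) ≡⟨ eval-mapPow fe (map proot (thin 0 g)) x ⟨
    eval (map proot (thin 0 g)) x ^ p ∎
    where
    open ≡-Reasoning
    fe : FrobExp p
    fe = record { exponent = 1 ; n≡ = sym (ℕₚ.*-identityʳ p) }
    roots : ∀ f → mapPow p (map proot f) ≡ f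
    roots [] = refl
    roots (c ∷ f) = cong₂ _∷_ (proot-^ c) (roots f)
    from0 : ∀ g → Zero (deriv g) → Zero (derivFrom 0 g)
    from0 [] _ i = refl
    from0 (c ∷ g) _ zero = zeroˡ c
    from0 (c ∷ g) z (suc i) = z i

module CubeOrder (F : FiniteField) (p k : ℕ) (pp : Prime p) (k>0 : 0 < k) (k-odd : ∀ j → k ≢ j ℕ.+ j)
  (order≡ : FiniteField.order F ≡ p ℕ.^ ((k ℕ.+ (k ℕ.+ k)) ℕ.+ (k ℕ.+ (k ℕ.+ k)))) where

  open FieldTheory F
  open Polynomials F

  -- Lacunary polynomials

  k3 : ℕ
  k3 = k ℕ.+ (k ℕ.+ k)

  open PrimePower F p (k3 ℕ.+ k3) pp (ℕₚ.≤-trans k>0 (ℕₚ.≤-trans (ℕₚ.m≤m+n k (k ℕ.+ k)) (ℕₚ.m≤m+n k3 k3))) order≡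

  pw : ℕ → ℕ
  pw e = p ℕ.^ e

  r q : ℕ
  r = pw k
  q = pw k3

  pw-+ : ∀ a b → pw (a ℕ.+ b) ≡ pw a ℕ.* pw b
  pw-+ = ℕₚ.^-distribˡ-+-* p

  pw>0 : ∀ e → 0 < pw e
  pw>0 e = ℕₚ.m^n>0 p {{ℕ.>-nonZero 0<p}} e

  pw-mono : ∀ {a b} → a ≤ b → pw a ≤ pw b
  pw-mono = ℕₚ.^-monoʳ-≤ p {{ℕ.>-nonZero 0<p}}

  -- Both summands are at most p^(t-1), and p ≥ 2. The degree comparisons between powers of p in the
  -- lacunary argument come down to this.
  pw-< : ∀ {u v t} → u < t → v < t → pw u ℕ.+ pw v ≤ pw t
  pw-< {u} {v} {suc t} (s≤s u≤) (s≤s v≤) = begin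
    pw u ℕ.+ pw v    ≤⟨ ℕₚ.+-mono-≤ (pw-mono u≤) (pw-mono v≤) ⟩
    pw t ℕ.+ pw t    ≡⟨ cong (pw t ℕ.+_) (ℕₚ.+-identityʳ (pw t)) ⟨
    2 ℕ.* pw t       ≤⟨ ℕₚ.*-monoˡ-≤ (pw t) 1<p ⟩
    p ℕ.* pw t ∎
    where open ℕₚ.≤-Reasoning

  1<pw : ∀ {e} → 0 < e → 1 < pw e
  1<pw {suc e} _ = ℕₚ.≤-trans 1<p (subst (_≤ p ℕ.* pw e) (ℕₚ.*-identityʳ p) (ℕₚ.*-monoʳ-≤ p (pw>0 e)))

  suc-pred-pw : ∀ e → suc (pw e ∸ 1) ≡ pw e
  suc-pred-pw e = ℕₚ.m+[n∸m]≡n (pw>0 e)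

  order-qq : order ≡ q ℕ.* q
  order-qq = trans order≡ (pw-+ k3 k3)

  q≥8 : 8 ≤ q
  q≥8 = ℕₚ.≤-trans (ℕₚ.≤-trans (ℕₚ.^-monoˡ-≤ 3 1<p) (ℕₚ.≤-reflexive refl))
    (pw-mono (ℕₚ.+-mono-≤ k>0 (ℕₚ.+-mono-≤ k>0 k>0)))

  -- The 6 is slack that absorbs the off-by-ones of list lengths when h times a cofactor of degree
  -- below q must fit into `order` coefficients. It is available because q ≥ 2³.
  2q≤order : q ℕ.+ (q ℕ.+ 6) ≤ order
  2q≤order = begin
    q ℕ.+ (q ℕ.+ 6)        ≤⟨ ℕₚ.+-monoʳ-≤ q (ℕₚ.+-monoʳ-≤ q (ℕₚ.≤-trans (ℕₚ.m≤m+n 6 2) q≥8)) ⟩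
    q ℕ.+ (q ℕ.+ q)        ≡⟨ cong (λ t → q ℕ.+ (q ℕ.+ t)) (ℕₚ.+-identityʳ q) ⟨
    3 ℕ.* q                ≤⟨ ℕₚ.*-monoˡ-≤ q (ℕₚ.≤-trans (ℕₚ.m≤m+n 3 5) q≥8) ⟩
    q ℕ.* q                ≡⟨ order-qq ⟨
    order ∎
    where open ℕₚ.≤-Reasoning

  q<order : q < order
  q<order = ℕₚ.<-≤-trans (ℕₚ.m<m+n q (ℕₚ.≤-trans (s≤s z≤n) (ℕₚ.m≤n+m 6 q))) 2q≤order

  ^r-fixed-q : ∀ {x} → x ^ r ≡ x → x ^ q ≡ x
  ^r-fixed-q {x} e = begin
    x ^ q                              ≡⟨ cong (x ^_) (trans (pw-+ k (k ℕ.+ k)) (cong (r ℕ.*_) (pw-+ k k))) ⟩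
    x ^ (r ℕ.* (r ℕ.* r))              ≡⟨ ^-* x r (r ℕ.* r) ⟩
    (x ^ r) ^ (r ℕ.* r)                ≡⟨ cong (_^ (r ℕ.* r)) e ⟩
    x ^ (r ℕ.* r)                      ≡⟨ ^-* x r r ⟩
    (x ^ r) ^ r                        ≡⟨ cong (_^ r) e ⟩
    x ^ r                              ≡⟨ e ⟩
    x ∎
    where open ≡-Reasoning

  eval-take : ∀ n g → length g ≤ suc n → ∀ x → eval g x ≡ eval (take n g) x + coef g n * x ^ n
  eval-take zero [] _ x = solve 0 (:0 := :0 :+ :0 :* :1) refl
  eval-take (suc n) [] _ x = solve 1 (λ y → :0 := :0 :+ :0 :* y) refl (x ^ suc n)
  eval-take zero (c ∷ []) _ x = solve 2 (λ c x → c :+ x :* :0 := :0 :+ c :* :1) refl c x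
  eval-take zero (c ∷ _ ∷ _) (s≤s ()) x
  eval-take (suc n) (c ∷ g) (s≤s le) x = trans (cong (λ t → c + x * t) (eval-take n g le x))
    (solve 5 (λ c x a b y → c :+ x :* (a :+ b :* y) := (c :+ x :* a) :+ b :* (x :* y)) refl c x _ _ (x ^ n))

  deriv-mono-Zero : ∀ n → p ∣ n → Zero (deriv (mono n))
  deriv-mono-Zero n p∣n i with suc i ℕ.≟ n
  ... | yes sn = trans (coef-deriv (mono n) i)
    (trans (cong (_* coef (mono n) (suc i)) (trans (cong natF sn) (natF-∣ p∣n))) (zeroˡ _))
  ... | no ne = trans (coef-deriv (mono n) i) (trans (cong (natF (suc i) *_) (coef-mono-≢ n ne)) (zeroʳ _))

  p∣pw : ∀ {e} → 0 < e → p ∣ pw e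
  p∣pw {suc e} _ = divides (pw e) (ℕₚ.*-comm p _)

  record RSubspace (vs : List Carrier) : Set where
    field
      +-closed : ∀ {u v} → u ∈ vs → v ∈ vs → u + v ∈ vs
      *-closed : ∀ {c v} → c ^ r ≡ c → v ∈ vs → c * v ∈ vs

  kernel-RSubspace : ∀ vs (L : Carrier → Carrier) s → 0 < s → (∀ x → linProd vs x ≡ L x ^ s) →
    (∀ x y → L (x + y) ≡ L x + L y) → (∀ c x → c ^ r ≡ c → L (c * x) ≡ c * L x) → RSubspace vs
  kernel-RSubspace vs L s s>0 e add scale = record
    { +-closed = λ u∈ v∈ → back (trans (add _ _) (trans (cong₂ _+_ (root u∈) (root v∈)) (+-identityˡ 0#)))
    ; *-closed = λ cr v∈ → back (trans (scale _ _ cr) (trans (cong (_ *_) (root v∈)) (zeroʳ _))) }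
    where
    root : ∀ {v} → v ∈ vs → L v ≡ 0#
    root v∈ = ^-≡0 s (trans (sym (e _)) (linProd-root vs v∈))
    back : ∀ {v} → L v ≡ 0# → v ∈ vs
    back {v} z = linProd-∈ vs (trans (e v) (trans (cong (_^ s) z) (0^ s s>0)))

  -- Throughout, h = X^m + g and P = h^s with s = p^e, m = p^(a+k), deg g ≤ p^a and a + e = 2k.
  module Lacunary (ζ : Carrier) (ζ≢0 : ζ ≢ 0#) (vs : List Carrier) (length-vs : length vs ≡ q)
    (vs-root : ∀ {v} → v ∈ vs → v ^ q ≡ ζ * v) (0∈vs : 0# ∈ vs) where

    record State (a e : ℕ) : Set where
      field
        e+a : e ℕ.+ a ≡ k ℕ.+ k
        g : Poly
        length-g : length g ≤ suc (pw a)
        eq : ∀ x → linProd vs x ≡ (x ^ pw (a ℕ.+ k) + eval g x) ^ pw e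

    g0 : ∀ {a e} (st : State a e) → eval (State.g st) 0# ≡ 0#
    g0 {a} {e} st = begin
      eval g 0#                          ≡⟨ +-identityˡ _ ⟨
      0# + eval g 0#                     ≡⟨ cong (_+ eval g 0#) (0^ (pw (a ℕ.+ k)) (pw>0 (a ℕ.+ k))) ⟨
      0# ^ pw (a ℕ.+ k) + eval g 0#      ≡⟨ ^-≡0 (pw e) (trans (sym (eq 0#)) (linProd-root vs 0∈vs)) ⟩
      0# ∎
      where
      open State st
      open ≡-Reasoning

    -- Every term of X^m + γX^r + bX is additive, and it is 𝔽_r-homogeneous once the m-th power is
    -- trivial on 𝔽_r. Each branch of the lacunary argument that ends does so here.
    linearized : ∀ {a e} (st : State a e) γ b → (∀ c → c ^ r ≡ c → c ^ pw (a ℕ.+ k) ≡ c) →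
      (∀ x → eval (State.g st) x ≡ γ * x ^ r + b * x) → RSubspace vs
    linearized {a} {e} st γ b fixed eg = kernel-RSubspace vs (λ x → x ^ pw (a ℕ.+ k) + (γ * x ^ r + b * x)) (pw e)
      (pw>0 e)
      (λ x → trans (State.eq st x) (cong (λ t → (x ^ pw (a ℕ.+ k) + t) ^ pw e) (eg x)))
      (λ x y → trans (cong₂ (λ s t → s + (γ * t + b * (x + y))) (frob+ (frobExp (a ℕ.+ k)) x y) (frob+ (frobExp k) x y))
        (solve 8 (λ X Y γ x′ y′ b x y → (X :+ Y) :+ (γ :* (x′ :+ y′) :+ b :* (x :+ y)) := (X :+ (γ :* x′ :+ b :* x)) :+
          (Y :+ (γ :* y′ :+ b :* y)))
          refl (x ^ pw (a ℕ.+ k)) (y ^ pw (a ℕ.+ k)) γ (x ^ r) (y ^ r) b x y))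
      (λ c x cr → trans (cong₂ (λ s t → s + (γ * t + b * (c * x)))
        (trans (^-mul c x (pw (a ℕ.+ k))) (cong (_* x ^ pw (a ℕ.+ k)) (fixed c cr)))
        (trans (^-mul c x r) (cong (_* x ^ r) cr)))
        (solve 6 (λ c X γ x′ b x → c :* X :+ (γ :* (c :* x′) :+ b :* (c :* x)) := c :* (X :+ (γ :* x′ :+ b :* x))) refl
          c (x ^ pw (a ℕ.+ k)) γ (x ^ r) b x))

    final : ∀ {e} → State 0 e → RSubspace vs
    final st = linearized st 0# (proj₁ b,eb) (λ c cr → cr)
      (λ x → trans (proj₂ b,eb x) (solve 3 (λ y b x → b :* x := :0 :* y :+ b :* x) refl (x ^ r) _ x))
      where
      open State st
      lin : ∀ g → length g ≤ 2 → eval g 0# ≡ 0# → ∃[ b ] (∀ x → eval g x ≡ b * x)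
      lin [] _ _ = 0# , λ x → sym (zeroˡ x)
      lin (c ∷ []) _ z = 0# , λ x → trans (trans (solve 2 (λ c x → c :+ x :* :0 := c :+ :0 :* :0) refl c x) z)
        (sym (zeroˡ x))
      lin (c ∷ b ∷ []) _ z = b , λ x → begin
        c + x * (b + x * 0#)                 ≡⟨ solve 3
          (λ c b x → c :+ x :* (b :+ x :* :0) := (c :+ :0 :* (b :+ :0 :* :0)) :+ b :* x) refl c b x ⟩
        (c + 0# * (b + 0# * 0#)) + b * x     ≡⟨ cong (_+ b * x) z ⟩
        0# + b * x                           ≡⟨ +-identityˡ _ ⟩
        b * x ∎
        where open ≡-Reasoning
      lin (_ ∷ _ ∷ _ ∷ _) (s≤s (s≤s ())) _
      b,eb = lin g length-g (g0 st)

    module Step {a e : ℕ} (st : State (suc a) e) where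
      open State st

      m s : ℕ
      m = pw (suc a ℕ.+ k)
      s = pw e

      ms : m ℕ.* s ≡ q
      ms = trans (sym (pw-+ (suc a ℕ.+ k) e)) (cong pw (trans (lem (suc a) k e) (cong (k ℕ.+_) e+a)))
        where
        lem : ∀ a k e → (a ℕ.+ k) ℕ.+ e ≡ k ℕ.+ (e ℕ.+ a)
        lem = solve-∀

      g≤m : length g ≤ m
      g≤m = ℕₚ.≤-trans length-g (ℕₚ.≤-trans (ℕₚ.+-monoˡ-≤ (pw (suc a)) (pw>0 0))
        (pw-< (s≤s z≤n) (ℕₚ.m<m+n (suc a) k>0)))

      big : length vs ℕ.+ 3 ≤ order
      big = subst (λ n → n ℕ.+ 3 ≤ order) (sym length-vs)
        (ℕₚ.≤-trans (ℕₚ.+-monoʳ-≤ q (ℕₚ.≤-trans (ℕₚ.m≤m+n 3 3) (ℕₚ.m≤n+m 6 q))) 2q≤order)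

      split : ∃[ ws ] (length ws ≡ m × (∀ x → x ^ m + eval g x ≡ linProd ws x) × (∀ {w} → w ∈ ws → w ∈ vs))
      split = root-splits vs m s g (pw>0 e) (pw>0 (suc a ℕ.+ k)) g≤m (trans ms (sym length-vs)) big eq

      ws = proj₁ split
      ws-length = proj₁ (proj₂ split)
      ws-eq = proj₁ (proj₂ (proj₂ split))
      ws⊆ = proj₂ (proj₂ (proj₂ split))

      m≤q : m ≤ q
      m≤q = subst (m ≤_) ms (ℕₚ.m≤m*n m s {{ℕ.>-nonZero (pw>0 e)}})

      root-g : ∀ {w} → w ∈ ws → w ^ m ≡ - eval g w
      root-g {w} w∈ = +≡0⇒ (trans (ws-eq w) (linProd-root ws w∈))

      root-ζ : ∀ {w} → w ∈ ws → w ^ q ≡ ζ * w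
      root-ζ = vs-root ∘ ws⊆

      eval-deriv-g : ∀ x → eval (deriv g) x ≡ eval (deriv (prodP ws)) x
      eval-deriv-g x = sym (begin
        eval (deriv (prodP ws)) x                        ≡⟨ eval-≋ (deriv (prodP ws)) (deriv h)
          (deriv-≋ (prodP ws) h p≋h) x ⟩
        eval (deriv h) x                                 ≡⟨ eval-deriv-addP (mono m) g x ⟩
        eval (deriv (mono m)) x + eval (deriv g) x       ≡⟨ cong (_+ eval (deriv g) x)
          (eval-Zero (deriv (mono m)) dm0 x) ⟩
        0# + eval (deriv g) x                            ≡⟨ +-identityˡ _ ⟩
        eval (deriv g) x ∎)
        where
        open ≡-Reasoning
        h = addP (mono m) g
        sm≤ : suc m ≤ order
        sm≤ = ℕₚ.≤-trans (s≤s m≤q) q<order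
        p≋h : prodP ws ≋ h
        p≋h = eval⇒≋ (prodP ws) h (ℕₚ.≤-trans (length-prodP ws) (subst (λ n → suc n ≤ order) (sym ws-length) sm≤))
          (ℕₚ.≤-trans (length-addP (mono m) g (ℕₚ.≤-reflexive (length-mono m)) (ℕₚ.m≤n⇒m≤1+n g≤m)) sm≤)
          λ x → trans (eval-prodP ws x) (trans (sym (ws-eq x))
            (sym (trans (eval-addP (mono m) g x) (cong (_+ eval g x) (eval-mono m x)))))
        dm0 : Zero (deriv (mono m))
        dm0 = deriv-mono-Zero m (p∣pw {suc a ℕ.+ k} (s≤s z≤n))

      -- If g = g₁^p then h = (X^(m/p) + g₁)^p: the exponent s gains a factor p, while m and the
      -- bound on deg g lose one.
      next : Zero (deriv g) → State a (suc e)
      next z with deriv-Zero⇒pth-power g (pw a) (subst (λ n → length g ≤ suc n) (ℕₚ.*-comm p (pw a)) length-g) z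
      ... | g′ , lg′ , eg′ = record { e+a = trans (sym (ℕₚ.+-suc e a)) e+a ; g = g′ ; length-g = lg′ ; eq = λ x → begin
        linProd vs x                                           ≡⟨ eq x ⟩
        (x ^ (p ℕ.* pw (a ℕ.+ k)) + eval g x) ^ s              ≡⟨ cong (_^ s)
          (cong₂ _+_ (trans (cong (x ^_) (ℕₚ.*-comm p _)) (^-* x (pw (a ℕ.+ k)) p)) (eg′ x)) ⟩
        ((x ^ pw (a ℕ.+ k)) ^ p + eval g′ x ^ p) ^ s           ≡⟨ cong (_^ s) (frob-+ _ _) ⟨
        ((x ^ pw (a ℕ.+ k) + eval g′ x) ^ p) ^ s               ≡⟨ ^-* _ p s ⟨
        (x ^ pw (a ℕ.+ k) + eval g′ x) ^ (p ℕ.* s) ∎ }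
        where open ≡-Reasoning

      dichotomy : ∀ B b → length B ≤ suc b → b ℕ.+ pw (suc a) ≤ m → (∀ {w} → w ∈ ws → eval B w ≡ 0#) →
        Zero B ⊎ Zero (deriv g)
      dichotomy B b lB small root = vanishing-dichotomy ws B (deriv g) root eval-deriv-g b (pw (suc a)) lB
        (length-deriv g length-g)
        (subst (b ℕ.+ pw (suc a) ≤_) (sym ws-length) small) (subst (λ n → n ℕ.+ suc b ≤ order) (sym ws-length)
          (ℕₚ.≤-trans (ℕₚ.+-mono-≤ m≤q (ℕₚ.≤-trans (s≤s (ℕₚ.≤-trans (ℕₚ.m≤m+n b _) (ℕₚ.≤-trans small m≤q)))
            (subst (ℕ._≤ q ℕ.+ 6) (ℕₚ.+-comm q 1) (ℕₚ.+-monoʳ-≤ q (s≤s z≤n))))) 2q≤order))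

      ζX : Poly
      ζX = 0# ∷ ζ ∷ []

      eval-ζX : ∀ x → eval ζX x ≡ ζ * x
      eval-ζX x = solve 2 (λ z x → :0 :+ x :* (z :+ x :* :0) := z :* x) refl ζ x

      -- This is ζX + f^(p^j), with the power written as a conjugate in X^(p^j), so that its degree
      -- and its coefficient of X are visible.
      ζX+f^ : Poly → ℕ → Poly
      ζX+f^ f j = addP ζX (spread (pw j ∸ 1) (mapPow (pw j) f))

      eval-ζX+f^ : ∀ f j x → eval (ζX+f^ f j) x ≡ ζ * x + eval f x ^ pw j
      eval-ζX+f^ f j x = trans (eval-addP ζX (spread (pw j ∸ 1) (mapPow (pw j) f)) x) (cong₂ _+_ (eval-ζX x)
        (trans (eval-spread (pw j ∸ 1) (mapPow (pw j) f) x)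
          (trans (cong (λ n → eval (mapPow (pw j) f) (x ^ n)) (suc-pred-pw j)) (sym (eval-mapPow (frobExp j) f x)))))

      length-spread-mapPow : ∀ f j {d} → length f ≤ suc d → length (spread (pw j ∸ 1) (mapPow (pw j) f)) ≤ suc
        (d ℕ.* pw j)
      length-spread-mapPow f j {d} lf = subst (λ n → length (spread (pw j ∸ 1) (mapPow (pw j) f)) ≤ suc (d ℕ.* n))
        (suc-pred-pw j)
        (length-spread (pw j ∸ 1) (mapPow (pw j) f) (subst (_≤ suc d) (sym (length-map _ f)) lf))

      length-ζX+f^ : ∀ f j {d} → length f ≤ suc d → 0 < d → length (ζX+f^ f j) ≤ suc (d ℕ.* pw j)
      length-ζX+f^ f j {d} lf d>0 = length-addP ζX (spread (pw j ∸ 1) (mapPow (pw j) f))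
        (s≤s (ℕₚ.*-mono-≤ d>0 (pw>0 j))) (length-spread-mapPow f j lf)

      -- For j > 0 all exponents in f^(p^j) are multiples of p^j > 1, so the coefficient of X
      -- remains ζ.
      ζX+f^-≢0 : ∀ f j → 0 < j → ¬ Zero (ζX+f^ f j)
      ζX+f^-≢0 f j j>0 z = ζ≢0 (begin
        ζ                          ≡⟨ +-identityʳ ζ ⟨
        ζ + 0#                     ≡⟨ cong (ζ +_)
          (coef-spread (pw j ∸ 1) (mapPow (pw j) f) (ℕₚ.∸-monoˡ-≤ {m = 2} 1 (1<pw j>0))) ⟨
        ζ + coef (spread (pw j ∸ 1) (mapPow (pw j) f)) 1  ≡⟨ coef-addP ζX (spread (pw j ∸ 1) (mapPow (pw j) f)) 1 ⟨
        coef (ζX+f^ f j) 1         ≡⟨ z 1 ⟩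
        0# ∎)
        where open ≡-Reasoning

      -- Exponents s < r: a root w satisfies ζw = w^q = (w^m)^s = -g(w)^s.
      stage-I : k < suc a → RSubspace vs ⊎ State a (suc e)
      -- The degree of g^s is at most p^(suc a)·p^e = p^(2k), and p^(2k) + p^(suc a) ≤ m because k <
      -- suc a.
      stage-I k<a = conclude (dichotomy B (pw (k ℕ.+ k)) lB (pw-< (ℕₚ.+-monoˡ-< k k<a) (ℕₚ.m<m+n (suc a) k>0)) root)
        where
        B = ζX+f^ g e
        lB : length B ≤ suc (pw (k ℕ.+ k))
        lB = subst (λ n → length B ≤ suc n) (trans (sym (pw-+ (suc a) e)) (cong pw (trans (ℕₚ.+-comm (suc a) e) e+a)))
          (length-ζX+f^ g e length-g (pw>0 (suc a)))
        root : ∀ {w} → w ∈ ws → eval B w ≡ 0#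
        root {w} w∈ = begin
          eval B w                    ≡⟨ eval-ζX+f^ g e w ⟩
          ζ * w + eval g w ^ s        ≡⟨ cong (_+ eval g w ^ s) (root-ζ w∈) ⟨
          w ^ q + eval g w ^ s        ≡⟨ cong (λ n → w ^ n + eval g w ^ s) ms ⟨
          w ^ (m ℕ.* s) + eval g w ^ s  ≡⟨ cong (_+ eval g w ^ s)
            (trans (^-* w m s) (trans (cong (_^ s) (root-g w∈)) (frob-neg (frobExp e) (eval g w)))) ⟩
          - (eval g w ^ s) + eval g w ^ s  ≡⟨ -‿inverseˡ (eval g w ^ s) ⟩
          0# ∎
          where open ≡-Reasoning
        conclude : Zero B ⊎ Zero (deriv g) → RSubspace vs ⊎ State a (suc e)
        conclude (inj₂ z) = inj₂ (next z)
        conclude (inj₁ z) with e ℕ.≟ 0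
        ... | no e≢0 = ⊥-elim (ζX+f^-≢0 g e (ℕₚ.n≢0⇒n>0 e≢0) z)
        -- Here P = X^q - ζX: the projection is injective.
        ... | yes e≡0 = inj₁ (linearized st 0# (- ζ) (λ c cr → trans (cong (c ^_) m≡q) (^r-fixed-q cr))
            (λ x → trans (eg x) (solve 3 (λ z x y → :- (z :* x) := :0 :* y :+ (:- z) :* x) refl ζ x (x ^ r))))
          where
          s≡1 : s ≡ 1
          s≡1 = cong pw e≡0
          m≡q : m ≡ q
          m≡q = trans (sym (trans (cong (m ℕ.*_) s≡1) (ℕₚ.*-identityʳ m))) ms
          eg : ∀ x → eval g x ≡ - (ζ * x)
          eg x = +≡0⇒ (trans (+-comm _ _) (trans (cong (ζ * x +_) (sym (trans (cong (eval g x ^_) s≡1) (^-1 _))))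
            (trans (sym (eval-ζX+f^ g e x)) (eval-Zero B z x))))

      -- Exponent s = r: subtracting a multiple of h lowers the degree of ζX + g^r below r².
      stage-II : k ≡ suc a → e ≡ k → RSubspace vs ⊎ State a (suc e)
      stage-II k≡a e≡k = conclude (dichotomy B ((r ∸ 1) ℕ.* r) lB (ℕₚ.≤-reflexive small) root)
        where
        -- In g^r the top term γX^r of g becomes cX^(r²) = cX^m, and X^m equals -g at the roots.
        -- What remains, ζX + g₀^r - cg, has degree at most (r - 1)r.
        γ = coef g r
        c = γ ^ r
        g₀ = take r g
        B = addP (ζX+f^ g₀ k) (negP (scaleP c g))
        s≡r : s ≡ r
        s≡r = cong pw e≡k
        m≡rr : m ≡ r ℕ.* r
        m≡rr = trans (cong (λ t → pw (t ℕ.+ k)) (sym k≡a)) (pw-+ k k)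
        lg : length g ≤ suc r
        lg = subst (λ t → length g ≤ suc (pw t)) (sym k≡a) length-g
        r-1>0 : 0 < r ∸ 1
        r-1>0 = ℕₚ.∸-monoˡ-≤ {m = 2} 1 (1<pw k>0)
        small : (r ∸ 1) ℕ.* r ℕ.+ pw (suc a) ≡ m
        small = begin
          (r ∸ 1) ℕ.* r ℕ.+ pw (suc a)  ≡⟨ cong (λ t → (r ∸ 1) ℕ.* r ℕ.+ pw t) k≡a ⟨
          (r ∸ 1) ℕ.* r ℕ.+ r           ≡⟨ ℕₚ.+-comm _ r ⟩
          suc (r ∸ 1) ℕ.* r             ≡⟨ cong (ℕ._* r) (suc-pred-pw k) ⟩
          r ℕ.* r                       ≡⟨ m≡rr ⟨
          m ∎
          where open ≡-Reasoning
        lB : length B ≤ suc ((r ∸ 1) ℕ.* r)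
        lB = length-addP (ζX+f^ g₀ k) (negP (scaleP c g))
          (length-ζX+f^ g₀ k (subst (length g₀ ≤_) (sym (suc-pred-pw k))
            (ℕₚ.≤-trans (ℕₚ.≤-reflexive (length-take r g)) (ℕₚ.m⊓n≤m r (length g)))) r-1>0)
          (length-negP (scaleP c g) (length-scaleP c g
            (ℕₚ.≤-trans lg (s≤s (ℕₚ.m≤n*m r (r ∸ 1) {{ℕ.>-nonZero r-1>0}})))))
        eg : ∀ x → eval g x ≡ eval g₀ x + γ * x ^ r
        eg = eval-take r g lg
        eB : ∀ x → eval B x ≡ (ζ * x + eval g₀ x ^ r) - c * eval g x
        eB x = trans (eval-addP (ζX+f^ g₀ k) (negP (scaleP c g)) x)
          (cong₂ _+_ (eval-ζX+f^ g₀ k x) (trans (eval-negP (scaleP c g) x) (cong -_ (eval-scaleP c g x))))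
        root : ∀ {w} → w ∈ ws → eval B w ≡ 0#
        root {w} w∈ = begin
          eval B w                                              ≡⟨ eB w ⟩
          (ζ * w + eval g₀ w ^ r) - c * eval g w                ≡⟨ cong (λ t → (t + eval g₀ w ^ r) - c * eval g w) ζw ⟩
          (- (eval g₀ w ^ r + c * (- eval g w)) + eval g₀ w ^ r) - c * eval g w
            ≡⟨ solve 3 (λ a c b → (:- (a :+ c :* (:- b)) :+ a) :- c :* b := :0) refl (eval g₀ w ^ r) c (eval g w) ⟩
          0# ∎
          where
          open ≡-Reasoning
          gr : eval g w ^ r ≡ eval g₀ w ^ r + c * (- eval g w)
          gr = begin
            eval g w ^ r                           ≡⟨ cong (_^ r) (eg w) ⟩
            (eval g₀ w + γ * w ^ r) ^ r            ≡⟨ frob+ (frobExp k) _ _ ⟩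
            eval g₀ w ^ r + (γ * w ^ r) ^ r        ≡⟨ cong (eval g₀ w ^ r +_) (^-mul γ (w ^ r) r) ⟩
            eval g₀ w ^ r + c * (w ^ r) ^ r        ≡⟨ cong (λ t → eval g₀ w ^ r + c * t)
              (trans (sym (^-* w r r)) (trans (cong (w ^_) (sym m≡rr)) (root-g w∈))) ⟩
            eval g₀ w ^ r + c * (- eval g w) ∎
          ζw : ζ * w ≡ - (eval g₀ w ^ r + c * (- eval g w))
          ζw = begin
            ζ * w                ≡⟨ root-ζ w∈ ⟨
            w ^ q                ≡⟨ cong (w ^_) ms ⟨
            w ^ (m ℕ.* s)        ≡⟨ ^-* w m s ⟩
            (w ^ m) ^ s          ≡⟨ cong₂ _^_ (root-g w∈) s≡r ⟩
            (- eval g w) ^ r     ≡⟨ frob-neg (frobExp k) _ ⟩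
            - (eval g w ^ r)     ≡⟨ cong -_ gr ⟩
            - (eval g₀ w ^ r + c * (- eval g w)) ∎
        conclude : Zero B ⊎ Zero (deriv g) → RSubspace vs ⊎ State a (suc e)
        conclude (inj₂ z) = inj₂ (next z)
        conclude (inj₁ z) = inj₁ (linearized st γ b
          (λ x xr → trans (cong (x ^_) m≡rr) (trans (^-* x r r) (trans (cong (_^ r) xr) xr))) eg′)
          where
          b = coef g 1
          -- All exponents in g₀^r are multiples of r, so for the exponents 1 to r - 1 the equation
          -- B = 0 compares ζX with cg. Hence c ≠ 0, and g has no terms strictly between X and X^r.
          coefB : ∀ i → i < r ∸ 1 → coef ζX (suc i) ≡ c * coef g (suc i)
          coefB i lt = -‿≡0 (begin
            coef ζX (suc i) - c * coef g (suc i)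
              ≡⟨ cong₂ _+_ (sym (+-identityʳ _)) (cong -_ (sym (coef-scaleP c g (suc i)))) ⟩
            (coef ζX (suc i) + 0#) - coef (scaleP c g) (suc i)
              ≡⟨ cong₂ (λ s t → (coef ζX (suc i) + s) + t) (coef-spread (r ∸ 1) (mapPow r g₀) lt)
                (coef-negP (scaleP c g) (suc i)) ⟨
            (coef ζX (suc i) + coef (spread (r ∸ 1) (mapPow r g₀)) (suc i)) + coef (negP (scaleP c g)) (suc i)
              ≡⟨ cong (_+ coef (negP (scaleP c g)) (suc i)) (coef-addP ζX (spread (r ∸ 1) (mapPow r g₀)) (suc i)) ⟨
            coef (ζX+f^ g₀ k) (suc i) + coef (negP (scaleP c g)) (suc i)
              ≡⟨ coef-addP (ζX+f^ g₀ k) (negP (scaleP c g)) (suc i) ⟨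
            coef B (suc i)   ≡⟨ z (suc i) ⟩
            0# ∎)
            where open ≡-Reasoning
          c≢0 : c ≢ 0#
          c≢0 c0 = ζ≢0 (trans (coefB 0 r-1>0) (trans (cong (_* coef g 1) c0) (zeroˡ _)))
          mid : ∀ i → suc i < r ∸ 1 → coef g (suc (suc i)) ≡ 0#
          mid i lt with *-zero (sym (coefB (suc i) lt))
          ... | inj₁ c0 = ⊥-elim (c≢0 c0)
          ... | inj₂ e₀ = e₀
          G′ = addP (0# ∷ b ∷ []) (scaleP γ (mono r))
          coefG′ : ∀ i → i ≢ r → coef G′ i ≡ coef (0# ∷ b ∷ []) i
          coefG′ i ne = trans (coef-addP (0# ∷ b ∷ []) (scaleP γ (mono r)) i) (trans (cong (coef (0# ∷ b ∷ []) i +_)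
            (trans (coef-scaleP γ (mono r) i) (trans (cong (γ *_) (coef-mono-≢ r ne)) (zeroʳ γ)))) (+-identityʳ _))
          g≋G′ : g ≋ G′
          g≋G′ zero = trans (const g (g0 st)) (sym (coefG′ 0 (ℕₚ.<⇒≢ (pw>0 k))))
            where
            const : ∀ g → eval g 0# ≡ 0# → coef g 0 ≡ 0#
            const [] _ = refl
            const (c ∷ g) e₀ = trans (solve 2 (λ c x → c := c :+ :0 :* x) refl c (eval g 0#)) e₀
          g≋G′ (suc zero) = sym (coefG′ 1 (ℕₚ.<⇒≢ (1<pw k>0)))
          g≋G′ i@(suc (suc j)) with ℕₚ.<-cmp i r
          ... | tri< lt ne _ = trans (mid j (ℕₚ.∸-monoˡ-≤ 1 lt)) (sym (coefG′ i ne))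
          ... | tri> _ ne gt = trans (coef-≥ g (ℕₚ.≤-trans lg gt)) (sym (coefG′ i ne))
          ... | tri≈ _ i≡r _ = trans (cong (coef g) i≡r) (sym (trans (coef-addP (0# ∷ b ∷ []) (scaleP γ (mono r)) i)
            (trans (+-identityˡ _) (trans (coef-scaleP γ (mono r) i)
              (trans (cong (γ *_) (trans (cong (coef (mono r)) i≡r) (coef-mono-≡ r))) (*-identityʳ γ))))))
          eg′ : ∀ x → eval g x ≡ γ * x ^ r + b * x
          eg′ x = begin
            eval g x              ≡⟨ eval-≋ g G′ g≋G′ x ⟩
            eval G′ x             ≡⟨ eval-addP (0# ∷ b ∷ []) (scaleP γ (mono r)) x ⟩
            eval (0# ∷ b ∷ []) x + eval (scaleP γ (mono r)) x  ≡⟨ cong (eval (0# ∷ b ∷ []) x +_)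
              (trans (eval-scaleP γ (mono r) x) (cong (γ *_) (eval-mono r x))) ⟩
            eval (0# ∷ b ∷ []) x + γ * x ^ r  ≡⟨ solve 3 (λ b x y → (:0 :+ x :* (b :+ x :* :0)) :+ y := y :+ b :* x)
              refl b x (γ * x ^ r) ⟩
            γ * x ^ r + b * x ∎
            where open ≡-Reasoning

      -- Exponents r < s < r²: with C(X) = g^[m](-g(X)), a root w satisfies w^(m²) = -C(w), and
      -- w^(m²) is a p-power of ζw (m² ≥ q) or has ζw as a p-power (m² < q); m² = q is excluded as k is odd.
      module Stage-III (a<k : suc a < k) where
        private
          a′ = suc a
          gm = mapPow m g
          C = compP gm (negP g)

        lC : length C ≤ suc (pw a′ ℕ.* pw a′)
        lC = length-compP gm (negP g) (pw a′) (pw a′) (subst (_≤ suc (pw a′)) (sym (length-map _ g)) length-g)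
          (length-negP g length-g)

        eC : ∀ x → eval C x ≡ eval gm (- eval g x)
        eC x = trans (eval-compP gm (negP g) x) (cong (eval gm) (eval-negP g x))

        root-C : ∀ {w} → w ∈ ws → (w ^ m) ^ m ≡ - eval C w
        root-C {w} w∈ = begin
          (w ^ m) ^ m            ≡⟨ cong (_^ m) (root-g w∈) ⟩
          (- eval g w) ^ m       ≡⟨ frob-neg (frobExp (a′ ℕ.+ k)) _ ⟩
          - (eval g w ^ m)       ≡⟨ cong -_ (eval-mapPow (frobExp (a′ ℕ.+ k)) g w) ⟩
          - eval gm (w ^ m)      ≡⟨ cong (λ t → - eval gm t) (root-g w∈) ⟩
          - eval gm (- eval g w) ≡⟨ cong -_ (eC w) ⟨
          - eval C w ∎
          where open ≡-Reasoning

        -- As j > 0, the coefficient of X in B = ζX + C^(p^j) is ζ, so B is not zero. Its degree is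
        -- at most p^(2a′ + j) = p^k, and m²p^j = q makes it vanish at the roots.
        low : ∀ j → 0 < j → j ℕ.+ (a′ ℕ.+ a′) ≡ k → Zero (deriv g)
        low j j>0 j+2a≡k = conclude (dichotomy B (pw k) lB (pw-< (ℕₚ.m<n+m k (s≤s z≤n)) (ℕₚ.m<m+n a′ k>0)) root)
          where
          B = ζX+f^ C j
          lB : length B ≤ suc (pw k)
          lB = subst (λ n → length B ≤ suc n)
            (trans (cong (ℕ._* pw j) (sym (pw-+ a′ a′)))
            (trans (sym (pw-+ (a′ ℕ.+ a′) j)) (cong pw (trans (ℕₚ.+-comm (a′ ℕ.+ a′) j) j+2a≡k))))
            (length-ζX+f^ C j lC (ℕₚ.*-mono-≤ (pw>0 a′) (pw>0 a′)))
          mmj : m ℕ.* m ℕ.* pw j ≡ q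
          mmj = trans (cong (ℕ._* pw j) (sym (pw-+ (a′ ℕ.+ k) (a′ ℕ.+ k))))
            (trans (sym (pw-+ (a′ ℕ.+ k ℕ.+ (a′ ℕ.+ k)) j))
            (cong pw (trans (lem a′ k j) (cong (ℕ._+ (k ℕ.+ k)) j+2a≡k))))
            where
            lem : ∀ a k j → a ℕ.+ k ℕ.+ (a ℕ.+ k) ℕ.+ j ≡ j ℕ.+ (a ℕ.+ a) ℕ.+ (k ℕ.+ k)
            lem = solve-∀
          root : ∀ {w} → w ∈ ws → eval B w ≡ 0#
          root {w} w∈ = begin
            eval B w                                 ≡⟨ eval-ζX+f^ C j w ⟩
            ζ * w + eval C w ^ pw j                  ≡⟨ cong (_+ eval C w ^ pw j) (root-ζ w∈) ⟨
            w ^ q + eval C w ^ pw j                  ≡⟨ cong (λ n → w ^ n + eval C w ^ pw j) mmj ⟨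
            w ^ (m ℕ.* m ℕ.* pw j) + eval C w ^ pw j ≡⟨ cong (_+ eval C w ^ pw j)
              (trans (^-* w (m ℕ.* m) (pw j)) (cong (_^ pw j) (trans (^-* w m m) (root-C w∈)))) ⟩
            (- eval C w) ^ pw j + eval C w ^ pw j    ≡⟨ cong (_+ eval C w ^ pw j) (frob-neg (frobExp j) _) ⟩
            - (eval C w ^ pw j) + eval C w ^ pw j    ≡⟨ -‿inverseˡ _ ⟩
            0# ∎
            where open ≡-Reasoning
          conclude : Zero B ⊎ Zero (deriv g) → Zero (deriv g)
          conclude (inj₁ z) = ⊥-elim (ζX+f^-≢0 C j j>0 z)
          conclude (inj₂ z) = z

        -- Now m² = q p^j, so it is ζX that is raised to the power p^j: B = ζ′X^(p^j) + C has degree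
        -- at most p^(2a′), small because a′ < k. Unlike in `low`, B may vanish identically, and
        -- derivatives are needed.
        high : ∀ j → 0 < j → j ℕ.+ k ≡ a′ ℕ.+ a′ → Zero (deriv g)
        high j j>0 j+k≡2a = conclude (dichotomy B (pw (a′ ℕ.+ a′)) lB small root)
          where
          ζ′ = ζ ^ pw j
          monic = scaleP ζ′ (mono (pw j))
          B = addP monic C
          small : pw (a′ ℕ.+ a′) ℕ.+ pw a′ ≤ m
          small = pw-< (ℕₚ.+-monoʳ-< a′ a<k) (ℕₚ.m<m+n a′ k>0)
          lC′ : length C ≤ suc (pw (a′ ℕ.+ a′))
          lC′ = subst (λ n → length C ≤ suc n) (sym (pw-+ a′ a′)) lC
          lB : length B ≤ suc (pw (a′ ℕ.+ a′))
          lB = length-addP monic C (length-scaleP ζ′ (mono (pw j))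
            (ℕₚ.≤-trans (ℕₚ.≤-reflexive (length-mono (pw j))) (s≤s (pw-mono (subst (j ≤_) j+k≡2a (ℕₚ.m≤m+n j k)))))) lC′
          eB : ∀ x → eval B x ≡ ζ′ * x ^ pw j + eval C x
          eB x = trans (eval-addP monic C x)
            (cong (_+ eval C x) (trans (eval-scaleP ζ′ (mono (pw j)) x) (cong (ζ′ *_) (eval-mono (pw j) x))))
          mm : m ℕ.* m ≡ q ℕ.* pw j
          mm = trans (sym (pw-+ (a′ ℕ.+ k) (a′ ℕ.+ k)))
            (trans (cong pw (trans (lem a′ k) (trans (cong (ℕ._+ (k ℕ.+ k)) (sym j+k≡2a)) (lem′ j k)))) (pw-+ k3 j))
            where
            lem : ∀ a k → a ℕ.+ k ℕ.+ (a ℕ.+ k) ≡ (a ℕ.+ a) ℕ.+ (k ℕ.+ k)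
            lem = solve-∀
            lem′ : ∀ j k → j ℕ.+ k ℕ.+ (k ℕ.+ k) ≡ k ℕ.+ (k ℕ.+ k) ℕ.+ j
            lem′ = solve-∀
          root : ∀ {w} → w ∈ ws → eval B w ≡ 0#
          root {w} w∈ = begin
            eval B w                        ≡⟨ eB w ⟩
            ζ′ * w ^ pw j + eval C w        ≡⟨ cong (_+ eval C w)
              (trans (sym (^-mul ζ w (pw j))) (cong (_^ pw j) (sym (root-ζ w∈)))) ⟩
            (w ^ q) ^ pw j + eval C w       ≡⟨ cong (_+ eval C w)
              (trans (sym (^-* w q (pw j))) (trans (cong (w ^_) (sym mm)) (^-* w m m))) ⟩
            (w ^ m) ^ m + eval C w          ≡⟨ cong (_+ eval C w) (root-C w∈) ⟩
            - eval C w + eval C w           ≡⟨ -‿inverseˡ _ ⟩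
            0# ∎
            where open ≡-Reasoning
          -- If B = 0 then g is injective on F, and differentiating gives (g^[m])′(-g) g′ = 0.
          degenerate : Zero B → Zero (deriv g)
          degenerate z with mul-Zero (compP (deriv gm) (negP g)) (deriv (negP g)) lens prod0
            where
            open ≡-Reasoning
            dB0 : ∀ x → eval (deriv B) x ≡ 0#
            dB0 = eval-Zero (deriv B) λ i →
              trans (coef-deriv B i) (trans (cong (natF (suc i) *_) (z (suc i))) (zeroʳ _))
            prod0 : ∀ x → eval (compP (deriv gm) (negP g)) x * eval (deriv (negP g)) x ≡ 0#
            prod0 x = begin
              eval (compP (deriv gm) (negP g)) x * eval (deriv (negP g)) x       ≡⟨ cong (_* eval (deriv (negP g)) x)
                (eval-compP (deriv gm) (negP g) x) ⟩
              eval (deriv gm) (eval (negP g) x) * eval (deriv (negP g)) x        ≡⟨ eval-deriv-compP gm (negP g) x ⟨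
              eval (deriv C) x                                                   ≡⟨ +-identityˡ _ ⟨
              0# + eval (deriv C) x
                ≡⟨ cong (_+ eval (deriv C) x) (trans (eval-deriv-scaleP ζ′ (mono (pw j)) x)
                  (trans (cong (ζ′ *_) (eval-Zero (deriv (mono (pw j))) (deriv-mono-Zero (pw j) (p∣pw j>0)) x))
                  (zeroʳ _))) ⟨
              eval (deriv monic) x + eval (deriv C) x                            ≡⟨ eval-deriv-addP monic C x ⟨
              eval (deriv B) x                                                   ≡⟨ dB0 x ⟩
              0# ∎
            lens : length (compP (deriv gm) (negP g)) ℕ.+ length (deriv (negP g)) ≤ order
            lens = ℕₚ.≤-trans (ℕₚ.+-mono-≤
              (subst (λ n → length (compP (deriv gm) (negP g)) ≤ suc n) (sym (pw-+ a′ a′))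
                (length-compP (deriv gm) (negP g) (pw a′) (pw a′)
                  (ℕₚ.m≤n⇒m≤1+n (length-deriv gm (subst (_≤ suc (pw a′)) (sym (length-map _ g)) length-g)))
                  (length-negP g length-g)))
              (length-deriv (negP g) (length-negP g length-g)))
              (ℕₚ.≤-trans (s≤s (ℕₚ.≤-trans small m≤q)) q<order)
          ... | inj₂ z′ = evalAll0⇒Zero (deriv g)
            (ℕₚ.≤-trans (length-deriv g (ℕₚ.m≤n⇒m≤1+n g≤m)) (ℕₚ.≤-trans m≤q (ℕₚ.<⇒≤ q<order)))
              λ x → trans (sym (-‿involutive _))
                (trans (cong -_ (trans (sym (eval-deriv-negP g x)) (eval-Zero (deriv (negP g)) z′ x))) -0#≈0#)
          ... | inj₁ z′ = coefs
            where
            inj : ∀ {x y} → eval (negP g) x ≡ eval (negP g) y → x ≡ y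
            inj {x} {y} e₀ = frob-inj (frobExp j)
              (*-cancelˡ (^-≢0 (pw j) ζ≢0) (trans (ζC x) (trans (cong -_ Cxy) (sym (ζC y)))))
              where
              ζC : ∀ x → ζ′ * x ^ pw j ≡ - eval C x
              ζC x = +≡0⇒ (trans (sym (eB x)) (eval-Zero B z x))
              Cxy : eval C x ≡ eval C y
              Cxy = trans (eval-compP gm (negP g) x) (trans (cong (eval gm) e₀) (sym (eval-compP gm (negP g) y)))
            -- Being injective, -g takes `order` many distinct values, all of them roots of
            -- (g^[m])′.
            dgm0 : Zero (deriv gm)
            dgm0 = roots⇒Zero (deriv gm) (map⁺ {f = eval (negP g)} inj unique) root₀
              (subst (length (deriv gm) ≤_) (sym (length-map (eval (negP g)) elements))
                (ℕₚ.≤-trans (length-deriv gm (subst (_≤ suc m) (sym (length-map _ g)) (ℕₚ.m≤n⇒m≤1+n g≤m)))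
                (ℕₚ.≤-trans m≤q (ℕₚ.<⇒≤ q<order))))
              where
              root₀ : ∀ {y} → y ∈ map (eval (negP g)) elements → eval (deriv gm) y ≡ 0#
              root₀ y∈ with ∈-map⁻ (eval (negP g)) y∈
              ... | x , _ , refl = trans (sym (eval-compP (deriv gm) (negP g) x))
                (eval-Zero (compP (deriv gm) (negP g)) z′ x)
            -- The coefficients of g^[m] are m-th powers of those of g, so both derivatives vanish
            -- together.
            coefs : Zero (deriv g)
            coefs i with *-zero (trans (sym (coef-deriv gm i)) (dgm0 i))
            ... | inj₁ n0 = trans (coef-deriv g i) (trans (cong (_* coef g (suc i)) n0) (zeroˡ _))
            ... | inj₂ c0 = trans (coef-deriv g i)
              (trans (cong (natF (suc i) *_) (^-≡0 m (trans (sym (coef-mapPow (frobExp (a′ ℕ.+ k)) g (suc i))) c0)))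
              (zeroʳ _))
          conclude : Zero B ⊎ Zero (deriv g) → Zero (deriv g)
          conclude (inj₁ z) = degenerate z
          conclude (inj₂ z) = z

        stage-III : State a (suc e)
        stage-III = by-size (ℕₚ.<-cmp (a′ ℕ.+ a′) k)
          where
          by-size : Tri (a′ ℕ.+ a′ < k) (a′ ℕ.+ a′ ≡ k) (k < a′ ℕ.+ a′) → State a (suc e)
          by-size (tri< lt _ _) = next (low (k ∸ (a′ ℕ.+ a′)) (ℕₚ.m<n⇒0<n∸m lt) (ℕₚ.m∸n+n≡m (ℕₚ.<⇒≤ lt)))
          by-size (tri≈ _ eq′ _) = ⊥-elim (k-odd a′ (sym eq′))
          by-size (tri> _ _ gt) = next (high ((a′ ℕ.+ a′) ∸ k) (ℕₚ.m<n⇒0<n∸m gt) (ℕₚ.m∸n+n≡m (ℕₚ.<⇒≤ gt)))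

    -- Since e + (a + 1) = 2k, comparing a + 1 with k amounts to comparing s = p^e with r, which
    -- selects the stage.
    loop : ∀ a e → State a e → RSubspace vs
    loop zero e st = final st
    loop (suc a) e st = by-size (ℕₚ.<-cmp (suc a) k)
      where
      continue : RSubspace vs ⊎ State a (suc e) → RSubspace vs
      continue (inj₁ c) = c
      continue (inj₂ st′) = loop a (suc e) st′
      by-size : Tri (suc a < k) (suc a ≡ k) (k < suc a) → RSubspace vs
      by-size (tri< lt _ _) = loop a (suc e) (Step.Stage-III.stage-III st lt)
      by-size (tri> _ _ gt) = continue (Step.stage-I st gt)
      by-size (tri≈ _ a≡k _) = continue
        (Step.stage-II st (sym a≡k) (ℕₚ.+-cancelʳ-≡ k e k (trans (cong (e ℕ.+_) (sym a≡k)) (State.e+a st))))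

    -- The start is a = 2k and e = 0: p^(2k) = r² bounds deg g, and p^(3k) = q is the degree of the
    -- whole polynomial.
    lacunary : ∀ g → length g ≤ suc (r ℕ.* r) → (∀ x → linProd vs x ≡ x ^ q + eval g x) → RSubspace vs
    lacunary g lg e = loop (k ℕ.+ k) 0 record { e+a = refl ; g = g ; length-g = subst (λ n → length g ≤ suc n)
      (sym (pw-+ k k)) lg
      ; eq = λ x → trans (e x) (trans (cong (λ n → x ^ pw n + eval g x) (ℕₚ.+-comm k (k ℕ.+ k))) (sym (^-1 _))) }

  open import Data.List.Membership.DecPropositional _≟_ using (_∈?_)
  open import Data.List.Relation.Unary.Unique.DecPropositional.Properties _≟_ using (deduplicate-!)

  -- Slopes and Rédei polynomials

  root-bound : ∀ f n → ¬ Zero f → length f ≤ suc n → ∀ {zs} → Unique zs → (∀ {z} → z ∈ zs → eval f z ≡ 0#) →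
    length zs ≤ n
  root-bound f n nz lf {zs} u root with length zs ℕ.≤? n
  ... | yes le = le
  ... | no ¬le = ⊥-elim (nz (roots⇒Zero f u root (ℕₚ.≤-trans lf (ℕₚ.≰⇒> ¬le))))

  frob-q : FrobExp q
  frob-q = frobExp (k ℕ.+ (k ℕ.+ k))

  frob-r : FrobExp r
  frob-r = frobExp k

  0<q : 0 < q
  0<q = ℕₚ.≤-trans (s≤s z≤n) q≥8

  ^qq : ∀ x → (x ^ q) ^ q ≡ x
  ^qq x = trans (sym (^-* x q q)) (trans (cong (x ^_) (sym order-qq)) (fermat x))

  -- The slope of x ≠ 0 determines the K-line through x.
  slope : Carrier → Carrier
  slope x = x ^ q * inv x

  slope-* : ∀ {x} → x ≢ 0# → slope x * x ≡ x ^ q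
  slope-* {x} x≢0 = trans (*-assoc _ _ _) (trans (cong (x ^ q *_) (inv-l x≢0)) (*-identityʳ _))

  slope-unique : ∀ {x z} → x ≢ 0# → z * x ≡ x ^ q → slope x ≡ z
  slope-unique {x} {z} x≢0 e = *-cancelˡ x≢0 (trans (*-comm _ _) (trans (slope-* x≢0) (trans (sym e) (*-comm _ _))))

  slope≢0 : ∀ {x} → x ≢ 0# → slope x ≢ 0#
  slope≢0 x≢0 = *-≢0 (^-≢0 q x≢0) (inv≢0 x≢0)

  -- The slope is x^(q-1), so its (q+1)-st power is x^(q²-1) = 1.
  slope-^q : ∀ {x} → x ≢ 0# → slope x * slope x ^ q ≡ 1#
  slope-^q {x} x≢0 = begin
    (x ^ q * inv x) * (x ^ q * inv x) ^ q          ≡⟨ cong ((x ^ q * inv x) *_) (^-mul (x ^ q) (inv x) q) ⟩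
    (x ^ q * inv x) * ((x ^ q) ^ q * inv x ^ q)    ≡⟨ cong₂ (λ s t → (x ^ q * inv x) * (s * t)) (^qq x) (^-inv q x≢0) ⟩
    (x ^ q * inv x) * (x * inv (x ^ q))            ≡⟨ solve 4
      (λ a b c d → (a :* b) :* (c :* d) := (a :* d) :* (c :* b)) refl (x ^ q) (inv x) x (inv (x ^ q)) ⟩
    (x ^ q * inv (x ^ q)) * (x * inv x)            ≡⟨ cong₂ _*_ (inv-r (^-≢0 q x≢0)) (inv-r x≢0) ⟩
    1# * 1#                                        ≡⟨ *-identityˡ 1# ⟩
    1# ∎
    where open ≡-Reasoning

  X^q-cX : Carrier → Poly
  X^q-cX c = addP (mono q) (0# ∷ - c ∷ [])

  eval-X^q-cX : ∀ c x → eval (X^q-cX c) x ≡ x ^ q - c * x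
  eval-X^q-cX c x = trans (eval-addP (mono q) (0# ∷ - c ∷ []) x) (trans (cong (_+ _) (eval-mono q x))
    (solve 3 (λ c x y → y :+ (:0 :+ x :* (:- c :+ x :* :0)) := y :- c :* x) refl c x (x ^ q)))

  length-X^q-cX : ∀ c → length (X^q-cX c) ≤ suc q
  length-X^q-cX c = length-addP (mono q) (0# ∷ - c ∷ []) (ℕₚ.≤-reflexive (length-mono q)) (s≤s 0<q)

  coef-X^q-cX : ∀ c i → 1 < i → coef (X^q-cX c) i ≡ coef (mono q) i
  coef-X^q-cX c (suc (suc i)) _ = trans (coef-addP (mono q) (0# ∷ - c ∷ []) (suc (suc i))) (+-identityʳ _)
  coef-X^q-cX c (suc zero) (s≤s ())

  X^q-cX≢0 : ∀ c → ¬ Zero (X^q-cX c)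
  X^q-cX≢0 c z = 1≢0 (trans (sym (coef-mono-≡ q)) (trans (sym (coef-X^q-cX c q (ℕₚ.≤-trans (s≤s (s≤s z≤n)) q≥8)))
    (z q)))

  -- X^q - cX has at most q roots. With various c this bounds slope fibres, K itself, the image of
  -- x^q - x, and, through projections, every clique.
  eigen-bound : ∀ c {zs} → Unique zs → (∀ {z} → z ∈ zs → z ^ q ≡ c * z) → length zs ≤ q
  eigen-bound c u e = root-bound (X^q-cX c) q (X^q-cX≢0 c) (length-X^q-cX c) u
    (λ {z} z∈ → trans (eval-X^q-cX c z) (≡⇒-‿0 (e z∈)))

  slope-fibre : ∀ z {xs} → Unique xs → (∀ {x} → x ∈ xs → x ≢ 0#) → (∀ {x} → x ∈ xs → slope x ≡ z) → length xs ≤ q ∸ 1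
  slope-fibre z {xs} u nz e = ℕₚ.∸-monoˡ-≤ 1 (eigen-bound z {0# ∷ xs} (All.tabulate (λ x∈ 0≡x → nz x∈ (sym 0≡x)) ∷ u)
    λ { (here refl) → trans (0^ q 0<q) (sym (zeroʳ z)) ; (there x∈) →
      trans (sym (slope-* (nz x∈))) (cong (_* _) (e x∈)) })

  slopes : List Carrier
  slopes = deduplicate _≟_ (map slope elements*)

  slopes-unique : Unique slopes
  slopes-unique = deduplicate-! (map slope elements*)

  ∈-slopes : ∀ {x} → x ≢ 0# → slope x ∈ slopes
  ∈-slopes x≢0 = ∈-deduplicate⁺ _≟_ (∈-map⁺ slope (∈* x≢0))

  ∈-slopes⁻ : ∀ {z} → z ∈ slopes → ∃[ y ] (y ≢ 0# × z ≡ slope y)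
  ∈-slopes⁻ z∈ with ∈-map⁻ slope (∈-deduplicate⁻ _≟_ (map slope elements*) z∈)
  ... | y , y∈ , e = y , ∈*⁻ y∈ , e

  -- The q² - 1 = (q + 1)(q - 1) nonzero elements are distributed over fibres of at most q - 1
  -- elements.
  q<slopes : q < length slopes
  q<slopes = ℕₚ.*-cancelʳ-≤ (suc q) (length slopes) (q ∸ 1)
    {{ℕ.>-nonZero (ℕₚ.∸-monoˡ-≤ {m = 2} 1 (ℕₚ.≤-trans (s≤s (s≤s z≤n)) q≥8))}}
    (ℕₚ.≤-trans (ℕₚ.≤-reflexive sq) (fibre-bound _≟_ slope (q ∸ 1) slopes elements* (λ x∈ → ∈-slopes (∈*⁻ x∈))
      λ z → slope-fibre z (filter⁺ _ unique*) (λ x∈ → ∈*⁻ (proj₁ (∈-filter⁻ (λ x → slope x ≟ z) {xs = elements*} x∈)))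
        (λ x∈ → proj₂ (∈-filter⁻ (λ x → slope x ≟ z) {xs = elements*} x∈))))
    where
    sq : suc q ℕ.* (q ∸ 1) ≡ length elements*
    sq = ℕₚ.suc-injective (trans (lem q 0<q) (sym (trans length* order-qq)))
      where
      lem′ : ∀ n → suc (suc (suc n) ℕ.* n) ≡ suc n ℕ.* suc n
      lem′ = solve-∀
      lem : ∀ n → 0 < n → suc (suc n ℕ.* (n ∸ 1)) ≡ n ℕ.* n
      lem (suc n) _ = lem′ n

  -- The fibres of π z on F are the K-lines of slope z.
  π : Carrier → Carrier → Carrier
  π z u = u * z - u ^ q

  π-+ : ∀ z u v → π z (u + v) ≡ π z u + π z v
  π-+ z u v = trans (cong (λ t → (u + v) * z - t) (frob+ frob-q u v))
    (solve 5 (λ u v z a b → (u :+ v) :* z :- (a :+ b) := (u :* z :- a) :+ (v :* z :- b)) refl u v z (u ^ q) (v ^ q))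

  π-* : ∀ z c u → c ^ q ≡ c → π z (c * u) ≡ c * π z u
  π-* z c u cq = trans (cong (λ t → c * u * z - t) (trans (^-mul c u q) (cong (_* u ^ q) cq)))
    (solve 4 (λ c u z a → c :* u :* z :- c :* a := c :* (u :* z :- a)) refl c u z (u ^ q))

  π-slope : ∀ {z u v} → u ≢ v → π z u ≡ π z v → slope (u - v) ≡ z
  π-slope {z} {u} {v} u≢v e = slope-unique (u≢v ∘ -‿≡0) (begin
    z * (u - v)                            ≡⟨ solve 5 (λ z u v a b → z :* (u :- v) := ((u :* z :- a) :- (v :* z :- b))
      :+ (a :- b)) refl z u v (u ^ q) (v ^ q) ⟩
    (π z u - π z v) + (u ^ q - v ^ q)      ≡⟨ cong (_+ (u ^ q - v ^ q)) (≡⇒-‿0 e) ⟩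
    0# + (u ^ q - v ^ q)                   ≡⟨ +-identityˡ _ ⟩
    u ^ q - v ^ q                          ≡⟨ frob-sub frob-q u v ⟨
    (u - v) ^ q ∎)
    where open ≡-Reasoning

  -- All projections along slope z lie in one set of at most q elements, the roots of X^q + z^q X.
  -- This supplies ζ for the lacunary argument.
  π-eigen : ∀ {z} u → z * z ^ q ≡ 1# → π z u ^ q ≡ (- (z ^ q)) * π z u
  π-eigen {z} u zz = begin
    (u * z - u ^ q) ^ q                  ≡⟨ frob-sub frob-q (u * z) (u ^ q) ⟩
    (u * z) ^ q - (u ^ q) ^ q            ≡⟨ cong₂ _-_ (^-mul u z q) (^qq u) ⟩
    u ^ q * z ^ q - u                    ≡⟨ cong (λ t → u ^ q * z ^ q - t) (*-identityʳ u) ⟨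
    u ^ q * z ^ q - u * 1#               ≡⟨ cong (λ t → u ^ q * z ^ q - u * t) zz ⟨
    u ^ q * z ^ q - u * (z * z ^ q)      ≡⟨ solve 4 (λ a b u z → a :* b :- u :* (z :* b) := (:- b) :* (u :* z :- a))
      refl (u ^ q) (z ^ q) u z ⟩
    (- (z ^ q)) * (u * z - u ^ q) ∎
    where open ≡-Reasoning

  -- redei us i is, as a polynomial in z, the coefficient of Xⁱ in ∏_{u ∈ us} (X - π z u).
  redei : List Carrier → ℕ → Poly
  redei [] zero = 1# ∷ []
  redei [] (suc i) = []
  redei (u ∷ us) zero = mulP (redei us zero) (u ^ q ∷ - u ∷ [])
  redei (u ∷ us) (suc i) = addP (redei us i) (mulP (redei us (suc i)) (u ^ q ∷ - u ∷ []))

  eval-redei : ∀ us i z → eval (redei us i) z ≡ coef (prodP (map (π z) us)) i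
  eval-redei [] zero z = solve 1 (λ z → :1 :+ z :* :0 := :1) refl z
  eval-redei [] (suc i) z = refl
  eval-redei (u ∷ us) zero z = trans (eval-mulP (redei us 0) (u ^ q ∷ - u ∷ []) z)
    (trans (cong (_* eval (u ^ q ∷ - u ∷ []) z) (eval-redei us 0 z))
    (sym (trans (coef-addP (0# ∷ P) (scaleP (- π z u) P) 0) (trans (cong (0# +_) (coef-scaleP (- π z u) P 0))
      (solve 4 (λ u z a b → :0 :+ (:- (u :* z :- a)) :* b := b :* (a :+ z :* (:- u :+ z :* :0))) refl u z (u ^ q)
        (coef P 0))))))
    where P = prodP (map (π z) us)
  eval-redei (u ∷ us) (suc i) z = trans (eval-addP (redei us i) (mulP (redei us (suc i)) (u ^ q ∷ - u ∷ [])) z)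
    (trans (cong₂ _+_ (eval-redei us i z) (trans (eval-mulP (redei us (suc i)) (u ^ q ∷ - u ∷ []) z)
      (cong (_* eval (u ^ q ∷ - u ∷ []) z) (eval-redei us (suc i) z))))
    (sym (trans (coef-addP (0# ∷ P) (scaleP (- π z u) P) (suc i))
      (trans (cong (coef P i +_) (coef-scaleP (- π z u) P (suc i)))
      (solve 5 (λ u z a b c → c :+ (:- (u :* z :- a)) :* b := c :+ b :* (a :+ z :* (:- u :+ z :* :0))) refl u z (u ^ q)
        (coef P (suc i)) (coef P i))))))
    where P = prodP (map (π z) us)

  length-mul-lin : ∀ a b f n i → length f ≤ n ∸ i → length (mulP f (a ∷ b ∷ [])) ≤ suc n ∸ i
  length-mul-lin a b [] n i _ = z≤n
  length-mul-lin a b f@(_ ∷ _) (suc n) zero lf = subst (λ t → length (mulP f (a ∷ b ∷ [])) ≤ suc t) (ℕₚ.+-comm n 1)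
    (length-mulP f (a ∷ b ∷ []) n 1 lf ℕₚ.≤-refl)
  length-mul-lin a b f@(_ ∷ _) (suc n) (suc i) lf = length-mul-lin a b f n i lf

  -- Each factor X - π z u is linear in z, and choosing X from i of the factors leaves degree at
  -- most |us| - i in z.
  length-redei : ∀ us i → length (redei us i) ≤ suc (length us) ∸ i
  length-redei [] zero = s≤s z≤n
  length-redei [] (suc i) = z≤n
  length-redei (u ∷ us) zero = length-mul-lin (u ^ q) (- u) (redei us 0) (suc (length us)) 0 (length-redei us 0)
  length-redei (u ∷ us) (suc i) = length-addP (redei us i) (mulP (redei us (suc i)) (u ^ q ∷ - u ∷ []))
    (length-redei us i)
    (length-mul-lin (u ^ q) (- u) (redei us (suc i)) (length us) i (length-redei us (suc i)))

  coef-take-< : ∀ n f {i} → i < n → coef (take n f) i ≡ coef f i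
  coef-take-< (suc n) [] _ = refl
  coef-take-< (suc n) (c ∷ f) {zero} _ = refl
  coef-take-< (suc n) (c ∷ f) {suc i} (s≤s lt) = coef-take-< n f lt

  rr<q : r ℕ.* r < q
  rr<q = subst (_≤ q) (trans (ℕₚ.+-comm (pw (k ℕ.+ k)) 1) (cong suc (pw-+ k k)))
    (ℕₚ.≤-trans (ℕₚ.+-monoʳ-≤ (pw (k ℕ.+ k)) (pw>0 0))
    (pw-< {k ℕ.+ k} {0} (ℕₚ.m<n+m (k ℕ.+ k) k>0) (ℕₚ.≤-trans k>0 (ℕₚ.m≤m+n k _))))

  module Direction (us : List Carrier) (us-unique : Unique us) (length-us : length us ≡ q) (0∈us : 0# ∈ us)
    (dirs : List Carrier) (few-dirs : length dirs ≤ suc (r ℕ.* r))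
    (us-dirs : ∀ {u v} → u ∈ us → v ∈ us → u ≢ v → slope (u - v) ∈ dirs) where

    free : List Carrier
    free = filter (λ z → ¬? (z ∈? dirs)) slopes

    many-free : q ∸ r ℕ.* r ≤ length free
    many-free = ℕₚ.≤-trans (ℕₚ.∸-monoˡ-≤ {m = suc q} (suc (r ℕ.* r)) q<slopes)
      (ℕₚ.≤-trans (ℕₚ.∸-monoʳ-≤ (length slopes) taken≤)
      (ℕₚ.≤-reflexive (trans (cong (_∸ length taken) (sym (filter-count (_∈? dirs) slopes)))
        (ℕₚ.m+n∸m≡n (length taken) (length free)))))
      where
      taken = filter (_∈? dirs) slopes
      taken≤ : length taken ≤ suc (r ℕ.* r)
      taken≤ = ℕₚ.≤-trans (unique-⊆-length (filter⁺ (_∈? dirs) slopes-unique) λ z∈ →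
        proj₂ (∈-filter⁻ (_∈? dirs) {xs = slopes} z∈)) few-dirs

    module _ {y : Carrier} (y≢0 : y ≢ 0#) where
      private
        z = slope y
        ζ = - (z ^ q)
      ζ≢0 : ζ ≢ 0#
      ζ≢0 = neg-≢0 (^-≢0 q (slope≢0 y≢0))
      vs-root : ∀ {v} → v ∈ map (π z) us → v ^ q ≡ ζ * v
      vs-root v∈ with ∈-map⁻ (π z) v∈
      ... | u , _ , refl = π-eigen u (slope-^q y≢0)

      -- The projection along a free slope is injective on us, so the Rédei polynomial is X^q - ζX there.
      free-prod : z ∉ dirs → prodP (map (π z) us) ≋ X^q-cX ζ
      free-prod z∉ = eval⇒≋ P (X^q-cX ζ) lP (ℕₚ.≤-trans (length-X^q-cX ζ) q<order) agree
        where
        vs = map (π z) us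
        P = prodP vs
        lvs : length vs ≡ q
        lvs = trans (length-map (π z) us) length-us
        lP : length P ≤ order
        lP = ℕₚ.≤-trans (length-prodP vs) (subst (λ n → suc n ≤ order) (sym lvs) q<order)
        vs-unique : Unique vs
        vs-unique = map-unique-on (π z) inj us-unique
          where
          inj : ∀ {u v} → u ∈ us → v ∈ us → π z u ≡ π z v → u ≡ v
          inj {u} {v} u∈ v∈ e with u ≟ v
          ... | yes eq = eq
          ... | no ne = ⊥-elim (z∉ (subst (_∈ dirs) (π-slope ne e) (us-dirs u∈ v∈ ne)))
        -- Both polynomials are monic of degree q, so the difference has degree below q; it vanishes
        -- at the q distinct projections.
        D = addP (X^q-cX ζ) (negP P)
        eD : ∀ x → eval D x ≡ eval (X^q-cX ζ) x - linProd vs x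
        eD x = trans (eval-addP (X^q-cX ζ) (negP P) x)
          (cong (eval (X^q-cX ζ) x +_) (trans (eval-negP P x) (cong -_ (eval-prodP vs x))))
        coefD : ∀ i → q ≤ i → coef D i ≡ 0#
        coefD i q≤i with i ℕ.≟ q
        ... | yes refl = trans (coef-addP (X^q-cX ζ) (negP P) q)
          (trans (cong₂ _+_ (trans (coef-X^q-cX ζ q (ℕₚ.≤-trans (s≤s (s≤s z≤n)) q≥8)) (coef-mono-≡ q))
          (trans (coef-negP P q) (cong -_ (trans (cong (coef P) (sym lvs)) (coef-prodP-top vs))))) (-‿inverseʳ 1#))
        ... | no ne = coef-≥ D (ℕₚ.≤-trans (length-addP (X^q-cX ζ) (negP P) (length-X^q-cX ζ)
          (length-negP P (subst (λ n → length P ≤ suc n) lvs (length-prodP vs))))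
          (ℕₚ.≤∧≢⇒< q≤i (ne ∘ sym)))
        take-D : ∀ x → eval D x ≡ eval (take q D) x
        take-D = eval-≋ D (take q D) coefs
          where
          coefs : D ≋ take q D
          coefs i with i ℕ.<? q
          ... | yes lt = sym (coef-take-< q D lt)
          ... | no ge = trans (coefD i (ℕₚ.≮⇒≥ ge))
            (sym (coef-≥ (take q D) (ℕₚ.≤-trans (ℕₚ.≤-reflexive (length-take q D))
            (ℕₚ.≤-trans (ℕₚ.m⊓n≤m q _) (ℕₚ.≮⇒≥ ge)))))
        D0 : Zero (take q D)
        D0 = roots⇒Zero (take q D) vs-unique (λ {v} v∈ → trans (sym (take-D v)) (trans (eD v)
            (≡⇒-‿0 (trans (trans (eval-X^q-cX ζ v) (≡⇒-‿0 (vs-root v∈))) (sym (linProd-root vs v∈))))))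
          (ℕₚ.≤-trans (ℕₚ.≤-reflexive (length-take q D)) (ℕₚ.≤-trans (ℕₚ.m⊓n≤m q _) (ℕₚ.≤-reflexive (sym lvs))))
        agree : ∀ x → eval P x ≡ eval (X^q-cX ζ) x
        agree x = trans (eval-prodP vs x)
          (sym (-‿≡0 (trans (sym (eD x)) (trans (take-D x) (eval-Zero (take q D) D0 x)))))

    -- In z this coefficient has degree at most q - i < q - r², yet it vanishes at every free slope,
    -- and there are at least (q + 1) - (r² + 1) of these.
    redei-Zero : ∀ i → r ℕ.* r < i → i < q → Zero (redei us i)
    redei-Zero i lo hi = roots⇒Zero (redei us i) (filter⁺ _ slopes-unique) root
      (ℕₚ.≤-trans (length-redei us i)
        (ℕₚ.≤-trans (subst (λ n → suc n ∸ i ≤ suc n ∸ suc (r ℕ.* r)) refl (ℕₚ.∸-monoʳ-≤ (suc (length us)) lo))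
        (subst (λ n → n ∸ r ℕ.* r ≤ length free) (sym length-us) many-free)))
      where
      root : ∀ {z} → z ∈ free → eval (redei us i) z ≡ 0#
      root z∈ with ∈-filter⁻ (λ z → ¬? (z ∈? dirs)) {xs = slopes} z∈
      ... | z∈s , z∉ with ∈-slopes⁻ z∈s
      ... | y , y≢0 , refl = trans (eval-redei us i (slope y)) (trans (free-prod y≢0 z∉ i)
        (trans (coef-X^q-cX _ i (ℕₚ.≤-<-trans (ℕₚ.*-mono-≤ (pw>0 k) (pw>0 k)) lo)) (coef-mono-≢ q (ℕₚ.<⇒≢ hi))))

    -- The Rédei coefficients vanish identically in z, so the gap between X^(r²) and X^q passes from
    -- the free slopes to all slopes.
    projection-RSubspace : ∀ {y} → y ≢ 0# → RSubspace (map (π (slope y)) us)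
    projection-RSubspace {y} y≢0 = Lacunary.lacunary _ (ζ≢0 y≢0) vs lvs (vs-root y≢0) 0∈vs g
        (ℕₚ.≤-trans (ℕₚ.≤-reflexive (length-take (suc (r ℕ.* r)) P)) (ℕₚ.m⊓n≤m _ (length P))) shape
      where
      z = slope y
      vs = map (π z) us
      P = prodP vs
      g = take (suc (r ℕ.* r)) P
      lvs : length vs ≡ q
      lvs = trans (length-map (π z) us) length-us
      0∈vs : 0# ∈ vs
      0∈vs = subst (_∈ vs) (trans (cong (λ t → 0# * z - t) (0^ q 0<q)) (solve 1 (λ z → :0 :* z :- :0 := :0) refl z))
        (∈-map⁺ (π z) 0∈us)
      P≋ : P ≋ addP (mono q) g
      P≋ i = trans (cases i) (sym (coef-addP (mono q) g i))
        where
        g-high : ∀ i → r ℕ.* r < i → coef g i ≡ 0#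
        g-high i lt = coef-≥ g (ℕₚ.≤-trans (ℕₚ.≤-reflexive (length-take (suc (r ℕ.* r)) P))
          (ℕₚ.≤-trans (ℕₚ.m⊓n≤m _ (length P)) lt))
        cases : ∀ i → coef P i ≡ coef (mono q) i + coef g i
        cases i with i ℕ.≤? r ℕ.* r | ℕₚ.<-cmp i q
        ... | yes le | _ = trans (sym (coef-take-< (suc (r ℕ.* r)) P (s≤s le)))
          (trans (sym (+-identityˡ _)) (cong (_+ coef g i) (sym (coef-mono-≢ q (ℕₚ.<⇒≢ (ℕₚ.≤-<-trans le rr<q))))))
        ... | no gt | tri< lt ne _ = trans (sym (eval-redei us i z))
          (trans (eval-Zero (redei us i) (redei-Zero i (ℕₚ.≰⇒> gt) lt) z)
          (sym (trans (cong₂ _+_ (coef-mono-≢ q ne) (g-high i (ℕₚ.≰⇒> gt))) (+-identityˡ 0#))))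
        ... | no gt | tri≈ _ refl _ = trans (trans (cong (coef P) (sym lvs)) (coef-prodP-top vs))
          (sym (trans (cong₂ _+_ (coef-mono-≡ q) (g-high i (ℕₚ.≰⇒> gt))) (+-identityʳ 1#)))
        ... | no gt | tri> _ ne lt = trans
          (coef-≥ P (ℕₚ.≤-trans (length-prodP vs) (subst (λ n → suc n ≤ i) (sym lvs) lt)))
          (sym (trans (cong₂ _+_ (coef-mono-≢ q ne) (g-high i (ℕₚ.≰⇒> gt))) (+-identityˡ 0#)))
      shape : ∀ x → linProd vs x ≡ x ^ q + eval g x
      shape x = trans (sym (eval-prodP vs x))
        (trans (eval-≋ P (addP (mono q) g) P≋ x) (trans (eval-addP (mono q) g x) (cong (_+ eval g x) (eval-mono q x))))

    -- A point all of whose projections come from us lies in us: otherwise each of the q + 1 lines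
    -- through it meets us, giving q + 1 points of us.
    ∈-from-projections : ∀ w → (∀ {y} → y ≢ 0# → π (slope y) w ∈ map (π (slope y)) us) → w ∈ us
    ∈-from-projections w proj with w ∈? us
    ... | yes w∈ = w∈
    ... | no w∉ = ⊥-elim (ℕₚ.<⇒≱ q<slopes
      (subst (length slopes ≤_) (trans (length-map (λ u → slope (u - w)) us) length-us)
      (unique-⊆-length slopes-unique sub)))
      where
      sub : ∀ {z} → z ∈ slopes → z ∈ map (λ u → slope (u - w)) us
      sub z∈ with ∈-slopes⁻ z∈
      ... | y , y≢0 , refl with ∈-map⁻ (π (slope y)) (proj y≢0)
      ... | u , u∈ , e = subst (_∈ map (λ u → slope (u - w)) us) (π-slope (λ { refl → w∉ u∈ }) (sym e))
        (∈-map⁺ (λ u → slope (u - w)) u∈)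

    us-RSubspace : RSubspace us
    us-RSubspace = record
      { +-closed = λ {u} {v} u∈ v∈ → ∈-from-projections (u + v) λ {y} y≢0 → subst (_∈ map (π (slope y)) us)
        (sym (π-+ (slope y) u v))
          (RSubspace.+-closed (projection-RSubspace y≢0) (∈-map⁺ (π (slope y)) u∈) (∈-map⁺ (π (slope y)) v∈))
      ; *-closed = λ {c} {v} cr v∈ → ∈-from-projections (c * v) λ {y} y≢0 → subst (_∈ map (π (slope y)) us)
        (sym (π-* (slope y) c v (^r-fixed-q cr)))
          (RSubspace.*-closed (projection-RSubspace y≢0) cr (∈-map⁺ (π (slope y)) v∈))
      }

  -- Subfields and the trace-zero hyperplane

  q≡ : q ≡ r ℕ.* (r ℕ.* r)
  q≡ = trans (pw-+ k (k ℕ.+ k)) (cong (r ℕ.*_) (pw-+ k k))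

  1<r : 1 < r
  1<r = 1<pw k>0

  -- As a record the condition determines n and x, which can then stay implicit; a bare equation
  -- between powers would not.
  record Fixed (n : ℕ) (x : Carrier) : Set where
    constructor fixed
    field eq : x ^ n ≡ x

  open Fixed public

  InK InFr : Carrier → Set
  InK = Fixed q
  InFr = Fixed r

  inv0 : inv 0# ≡ 0#
  inv0 with 0# ≟ 0#
  ... | yes _ = refl
  ... | no ne = ⊥-elim (ne refl)

  module _ {n : ℕ} (fe : FrobExp n) where
    fixed? : (x : Carrier) → Dec (Fixed n x)
    fixed? x with x ^ n ≟ x
    ... | yes e = yes (fixed e)
    ... | no ne = no (ne ∘ eq)

    fixed-+ : ∀ {x y} → Fixed n x → Fixed n y → Fixed n (x + y)
    fixed-+ (fixed a) (fixed b) = fixed (trans (frob+ fe _ _) (cong₂ _+_ a b))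

    fixed-neg : ∀ {x} → Fixed n x → Fixed n (- x)
    fixed-neg (fixed a) = fixed (trans (frob-neg fe _) (cong -_ a))

    fixed-* : ∀ {x y} → Fixed n x → Fixed n y → Fixed n (x * y)
    fixed-* (fixed a) (fixed b) = fixed (trans (^-mul _ _ n) (cong₂ _*_ a b))

    fixed-0 : Fixed n 0#
    fixed-0 = fixed (frob0 fe)

    fixed-1 : Fixed n 1#
    fixed-1 = fixed (1^ n)

    fixed-inv : ∀ {x} → Fixed n x → Fixed n (inv x)
    fixed-inv {x} (fixed a) = by-cases (x ≟ 0#)
      where
      by-cases : Dec (x ≡ 0#) → Fixed n (inv x)
      by-cases (yes x0) = subst (Fixed n) (sym (trans (cong inv x0) inv0)) fixed-0
      by-cases (no x≢0) = fixed (trans (^-inv n x≢0) (cong inv a))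

  Fr⊆K : ∀ {x} → InFr x → InK x
  Fr⊆K (fixed e) = fixed (^r-fixed-q e)

  -- On K this is the trace to 𝔽_r; its zeros in F automatically lie in K.
  tr : Carrier → Carrier
  tr x = x + x ^ r + (x ^ r) ^ r

  record InT (x : Carrier) : Set where
    constructor inT
    field tr0 : tr x ≡ 0#
  open InT public

  inT? : (x : Carrier) → Dec (InT x)
  inT? x with tr x ≟ 0#
  ... | yes e = yes (inT e)
  ... | no ne = no (ne ∘ tr0)

  ^q-^r : ∀ x → x ^ q ≡ ((x ^ r) ^ r) ^ r
  ^q-^r x = trans (cong (x ^_) q≡) (trans (^-* x r (r ℕ.* r)) (^-* (x ^ r) r r))

  tr-+ : ∀ x y → tr (x + y) ≡ tr x + tr y
  tr-+ x y = trans (cong₂ (λ s t → x + y + s + t) (frob+ frob-r x y)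
    (trans (cong (_^ r) (frob+ frob-r x y)) (frob+ frob-r _ _)))
    (solve 6 (λ a b c d e f → a :+ b :+ (c :+ d) :+ (e :+ f) := a :+ c :+ e :+ (b :+ d :+ f)) refl x y _ _ _ _)

  T-+ : ∀ {x y} → InT x → InT y → InT (x + y)
  T-+ (inT a) (inT b) = inT (trans (tr-+ _ _) (trans (cong₂ _+_ a b) (+-identityˡ 0#)))

  T-Fr : ∀ {c x} → InFr c → InT x → InT (c * x)
  T-Fr {c} {x} (fixed cr) (inT a) =
    inT (trans (cong₂ (λ s t → c * x + s + t) e₁
    (trans (cong (_^ r) e₁) (trans (^-mul c (x ^ r) r) (cong (_* (x ^ r) ^ r) cr))))
    (trans (solve 4 (λ c x y z → c :* x :+ c :* y :+ c :* z := c :* (x :+ y :+ z)) refl c x _ _)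
      (trans (cong (c *_) a) (zeroʳ c))))
    where
    e₁ : (c * x) ^ r ≡ c * x ^ r
    e₁ = trans (^-mul c x r) (cong (_* x ^ r) cr)

  T-neg : ∀ {x} → InT x → InT (- x)
  T-neg {x} t = subst InT (solve 1 (λ x → (:- :1) :* x := :- x) refl x) (T-Fr (fixed-neg frob-r (fixed-1 frob-r)) t)

  T-sub : ∀ {x y} → InT x → InT y → InT (x - y)
  T-sub a b = T-+ a (T-neg b)

  T-0 : InT 0#
  T-0 = inT (trans (cong₂ (λ s t → 0# + s + t) z (trans (cong (_^ r) z) z)) (solve 0 (:0 :+ :0 :+ :0 := :0) refl))
    where
    z : 0# ^ r ≡ 0#
    z = 0^ r (pw>0 k)

  -- Raising x + x^r + x^(r²) = 0 to the power r and subtracting gives x^(r³) = x.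
  T⊆K : ∀ {x} → InT x → InK x
  T⊆K {x} (inT e) = fixed (trans (^q-^r x) (begin
    c                                              ≡⟨ solve 3 (λ a b c → c := (a :+ b :+ c) :- (a :+ b)) refl a b c ⟩
    (a + b + c) - (a + b)                          ≡⟨ cong (_- (a + b))
      (trans (sym (trans (frob+ frob-r _ _) (cong (_+ c) (frob+ frob-r _ _))))
      (trans (cong (_^ r) e) (0^ r (pw>0 k)))) ⟩
    0# - (a + b)                                   ≡⟨ cong (_- (a + b)) e ⟨
    (x + a + b) - (a + b)                          ≡⟨ solve 3 (λ x a b → (x :+ a :+ b) :- (a :+ b) := x) refl x a b ⟩
    x ∎))
    where
    open ≡-Reasoning
    a = x ^ r
    b = a ^ r
    c = b ^ r

  Ks Frs Ts : List Carrier
  Ks = filter (fixed? frob-q) elements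
  Frs = filter (fixed? frob-r) elements
  Ts = filter inT? elements

  Ks-unique : Unique Ks
  Ks-unique = filter⁺ _ unique
  Frs-unique : Unique Frs
  Frs-unique = filter⁺ _ unique
  Ts-unique : Unique Ts
  Ts-unique = filter⁺ _ unique

  ∈Ks : ∀ {x} → InK x → x ∈ Ks
  ∈Ks = ∈-filter⁺ (fixed? frob-q) (complete _)
  ∈Ks⁻ : ∀ {x} → x ∈ Ks → InK x
  ∈Ks⁻ = proj₂ ∘ ∈-filter⁻ (fixed? frob-q) {xs = elements}
  ∈Frs : ∀ {x} → InFr x → x ∈ Frs
  ∈Frs = ∈-filter⁺ (fixed? frob-r) (complete _)
  ∈Frs⁻ : ∀ {x} → x ∈ Frs → InFr x
  ∈Frs⁻ = proj₂ ∘ ∈-filter⁻ (fixed? frob-r) {xs = elements}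
  ∈Ts : ∀ {x} → InT x → x ∈ Ts
  ∈Ts = ∈-filter⁺ inT? (complete _)
  ∈Ts⁻ : ∀ {x} → x ∈ Ts → InT x
  ∈Ts⁻ = proj₂ ∘ ∈-filter⁻ inT? {xs = elements}

  -- The map x^n - x is additive with kernel the fixed points, so subtracting one point of a fibre
  -- moves the whole fibre into `ker`.
  artin-schreier-count : ∀ {n} → FrobExp n → (xs : List Carrier) → (ker : List Carrier) →
    (∀ {x y} → x ∈ xs → y ∈ xs → Fixed n (x - y) → x - y ∈ ker) → Unique xs →
    length xs ≤ length (deduplicate _≟_ (map (λ x → x ^ n - x) xs)) ℕ.* length ker
  artin-schreier-count {n} fe xs ker into u =
    fibre-bound _≟_ f (length ker) (deduplicate _≟_ (map f xs)) xs (λ x∈ → ∈-deduplicate⁺ _≟_ (∈-map⁺ f x∈)) fib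
    where
    f = λ x → x ^ n - x
    fib : ∀ z → length (filter (λ x → f x ≟ z) xs) ≤ length ker
    fib z = go (filter (λ x → f x ≟ z) xs) (filter⁺ _ u) (λ x∈ → proj₁ (∈-filter⁻ (λ x → f x ≟ z) {xs = xs} x∈))
      (λ x∈ → proj₂ (∈-filter⁻ (λ x → f x ≟ z) {xs = xs} x∈))
      where
      go : ∀ ys → Unique ys → (∀ {y} → y ∈ ys → y ∈ xs) → (∀ {y} → y ∈ ys → f y ≡ z) → length ys ≤ length ker
      go [] _ _ _ = z≤n
      go ys@(y₀ ∷ _) uy sub val = subst (_≤ length ker) (length-map (_- y₀) ys)
        (unique-⊆-length (map⁺ (λ {a} {b} e →
          -‿≡0 (trans (solve 3 (λ a b c → a :- b := (a :- c) :- (b :- c)) refl a b y₀) (≡⇒-‿0 e))) uy) mem)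
        where
        mem : ∀ {d} → d ∈ map (_- y₀) ys → d ∈ ker
        mem d∈ with ∈-map⁻ (_- y₀) d∈
        ... | y , y∈ , refl = into (sub y∈) (sub (here refl)) (fixed (-‿≡0 (begin
          (y - y₀) ^ n - (y - y₀)         ≡⟨ cong (_- (y - y₀)) (frob-sub fe y y₀) ⟩
          (y ^ n - y₀ ^ n) - (y - y₀)     ≡⟨ solve 4 (λ a b c d → (a :- b) :- (c :- d) := (a :- c) :- (b :- d)) refl
            (y ^ n) (y₀ ^ n) y y₀ ⟩
          f y - f y₀                      ≡⟨ ≡⇒-‿0 (trans (val y∈) (sym (val (here refl)))) ⟩
          0# ∎)))
          where open ≡-Reasoning

  -- The image of x^q - x on F consists of elements with z^q = -z, hence has at most q members; as
  -- |F| = q², the kernel K has at least q.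
  length-Ks : length Ks ≡ q
  length-Ks = ℕₚ.≤-antisym upper (ℕₚ.*-cancelˡ-≤ q {{ℕ.>-nonZero 0<q}} (ℕₚ.≤-trans (ℕₚ.≤-reflexive (sym order-qq))
    (ℕₚ.≤-trans (artin-schreier-count frob-q elements Ks (λ _ _ → ∈Ks) unique) (ℕₚ.*-monoˡ-≤ (length Ks) image≤))))
    where
    upper : length Ks ≤ q
    upper = eigen-bound 1# Ks-unique (λ x∈ → trans (eq (∈Ks⁻ x∈)) (sym (*-identityˡ _)))
    image≤ : length (deduplicate _≟_ (map (λ x → x ^ q - x) elements)) ≤ q
    image≤ = eigen-bound (- 1#) (deduplicate-! (map (λ x → x ^ q - x) elements)) λ z∈ →
      anti (∈-map⁻ _ (∈-deduplicate⁻ _≟_ (map (λ x → x ^ q - x) elements) z∈))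
      where
      anti : ∀ {z} → ∃ (λ x → x ∈ elements × z ≡ x ^ q - x) → z ^ q ≡ - 1# * z
      anti (x , _ , refl) = trans (frob-sub frob-q _ _)
        (trans (cong (_- x ^ q) (^qq x)) (solve 2 (λ x y → x :- y := (:- :1) :* (y :- x)) refl x (x ^ q)))

  private
    r<rr : suc r ≤ r ℕ.* r
    r<rr = ℕₚ.m<m*n r r {{ℕ.>-nonZero (pw>0 k)}} 1<r

  length-Frs≤ : length Frs ≤ r
  length-Frs≤ = root-bound f r f≢0 lf Frs-unique λ {z} z∈ → trans (ef z) (≡⇒-‿0 (eq (∈Frs⁻ z∈)))
    where
    f = addP (mono r) (0# ∷ - 1# ∷ [])
    lf : length f ≤ suc r
    lf = length-addP (mono r) (0# ∷ - 1# ∷ []) (ℕₚ.≤-reflexive (length-mono r)) (s≤s (pw>0 k))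
    ef : ∀ x → eval f x ≡ x ^ r - x
    ef x = trans (eval-addP (mono r) (0# ∷ - 1# ∷ []) x) (trans (cong (_+ eval (0# ∷ - 1# ∷ []) x) (eval-mono r x))
      (solve 2 (λ x y → y :+ (:0 :+ x :* (:- :1 :+ x :* :0)) := y :- x) refl x (x ^ r)))
    f≢0 : ¬ Zero f
    f≢0 z = 1≢0 (trans (sym (trans (coef-addP (mono r) (0# ∷ - 1# ∷ []) r)
      (trans (cong₂ _+_ (coef-mono-≡ r) (coef-≥ (0# ∷ - 1# ∷ []) 1<r)) (+-identityʳ 1#)))) (z r))

  length-Ts≤ : length Ts ≤ r ℕ.* r
  length-Ts≤ = root-bound f (r ℕ.* r) f≢0 lf Ts-unique λ {z} z∈ → trans (ef z) (tr0 (∈Ts⁻ z∈))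
    where
    g = addP (mono r) (0# ∷ 1# ∷ [])
    f = addP (mono (r ℕ.* r)) g
    lg : length g ≤ suc r
    lg = length-addP (mono r) (0# ∷ 1# ∷ []) (ℕₚ.≤-reflexive (length-mono r)) (s≤s (pw>0 k))
    lf : length f ≤ suc (r ℕ.* r)
    lf = length-addP (mono (r ℕ.* r)) g (ℕₚ.≤-reflexive (length-mono (r ℕ.* r))) (ℕₚ.≤-trans lg (ℕₚ.m≤n⇒m≤1+n r<rr))
    ef : ∀ x → eval f x ≡ tr x
    ef x = trans (eval-addP (mono (r ℕ.* r)) g x)
      (trans (cong₂ _+_ (trans (eval-mono (r ℕ.* r) x) (^-* x r r))
      (trans (eval-addP (mono r) (0# ∷ 1# ∷ []) x) (cong (_+ eval (0# ∷ 1# ∷ []) x) (eval-mono r x))))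
      (solve 3 (λ x y z → z :+ (y :+ (:0 :+ x :* (:1 :+ x :* :0))) := x :+ y :+ z) refl x (x ^ r) _))
    f≢0 : ¬ Zero f
    f≢0 z = 1≢0 (trans (sym (trans (coef-addP (mono (r ℕ.* r)) g (r ℕ.* r))
      (trans (cong₂ _+_ (coef-mono-≡ (r ℕ.* r)) (coef-≥ g (ℕₚ.≤-trans lg r<rr))) (+-identityʳ 1#)))) (z (r ℕ.* r)))

  private
    -- The trace of x^r - x telescopes to x^q - x, which is zero on K.
    traceless : ∀ {z} → z ∈ deduplicate _≟_ (map (λ x → x ^ r - x) Ks) → z ∈ Ts
    traceless z∈ with ∈-map⁻ _ (∈-deduplicate⁻ _≟_ (map (λ x → x ^ r - x) Ks) z∈)
    ... | x , x∈ , refl = ∈Ts (inT (trans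
      (cong₂ (λ s t → x ^ r - x + s + t) e₁ (trans (cong (_^ r) e₁) (frob-sub frob-r _ _)))
        (trans (cong (λ t → x ^ r - x + ((x ^ r) ^ r - x ^ r) + (t - (x ^ r) ^ r))
          (trans (sym (^q-^r x)) (eq (∈Ks⁻ x∈))))
          (solve 3 (λ x y z → y :- x :+ (z :- y) :+ (x :- z) := :0) refl x (x ^ r) ((x ^ r) ^ r)))))
      where
      e₁ : (x ^ r - x) ^ r ≡ (x ^ r) ^ r - x ^ r
      e₁ = frob-sub frob-r _ _
    imageT = deduplicate _≟_ (map (λ x → x ^ r - x) Ks)
    imageT≤ : length imageT ≤ length Ts
    imageT≤ = unique-⊆-length (deduplicate-! (map (λ x → x ^ r - x) Ks)) traceless
    imageT-count : q ≤ length imageT ℕ.* length Frs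
    imageT-count = subst (_≤ length imageT ℕ.* length Frs) length-Ks (artin-schreier-count frob-r Ks Frs (λ _ _ → ∈Frs)
      Ks-unique)

  -- On K the map x^r - x has kernel 𝔽_r and image inside T, so r³ ≤ |T||𝔽_r|. The degree bounds |T|
  -- ≤ r² and |𝔽_r| ≤ r must then both be attained.
  length-Frs : length Frs ≡ r
  length-Frs = ℕₚ.≤-antisym length-Frs≤ (ℕₚ.*-cancelˡ-≤ (r ℕ.* r) {{ℕ.>-nonZero (ℕₚ.*-mono-≤ (pw>0 k) (pw>0 k))}}
    (ℕₚ.≤-trans (ℕₚ.≤-reflexive (trans (ℕₚ.*-comm (r ℕ.* r) r) (sym q≡)))
      (ℕₚ.≤-trans imageT-count (ℕₚ.*-monoˡ-≤ (length Frs) (ℕₚ.≤-trans imageT≤ length-Ts≤)))))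

  length-Ts : length Ts ≡ r ℕ.* r
  length-Ts = ℕₚ.≤-antisym length-Ts≤ (ℕₚ.*-cancelˡ-≤ r {{ℕ.>-nonZero (pw>0 k)}}
    (ℕₚ.≤-trans (ℕₚ.≤-reflexive (sym q≡))
      (ℕₚ.≤-trans imageT-count (ℕₚ.≤-trans (ℕₚ.*-mono-≤ imageT≤ length-Frs≤)
      (ℕₚ.≤-reflexive (ℕₚ.*-comm (length Ts) r))))))

  -- Substituting x^(r²) = -x - x^r turns tr(μx) = 0 into (μ - μ^(r²))x + (μ^r - μ^(r²))x^r = 0 on
  -- T. Its degree is below |T| = r², so μ^r = μ^(r²), and the Frobenius map is injective.
  T-stable⇒Fr : ∀ μ → (∀ {x} → InT x → InT (μ * x)) → InFr μ
  T-stable⇒Fr μ st = fixed (sym (frob-inj frob-r (-‿≡0 top)))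
    where
    a = μ - (μ ^ r) ^ r
    b = μ ^ r - (μ ^ r) ^ r
    f = addP (0# ∷ a ∷ []) (scaleP b (mono r))
    ef : ∀ x → eval f x ≡ a * x + b * x ^ r
    ef x = trans (eval-addP (0# ∷ a ∷ []) (scaleP b (mono r)) x)
      (cong₂ _+_ (solve 2 (λ a x → :0 :+ x :* (a :+ x :* :0) := a :* x) refl a x)
      (trans (eval-scaleP b (mono r) x) (cong (b *_) (eval-mono r x))))
    root : ∀ {x} → x ∈ Ts → eval f x ≡ 0#
    root {x} x∈ = begin
      eval f x                 ≡⟨ ef x ⟩
      a * x + b * x ^ r        ≡⟨ solve 6 (λ μ μ′ μ″ x y z → (μ :- μ″) :* x :+ (μ′ :- μ″) :* y :=
        (μ :* x :+ μ′ :* y :+ μ″ :* z) :- μ″ :* (x :+ y :+ z)) refl μ (μ ^ r) ((μ ^ r) ^ r) x (x ^ r) ((x ^ r) ^ r) ⟩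
      (μ * x + μ ^ r * x ^ r + (μ ^ r) ^ r * (x ^ r) ^ r) - (μ ^ r) ^ r * tr x
        ≡⟨ cong (_- (μ ^ r) ^ r * tr x) (cong₂ (λ s t → μ * x + s + t) (sym (^-mul μ x r))
          (sym (trans (cong (_^ r) (^-mul μ x r)) (^-mul (μ ^ r) (x ^ r) r)))) ⟩
      tr (μ * x) - (μ ^ r) ^ r * tr x  ≡⟨ cong₂ (λ s t → s - (μ ^ r) ^ r * t) (tr0 (st (∈Ts⁻ x∈))) (tr0 (∈Ts⁻ x∈)) ⟩
      0# - (μ ^ r) ^ r * 0#    ≡⟨ solve 1 (λ a → :0 :- a :* :0 := :0) refl ((μ ^ r) ^ r) ⟩
      0# ∎
      where open ≡-Reasoning
    f0 : Zero f
    f0 = roots⇒Zero f Ts-unique root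
      (ℕₚ.≤-trans (length-addP (0# ∷ a ∷ []) (scaleP b (mono r)) (s≤s (pw>0 k))
      (length-scaleP b (mono r) (ℕₚ.≤-reflexive (length-mono r))))
      (subst (suc r ≤_) (sym length-Ts) r<rr))
    top : μ ^ r - (μ ^ r) ^ r ≡ 0#
    top = trans (sym (trans (coef-addP (0# ∷ a ∷ []) (scaleP b (mono r)) r)
      (trans (cong₂ _+_ (coef-≥ (0# ∷ a ∷ []) 1<r)
      (trans (coef-scaleP b (mono r) r) (trans (cong (b *_) (coef-mono-≡ r)) (*-identityʳ b)))) (+-identityˡ b))))
      (f0 r)

  -- Clubs

  slope-quotient : ∀ {x y} → x ≢ 0# → y ≢ 0# → slope x ≡ slope y → InK (inv x * y)
  slope-quotient {x} {y} x≢0 y≢0 e = fixed (*-cancelˡ (^-≢0 q x≢0) (begin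
    x ^ q * (inv x * y) ^ q        ≡⟨ ^-mul x (inv x * y) q ⟨
    (x * (inv x * y)) ^ q          ≡⟨ cong (_^ q) xy ⟩
    y ^ q                          ≡⟨ slope-* y≢0 ⟨
    slope y * y                    ≡⟨ cong₂ _*_ e xy ⟨
    slope x * (x * (inv x * y))    ≡⟨ *-assoc _ _ _ ⟨
    slope x * x * (inv x * y)      ≡⟨ cong (_* (inv x * y)) (slope-* x≢0) ⟩
    x ^ q * (inv x * y) ∎))
    where
    open ≡-Reasoning
    xy : x * (inv x * y) ≡ y
    xy = trans (sym (*-assoc _ _ _)) (trans (cong (_* y) (inv-r x≢0)) (*-identityˡ y))

  *-inv-* : ∀ {x} y → x ≢ 0# → x * (inv x * y) ≡ y
  *-inv-* {x} y x≢0 = trans (sym (*-assoc _ _ _)) (trans (cong (_* y) (inv-r x≢0)) (*-identityˡ y))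

  slope-scale : ∀ {x t} → InK t → t ≢ 0# → x ≢ 0# → slope (x * t) ≡ slope x
  slope-scale {x} {t} (fixed tq) t≢0 x≢0 = slope-unique (*-≢0 x≢0 t≢0)
    (trans (sym (*-assoc _ _ _)) (trans (cong₂ _*_ (slope-* x≢0) (sym tq)) (sym (^-mul x t q))))

  *-zero-r : ∀ {x y} → y ≢ 0# → x * y ≡ 0# → x ≡ 0#
  *-zero-r {x} {y} y≢0 e = *-cancelˡ y≢0 (trans (*-comm y x) (trans e (sym (zeroʳ y))))

  -- det c u = 0 iff c and u are linearly dependent over K.
  det : Carrier → Carrier → Carrier
  det c u = u ^ q * c - c ^ q * u

  comb : Carrier → Carrier → Carrier → Carrier → Carrier
  comb c u α β = c * α + u * β

  comb-^q : ∀ c u {α β} → InK α → InK β → comb c u α β ^ q ≡ c ^ q * α + u ^ q * β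
  comb-^q c u (fixed a) (fixed b) =
    trans (frob+ frob-q _ _) (cong₂ _+_ (trans (^-mul c _ q) (cong (c ^ q *_) a))
    (trans (^-mul u _ q) (cong (u ^ q *_) b)))

  det-comb : ∀ c u {α β α′ β′} → InK α → InK β → InK α′ → InK β′ →
    det (comb c u α β) (comb c u α′ β′) ≡ (α * β′ - β * α′) * det c u
  det-comb c u {α} {β} {α′} {β′} a b a′ b′ =
    trans (cong₂ (λ s t → s * comb c u α β - t * comb c u α′ β′) (comb-^q c u a′ b′) (comb-^q c u a b))
    (solve 8 (λ c u c′ u′ α β α′ β′ → (c′ :* α′ :+ u′ :* β′) :* (c :* α :+ u :* β) :- (c′ :* α :+ u′ :* β) :*
      (c :* α′ :+ u :* β′)
      := (α :* β′ :- β :* α′) :* (u′ :* c :- c′ :* u)) refl c u (c ^ q) (u ^ q) α β α′ β′)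

  det-c-comb : ∀ c u {α β} → InK α → InK β → det c (comb c u α β) ≡ β * det c u
  det-c-comb c u {α} {β} a b = trans (cong (λ s → s * c - c ^ q * comb c u α β) (comb-^q c u a b))
    (solve 6 (λ c u c′ u′ α β → (c′ :* α :+ u′ :* β) :* c :- c′ :* (c :* α :+ u :* β) := β :* (u′ :* c :- c′ :* u))
      refl c u (c ^ q) (u ^ q) α β)

  det-comb-u : ∀ c u {α β} → InK α → InK β → det (comb c u α β) u ≡ α * det c u
  det-comb-u c u {α} {β} a b = trans (cong (λ s → u ^ q * comb c u α β - s * u) (comb-^q c u a b))
    (solve 6 (λ c u c′ u′ α β → u′ :* (c :* α :+ u :* β) :- (c′ :* α :+ u′ :* β) :* u := α :* (u′ :* c :- c′ :* u))
      refl c u (c ^ q) (u ^ q) α β)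

  slope≡⇒det0 : ∀ {c u} → c ≢ 0# → u ≢ 0# → slope c ≡ slope u → det c u ≡ 0#
  slope≡⇒det0 {c} {u} c≢0 u≢0 e = ≡⇒-‿0 (trans (cong (_* c) (trans (sym (slope-* u≢0)) (cong (_* u) (sym e))))
    (trans (solve 3 (λ s u c → s :* u :* c := s :* c :* u) refl (slope c) u c) (cong (_* u) (slope-* c≢0))))

  det0⇒slope≡ : ∀ {c u} → c ≢ 0# → u ≢ 0# → det c u ≡ 0# → slope c ≡ slope u
  det0⇒slope≡ {c} {u} c≢0 u≢0 e = sym (slope-unique u≢0 (*-cancelˡ c≢0 (begin
    c * (slope c * u)    ≡⟨ solve 3 (λ c s u → c :* (s :* u) := s :* c :* u) refl c (slope c) u ⟩
    slope c * c * u      ≡⟨ cong (_* u) (slope-* c≢0) ⟩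
    c ^ q * u            ≡⟨ -‿≡0 e ⟨
    u ^ q * c            ≡⟨ *-comm _ _ ⟩
    c * u ^ q ∎)))
    where open ≡-Reasoning

  det≢0ˡ : ∀ {c u} → det c u ≢ 0# → c ≢ 0#
  det≢0ˡ {c} {u} d refl = d (trans (cong (λ t → u ^ q * 0# - t * u) (0^ q 0<q))
    (solve 2 (λ a u → a :* :0 :- :0 :* u := :0) refl (u ^ q) u))

  det≢0ʳ : ∀ {c u} → det c u ≢ 0# → u ≢ 0#
  det≢0ʳ {c} {u} d refl = d (trans (cong (λ t → t * c - c ^ q * 0#) (0^ q 0<q))
    (solve 2 (λ a c → :0 :* c :- a :* :0 := :0) refl (c ^ q) c))

  -- The clique cT + u𝔽_r and its r² + 1 slopes: the head c, and u + ch for h ∈ T.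
  dirsOf : Carrier → Carrier → List Carrier
  dirsOf c u = slope c ∷ map (λ h → slope (comb c u h 1#)) Ts

  clubClique : Carrier → Carrier → List Carrier
  clubClique c u = cartesianProductWith (comb c u) Ts Frs

  1∈K : InK 1#
  1∈K = fixed-1 frob-q

  0∈Ks : InK 0#
  0∈Ks = fixed-0 frob-q

  module Basis {c u : Carrier} (d : det c u ≢ 0#) where

    c≢0 = det≢0ˡ d
    u≢0 = det≢0ʳ d

    comb-injective : ∀ {α β α′ β′} → InK α → InK β → InK α′ → InK β′ → comb c u α β ≡ comb c u α′ β′ → α ≡ α′ × β ≡ β′
    comb-injective a b a′ b′ e =
      *-cancelˡ d (trans (*-comm _ _)
        (trans (sym (det-comb-u c u a b)) (trans (cong (λ t → det t u) e) (trans (det-comb-u c u a′ b′) (*-comm _ _)))))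
        ,
      *-cancelˡ d (trans (*-comm _ _)
        (trans (sym (det-c-comb c u a b)) (trans (cong (det c) e) (trans (det-c-comb c u a′ b′) (*-comm _ _)))))

    comb≢0 : ∀ {α β} → InK α → InK β → β ≢ 0# → comb c u α β ≢ 0#
    comb≢0 a b β≢0 e = β≢0 (proj₂ (comb-injective a b 0∈Ks 0∈Ks
      (trans e (solve 2 (λ c u → :0 := c :* :0 :+ u :* :0) refl c u))))

    slope-c≢ : ∀ {α β} → InK α → InK β → β ≢ 0# → slope c ≢ slope (comb c u α β)
    slope-c≢ a b β≢0 e = *-≢0 β≢0 d (trans (sym (det-c-comb c u a b)) (slope≡⇒det0 c≢0 (comb≢0 a b β≢0) e))

    slope-comb≡ : ∀ {α β α′ β′} → InK α → InK β → InK α′ → InK β′ → β ≢ 0# → β′ ≢ 0# →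
      slope (comb c u α β) ≡ slope (comb c u α′ β′) → α * β′ ≡ β * α′
    slope-comb≡ a b a′ b′ β≢0 β′≢0 e =
      -‿≡0 (*-zero-r d (trans (sym (det-comb c u a b a′ b′)) (slope≡⇒det0 (comb≢0 a b β≢0) (comb≢0 a′ b′ β′≢0) e)))

    slope-comb-1 : ∀ {α β} → InK α → InK β → β ≢ 0# → slope (comb c u α β) ≡ slope (comb c u (α * inv β) 1#)
    slope-comb-1 {α} {β} a b β≢0 = trans (cong slope (sym scaled))
      (slope-scale b β≢0 (comb≢0 (fixed-* frob-q a (fixed-inv frob-q b)) 1∈K 1≢0))
      where
      open ≡-Reasoning
      scaled : comb c u (α * inv β) 1# * β ≡ comb c u α β
      scaled = begin
        (c * (α * inv β) + u * 1#) * β       ≡⟨ solve 5 (λ c u a i b → (c :* (a :* i) :+ u :* :1) :* b := c :*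
          (a :* (i :* b)) :+ u :* b) refl c u α (inv β) β ⟩
        c * (α * (inv β * β)) + u * β        ≡⟨ cong (λ t → c * (α * t) + u * β) (inv-l β≢0) ⟩
        c * (α * 1#) + u * β                 ≡⟨ cong (λ t → c * t + u * β) (*-identityʳ α) ⟩
        c * α + u * β ∎

    dirsOf-unique : Unique (dirsOf c u)
    dirsOf-unique = All.tabulate (λ s∈ e → notHead s∈ e) ∷ map-unique-on (λ h → slope (comb c u h 1#)) inj Ts-unique
      where
      notHead : ∀ {s} → s ∈ map (λ h → slope (comb c u h 1#)) Ts → slope c ≢ s
      notHead s∈ e = let (h , h∈ , eh) = ∈-map⁻ (λ h → slope (comb c u h 1#)) s∈ in
        slope-c≢ (T⊆K (∈Ts⁻ h∈)) 1∈K 1≢0 (trans e eh)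
      inj : ∀ {h h′} → h ∈ Ts → h′ ∈ Ts → slope (comb c u h 1#) ≡ slope (comb c u h′ 1#) → h ≡ h′
      inj {h} {h′} h∈ h′∈ e = trans (sym (*-identityʳ h))
        (trans (slope-comb≡ (T⊆K (∈Ts⁻ h∈)) 1∈K (T⊆K (∈Ts⁻ h′∈)) 1∈K 1≢0 1≢0 e) (*-identityˡ h′))

    length-dirsOf : length (dirsOf c u) ≡ suc (r ℕ.* r)
    length-dirsOf = cong suc (trans (length-map _ Ts) length-Ts)

    clubClique-unique : Unique (clubClique c u)
    clubClique-unique = cartesianProductWith-unique-on (comb c u) Ts Frs
      (λ h f h′ f′ → comb-injective (T⊆K (∈Ts⁻ h)) (Fr⊆K (∈Frs⁻ f)) (T⊆K (∈Ts⁻ h′)) (Fr⊆K (∈Frs⁻ f′))) Ts-unique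
        Frs-unique

    length-clubClique : length (clubClique c u) ≡ q
    length-clubClique = trans (length-cartesianProductWith (comb c u) Ts Frs)
      (trans (cong₂ ℕ._*_ length-Ts length-Frs) (trans (ℕₚ.*-comm (r ℕ.* r) r) (sym q≡)))

    ∈-clubClique : ∀ {h f} → InT h → InFr f → comb c u h f ∈ clubClique c u
    ∈-clubClique h f = ∈-cartesianProductWith⁺ (comb c u) (∈Ts h) (∈Frs f)

    ∈-clubClique⁻ : ∀ {x} → x ∈ clubClique c u → ∃[ h ] ∃[ f ] (InT h × InFr f × x ≡ comb c u h f)
    ∈-clubClique⁻ x∈ = let (h , f , h∈ , f∈ , e) = ∈-cartesianProductWith⁻ (comb c u) Ts Frs x∈ in h , f , ∈Ts⁻ h∈ ,
      ∈Frs⁻ f∈ , e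

    comb-slope : ∀ {h f} → InT h → InFr f → comb c u h f ≢ 0# → slope (comb c u h f) ∈ dirsOf c u
    comb-slope {h} {f} hT fF x≢0 = by-cases (f ≟ 0#)
      where
      e : f ≡ 0# → comb c u h f ≡ c * h
      e f0 = trans (cong (comb c u h) f0) (solve 3 (λ c u h → c :* h :+ u :* :0 := c :* h) refl c u h)
      h≢0 : f ≡ 0# → h ≢ 0#
      h≢0 f0 h0 = x≢0 (trans (cong₂ (comb c u) h0 f0) (solve 2 (λ c u → c :* :0 :+ u :* :0 := :0) refl c u))
      by-cases : Dec (f ≡ 0#) → slope (comb c u h f) ∈ dirsOf c u
      by-cases (yes f0) = here (trans (cong slope (e f0)) (slope-scale (T⊆K hT) (h≢0 f0) c≢0))
      by-cases (no f≢0) = there (subst (_∈ map (λ h → slope (comb c u h 1#)) Ts)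
        (sym (slope-comb-1 (T⊆K hT) (Fr⊆K fF) f≢0))
        (∈-map⁺ (λ h → slope (comb c u h 1#)) (∈Ts (subst InT (*-comm (inv f) h) (T-Fr (fixed-inv frob-r fF) hT)))))

    clubClique-slope : ∀ {x} → x ∈ clubClique c u → x ≢ 0# → slope x ∈ dirsOf c u
    clubClique-slope x∈ x≢0 = let (h , f , hT , fF , e) = ∈-clubClique⁻ x∈ in
      subst (λ t → slope t ∈ dirsOf c u) (sym e) (comb-slope hT fF (x≢0 ∘ trans e))

    clubClique-- : ∀ {x y} → x ∈ clubClique c u → y ∈ clubClique c u → x - y ∈ clubClique c u
    clubClique-- x∈ y∈ = let (h , f , hT , fF , e) = ∈-clubClique⁻ x∈ ; (h′ , f′ , hT′ , fF′ , e′) = ∈-clubClique⁻ y∈ in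
      subst (_∈ clubClique c u) (trans
        (solve 6 (λ c u h f h′ f′ → c :* (h :- h′) :+ u :* (f :- f′) := (c :* h :+ u :* f) :- (c :* h′ :+ u :* f′))
        refl c u h f h′ f′) (sym (cong₂ _-_ e e′)))
        (∈-clubClique (T-sub hT hT′) (fixed-+ frob-r fF (fixed-neg frob-r fF′)))

  module Structure (us : List Carrier) (us-unique : Unique us) (length-us : length us ≡ q) (0∈us : 0# ∈ us)
    (sub : RSubspace us) (dirs : List Carrier) (few-dirs : length dirs ≤ suc (r ℕ.* r))
    (us-dirs : ∀ {x} → x ∈ us → x ≢ 0# → slope x ∈ dirs) where

    open RSubspace sub

    us* : List Carrier
    us* = nonzeros us

    us*⁻ : ∀ {x} → x ∈ us* → x ∈ us × x ≢ 0#
    us*⁻ = ∈nonzeros⁻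

    us*-unique : Unique us*
    us*-unique = nonzeros-unique us-unique

    length-us* : suc (length us*) ≡ q
    length-us* = trans (length-nonzeros us-unique 0∈us) length-us

    Wide : Carrier → Carrier → Set
    Wide x y = InK (inv x * y) × ¬ InFr (inv x * y)

    wide? : ∀ x y → Dec (Wide x y)
    wide? x y = fixed? frob-q (inv x * y) ×-dec ¬? (fixed? frob-r (inv x * y))

    -- Otherwise every slope carries at most r - 1 nonzero points, so r³ - 1 ≤ (r² + 1)(r - 1),
    -- which falls short by r² - r. Thus some K-line meets `us` in more than one 𝔽_r-line.
    narrow-impossible : ¬ (∀ {x y} → x ∈ us* → y ∈ us* → ¬ Wide x y)
    narrow-impossible narrow = ℕₚ.<⇒≱ (arith r 1<r)
      (subst₂ _≤_ (trans (ℕₚ.suc-injective (trans length-us* (trans q≡ (sym (sp 0<rrr))))) refl) refl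
      (ℕₚ.≤-trans (fibre-bound _≟_ slope (r ∸ 1) dirs us* (λ x∈ → us-dirs (proj₁ (us*⁻ x∈)) (proj₂ (us*⁻ x∈))) fib)
        (ℕₚ.*-monoˡ-≤ (r ∸ 1) few-dirs)))
      where
      0<rrr : 0 < r ℕ.* (r ℕ.* r)
      0<rrr = subst (0 <_) q≡ 0<q
      sp : ∀ {n} → 0 < n → suc (n ∸ 1) ≡ n
      sp {suc n} _ = refl
      arith : ∀ r → 1 < r → suc (r ℕ.* r) ℕ.* (r ∸ 1) < r ℕ.* (r ℕ.* r) ∸ 1
      arith (suc zero) (s≤s ())
      arith (suc (suc n)) _ = subst (suc (suc (ss ℕ.* ss) ℕ.* suc n) ≤_) (cong (_∸ 1) (lem n))
        (ℕₚ.m≤m+n _ (suc n ℕ.* suc n ℕ.+ n))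
        where
        ss = suc (suc n)
        lem : ∀ n → suc (suc (suc (suc (suc n) ℕ.* suc (suc n)) ℕ.* suc n) ℕ.+ (suc n ℕ.* suc n ℕ.+ n)) ≡ suc (suc n)
          ℕ.* (suc (suc n) ℕ.* suc (suc n))
        lem = solve-∀
      fib : ∀ z → length (filter (λ x → slope x ≟ z) us*) ≤ r ∸ 1
      fib z = go (filter (λ x → slope x ≟ z) us*) (filter⁺ _ us*-unique)
        (λ x∈ → proj₁ (∈-filter⁻ (λ x → slope x ≟ z) {xs = us*} x∈))
        (λ x∈ → proj₂ (∈-filter⁻ (λ x → slope x ≟ z) {xs = us*} x∈))
        where
        go : ∀ xs → Unique xs → (∀ {x} → x ∈ xs → x ∈ us*) → (∀ {x} → x ∈ xs → slope x ≡ z) → length xs ≤ r ∸ 1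
        go [] _ _ _ = z≤n
        go xs@(x₀ ∷ _) u ⊆us* val = ℕₚ.∸-monoˡ-≤ 1
          (subst (suc (length xs) ≤_) (trans (length-map (x₀ *_) Frs) length-Frs)
          (unique-⊆-length {xs = 0# ∷ xs} (All.tabulate (λ x∈ e → nz x∈ (sym e)) ∷ u) mem))
          where
          nz : ∀ {x} → x ∈ xs → x ≢ 0#
          nz x∈ = proj₂ (us*⁻ (⊆us* x∈))
          x₀≢0 = nz (here refl)
          mem : ∀ {x} → x ∈ 0# ∷ xs → x ∈ map (x₀ *_) Frs
          mem (here refl) = subst (_∈ map (x₀ *_) Frs) (zeroʳ x₀) (∈-map⁺ (x₀ *_) (∈Frs (fixed-0 frob-r)))
          mem {x} (there x∈) = subst (_∈ map (x₀ *_) Frs) (*-inv-* x x₀≢0)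
            (∈-map⁺ (x₀ *_) (∈Frs (by-cases (fixed? frob-r (inv x₀ * x)))))
            where
            by-cases : Dec (InFr (inv x₀ * x)) → InFr (inv x₀ * x)
            by-cases (yes f) = f
            by-cases (no nf) = ⊥-elim (narrow (⊆us* (here refl)) (⊆us* x∈)
              (slope-quotient x₀≢0 (nz x∈) (trans (val (here refl)) (sym (val x∈))) , nf))

    Wide-pair : Set
    Wide-pair = ∃[ x ] ∃[ y ] (x ∈ us* × y ∈ us* × Wide x y)

    wide-pair : Wide-pair
    wide-pair = by-cases (any? (λ x → any? (wide? x) us*) us*)
      where
      by-cases : Dec (Any (λ x → Any (Wide x) us*) us*) → Wide-pair
      by-cases (yes a) = let (x , x∈ , b) = find a ; (y , y∈ , w) = find b in x , y , x∈ , y∈ , w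
      by-cases (no ¬a) = ⊥-elim (narrow-impossible λ x∈ y∈ w → ¬a (lose x∈ (lose y∈ w)))

    module FromPair (x₁ x₂ : Carrier) (x₁∈ : x₁ ∈ us*) (x₂∈ : x₂ ∈ us*) (w : Wide x₁ x₂) where

      x₁≢0 = proj₂ (us*⁻ x₁∈)

      y α c : Carrier
      y = inv x₁ * x₂
      -- The cross product of (1, y) with its Frobenius conjugate: α is orthogonal to 1 and y for the trace form.
      α = (y ^ r) ^ r - y ^ r
      -- With this choice cα = x₁ and c(αy) = x₂: multiplication by α carries the 𝔽_r-span of 1 and
      -- y onto T.
      c = x₁ * inv α

      y-r³ : ((y ^ r) ^ r) ^ r ≡ y
      y-r³ = trans (sym (^q-^r y)) (eq (proj₁ w))

      α^r : α ^ r ≡ y - (y ^ r) ^ r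
      α^r = trans (frob-sub frob-r _ _) (cong (_- (y ^ r) ^ r) y-r³)

      α^rr : (α ^ r) ^ r ≡ y ^ r - y
      α^rr = trans (cong (_^ r) α^r) (trans (frob-sub frob-r _ _) (cong (λ t → y ^ r - t) y-r³))

      α∈T : InT α
      α∈T = inT (trans (cong₂ (λ s t → α + s + t) α^r α^rr) (solve 3 (λ y a b → (b :- a) :+ (y :- b) :+ (a :- y) := :0)
        refl y (y ^ r) ((y ^ r) ^ r)))

      αy∈T : InT (α * y)
      αy∈T = inT (trans (cong₂ (λ s t → α * y + s + t) (^-mul α y r)
        (trans (cong (_^ r) (^-mul α y r)) (^-mul (α ^ r) (y ^ r) r)))
        (trans (cong₂ (λ s t → α * y + s * y ^ r + t * (y ^ r) ^ r) α^r α^rr)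
          (solve 3 (λ y a b → (b :- a) :* y :+ (y :- b) :* a :+ (a :- y) :* b := :0) refl y (y ^ r) ((y ^ r) ^ r))))

      α≢0 : α ≢ 0#
      α≢0 e = proj₂ w (fixed (frob-inj frob-r (-‿≡0 e)))

      c≢0 : c ≢ 0#
      c≢0 = *-≢0 x₁≢0 (inv≢0 α≢0)

      plane : Carrier → Carrier → Carrier
      plane f₁ f₂ = α * f₁ + α * y * f₂

      plane∈T : ∀ {f₁ f₂} → InFr f₁ → InFr f₂ → InT (plane f₁ f₂)
      plane∈T f₁ f₂ = T-+ (subst InT (*-comm _ _) (T-Fr f₁ α∈T)) (subst InT (*-comm _ _) (T-Fr f₂ αy∈T))

      plane-injective : ∀ {f₁ f₂ g₁ g₂} → InFr f₁ → InFr f₂ → InFr g₁ → InFr g₂ → plane f₁ f₂ ≡ plane g₁ g₂ →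
        f₁ ≡ g₁ × f₂ ≡ g₂
      plane-injective {f₁} {f₂} {g₁} {g₂} a b a′ b′ e = by-cases (f₂ ≟ g₂)
        where
        e₁ : f₁ + y * f₂ ≡ g₁ + y * g₂
        e₁ = *-cancelˡ α≢0 (trans (solve 4 (λ α y f g → α :* (f :+ y :* g) := α :* f :+ α :* y :* g) refl α y f₁ f₂)
          (trans e (solve 4 (λ α y f g → α :* f :+ α :* y :* g := α :* (f :+ y :* g)) refl α y g₁ g₂)))
        by-cases : Dec (f₂ ≡ g₂) → f₁ ≡ g₁ × f₂ ≡ g₂
        by-cases (yes e₂) = -‿≡0 (trans (solve 4 (λ f g y h → f :- g := (f :+ y :* h) :- (g :+ y :* h)) refl f₁ g₁ y
          g₂) (≡⇒-‿0 (trans (cong (λ t → f₁ + y * t) (sym e₂)) e₁))) , e₂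
        by-cases (no ne) = ⊥-elim (proj₂ w
          (subst InFr yq (fixed-* frob-r (fixed-inv frob-r (fixed-+ frob-r b (fixed-neg frob-r b′)))
          (fixed-+ frob-r a′ (fixed-neg frob-r a)))))
          where
          yq : inv (f₂ - g₂) * (g₁ - f₁) ≡ y
          yq = *-cancelˡ (ne ∘ -‿≡0) (trans (*-inv-* (g₁ - f₁) (ne ∘ -‿≡0)) (-‿≡0 (trans
            (solve 5 (λ f₁ f₂ g₁ g₂ y → (g₁ :- f₁) :- (f₂ :- g₂) :* y := (g₁ :+ y :* g₂) :- (f₁ :+ y :* f₂)) refl f₁ f₂
              g₁ g₂ y) (≡⇒-‿0 (sym e₁)))))

      -- The r² combinations of α and αy are distinct elements of T, hence all of T, and c maps them
      -- to combinations of x₁ and x₂.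
      cT⊆us : ∀ {h} → InT h → c * h ∈ us
      cT⊆us {h} hT = let (f₁ , f₂ , f₁∈ , f₂∈ , e) = ∈-cartesianProductWith⁻ plane Frs Frs h∈ in
        subst (_∈ us) (trans (back f₁ f₂) (cong (c *_) (sym e)))
          (+-closed (*-closed (eq (∈Frs⁻ f₁∈)) (proj₁ (us*⁻ x₁∈))) (*-closed (eq (∈Frs⁻ f₂∈)) (proj₁ (us*⁻ x₂∈))))
        where
        planes = cartesianProductWith plane Frs Frs
        planes-unique : Unique planes
        planes-unique = cartesianProductWith-unique-on plane Frs Frs (λ a b a′ b′ → plane-injective (∈Frs⁻ a) (∈Frs⁻ b)
          (∈Frs⁻ a′) (∈Frs⁻ b′)) Frs-unique Frs-unique
        into : ∀ {x} → x ∈ planes → x ∈ Ts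
        into x∈ = let (f₁ , f₂ , f₁∈ , f₂∈ , e) = ∈-cartesianProductWith⁻ plane Frs Frs x∈ in
          subst (_∈ Ts) (sym e) (∈Ts (plane∈T (∈Frs⁻ f₁∈) (∈Frs⁻ f₂∈)))
        h∈ : h ∈ planes
        h∈ = unique-⊆-full _≟_ planes-unique into
          (ℕₚ.≤-reflexive (trans length-Ts
          (sym (trans (length-cartesianProductWith plane Frs Frs) (cong₂ ℕ._*_ length-Frs length-Frs))))) (∈Ts hT)
        back : ∀ f₁ f₂ → f₁ * x₁ + f₂ * x₂ ≡ c * plane f₁ f₂
        back f₁ f₂ = begin
          f₁ * x₁ + f₂ * x₂                          ≡⟨ cong (λ t → f₁ * x₁ + f₂ * t) (*-inv-* x₂ x₁≢0) ⟨
          f₁ * x₁ + f₂ * (x₁ * y)                    ≡⟨ solve 4 (λ f g x y → f :* x :+ g :* (x :* y) := x :* :1 :*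
            (f :+ y :* g)) refl f₁ f₂ x₁ y ⟩
          x₁ * 1# * (f₁ + y * f₂)                    ≡⟨ cong (λ t → x₁ * t * (f₁ + y * f₂)) (inv-l α≢0) ⟨
          x₁ * (inv α * α) * (f₁ + y * f₂)           ≡⟨ solve 6 (λ f g x y i a → x :* (i :* a) :* (f :+ y :* g) := x :*
            i :* (a :* f :+ a :* y :* g)) refl f₁ f₂ x₁ y (inv α) α ⟩
          c * plane f₁ f₂ ∎
          where open ≡-Reasoning

    Line Club : Set
    Line = ∃[ c ] (c ≢ 0# × slope c ∈ dirs × (∀ {x} → x ∈ us → ∃[ t ] (InK t × x ≡ c * t)))
    Club = ∃[ c ] ∃[ u ] (det c u ≢ 0# × (∀ {x} → x ∈ us → x ∈ clubClique c u) × (∀ {x} → x ∈ clubClique c u → x ∈ us))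

    -- `us` contains cT, of size r². Any u in `us` off the K-line of c gives r³ = q elements cT +
    -- u𝔽_r, which exhaust `us`; if there is no such u, `us` lies on that line.
    line-or-club : Line ⊎ Club
    line-or-club = let (x₁ , x₂ , x₁∈ , x₂∈ , w) = wide-pair in go x₁ x₂ x₁∈ x₂∈ w
      where
      go : ∀ x₁ x₂ → x₁ ∈ us* → x₂ ∈ us* → Wide x₁ x₂ → Line ⊎ Club
      go x₁ x₂ x₁∈ x₂∈ w = by-cases (any? (λ u → ¬? (det x₁ u ≟ 0#)) us)
        where
        open FromPair x₁ x₂ x₁∈ x₂∈ w
        line : (∀ {u} → u ∈ us → det x₁ u ≡ 0#) → Line
        line z = x₁ , x₁≢0 , us-dirs (proj₁ (us*⁻ x₁∈)) x₁≢0 , λ {x} x∈ → inv x₁ * x , multiple x x∈ (x ≟ 0#) ,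
          sym (*-inv-* x x₁≢0)
          where
          multiple : ∀ x → x ∈ us → Dec (x ≡ 0#) → InK (inv x₁ * x)
          multiple x x∈ (yes x0) = subst InK (sym (trans (cong (inv x₁ *_) x0) (zeroʳ _))) 0∈Ks
          multiple x x∈ (no x≢0) = slope-quotient x₁≢0 x≢0 (det0⇒slope≡ x₁≢0 x≢0 (z x∈))
        club : ∀ u → u ∈ us → det x₁ u ≢ 0# → Club
        club u u∈ d = c , u , dc , unique-⊆-full _≟_ (Basis.clubClique-unique dc) into
          (ℕₚ.≤-reflexive (trans length-us (sym (Basis.length-clubClique dc)))) , into
          where
          x₁-comb : x₁ ≡ comb c u α 0#
          x₁-comb = trans (sym (trans (cong (x₁ *_) (inv-l α≢0)) (*-identityʳ x₁)))
            (solve 4 (λ x i a u → x :* (i :* a) := x :* i :* a :+ u :* :0) refl x₁ (inv α) α u)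
          dc : det c u ≢ 0#
          dc e = d (trans (cong (λ t → det t u) x₁-comb)
            (trans (det-comb-u c u (T⊆K α∈T) 0∈Ks) (trans (cong (α *_) e) (zeroʳ α))))
          into : ∀ {x} → x ∈ clubClique c u → x ∈ us
          into x∈ = let (h , f , hT , fF , e) = Basis.∈-clubClique⁻ dc x∈ in
            subst (_∈ us) (trans (cong (c * h +_) (*-comm f u)) (sym e)) (+-closed (cT⊆us hT) (*-closed (eq fF) u∈))
        by-cases : Dec (Any (λ u → det x₁ u ≢ 0#) us) → Line ⊎ Club
        by-cases (yes a) = let (u , u∈ , d) = find a in inj₂ (club u u∈ d)
        by-cases (no ¬a) = inj₁ (line λ {u} u∈ → zero-of u u∈ (det x₁ u ≟ 0#))
          where
          zero-of : ∀ u → u ∈ us → Dec (det x₁ u ≡ 0#) → det x₁ u ≡ 0#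
          zero-of u u∈ (yes e) = e
          zero-of u u∈ (no ne) = ⊥-elim (¬a (lose u∈ ne))

  -- The slopes determine the club

  T-nonzero : ∃[ h ] (InT h × h ≢ 0#)
  T-nonzero = go Ts Ts-unique ∈Ts⁻ (ℕₚ.≤-trans (ℕₚ.≤-trans 1<r (ℕₚ.m≤m*n r r {{ℕ.>-nonZero (pw>0 k)}}))
    (ℕₚ.≤-reflexive (sym length-Ts)))
    where
    go : ∀ xs → Unique xs → (∀ {x} → x ∈ xs → InT x) → 2 ≤ length xs → ∃[ h ] (InT h × h ≢ 0#)
    go (_ ∷ []) _ _ (s≤s ())
    go (a ∷ b ∷ xs) ((a≢b ∷ _) ∷ _) t _ with a ≟ 0#
    ... | no a≢0 = a , t (here refl) , a≢0
    ... | yes refl = b , t (there (here refl)) , λ b0 → a≢b (sym b0)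

  -- A hyperplane T is not closed under inversion up to a scalar. By Hua's identity
  -- a - (a⁻¹ + (b⁻¹ - a)⁻¹)⁻¹ = aba, such a scalar λ would make λa² stabilise T for every a ∈ T,
  -- forcing λa² ∈ 𝔽_r, which is a polynomial equation of degree 2r - 1 < r² after division by a.
  module Hua (λ′ : Carrier) (inverses : ∀ {h} → InT h → h ≢ 0# → ∃[ h′ ] (InT h′ × λ′ * h * h′ ≡ 1#)) where

    aba∈T : ∀ {a b} → InT a → InT b → InT (λ′ * (a * a) * b)
    aba∈T {a} {b} aT bT = by-a (a ≟ 0#)
      where
      Goal = InT (λ′ * (a * a) * b)
      nonzero : a ≢ 0# → b ≢ 0# → Goal
      nonzero a≢0 b≢0 = by-b̃ (b̃ ≟ a)
        where
        b̃ = proj₁ (inverses bT b≢0)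
        b̃T = proj₁ (proj₂ (inverses bT b≢0))
        b̃-eq : λ′ * b * b̃ ≡ 1#
        b̃-eq = proj₂ (proj₂ (inverses bT b≢0))
        b̃≢0 : b̃ ≢ 0#
        b̃≢0 e = 0≢1 (trans (sym (zeroʳ _)) (trans (cong (λ′ * b *_) (sym e)) b̃-eq))
        by-b̃ : Dec (b̃ ≡ a) → Goal
        -- Here b̃ = 1/(λ′b). If it equals a, Hua's identity would divide by zero, but then λ′a²b =
        -- a directly.
        by-b̃ (yes e) = subst InT (sym (trans (solve 3 (λ l a b → l :* (a :* a) :* b := l :* b :* a :* a) refl λ′ a b)
          (trans (cong (λ t → λ′ * b * t * a) (sym e)) (trans (cong (_* a) b̃-eq) (*-identityˡ a))))) aT
        by-b̃ (no ne) = subst InT final (T-sub aT wsT)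
          where
          a₀ = b̃ - a
          a₀≢0 : a₀ ≢ 0#
          a₀≢0 = ne ∘ -‿≡0
          a* = proj₁ (inverses aT a≢0)
          a*T = proj₁ (proj₂ (inverses aT a≢0))
          a₀* = proj₁ (inverses (T-sub b̃T aT) a₀≢0)
          a₀*T = proj₁ (proj₂ (inverses (T-sub b̃T aT) a₀≢0))
          a*-eq : λ′ * a * a* ≡ 1#
          a*-eq = proj₂ (proj₂ (inverses aT a≢0))
          a₀*-eq : λ′ * a₀ * a₀* ≡ 1#
          a₀*-eq = proj₂ (proj₂ (inverses (T-sub b̃T aT) a₀≢0))
          -- With a* = 1/(λ′a) and a₀* = 1/(λ′a₀), this is b̃/(λ′a a₀), so the scaled inverse of w
          -- is a a₀/b̃ = a - λ′a²b.
          w = a* + a₀*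
          w-eq : λ′ * (a * a₀) * w ≡ b̃
          w-eq = begin
            λ′ * (a * a₀) * (a* + a₀*)                    ≡⟨ solve 5
              (λ l a a₀ s t → l :* (a :* a₀) :* (s :+ t) := a₀ :* (l :* a :* s) :+ a :* (l :* a₀ :* t)) refl λ′ a a₀ a*
              a₀* ⟩
            a₀ * (λ′ * a * a*) + a * (λ′ * a₀ * a₀*)      ≡⟨ cong₂ (λ s t → a₀ * s + a * t) a*-eq a₀*-eq ⟩
            (b̃ - a) * 1# + a * 1#                         ≡⟨ solve 2 (λ b a → (b :- a) :* :1 :+ a :* :1 := b) refl b̃
              a ⟩
            b̃ ∎
            where open ≡-Reasoning
          w≢0 : w ≢ 0#
          w≢0 e = b̃≢0 (trans (sym w-eq) (trans (cong (λ′ * (a * a₀) *_) e) (zeroʳ _)))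
          ws = proj₁ (inverses (T-+ a*T a₀*T) w≢0)
          wsT = proj₁ (proj₂ (inverses (T-+ a*T a₀*T) w≢0))
          ws-eq : λ′ * w * ws ≡ 1#
          ws-eq = proj₂ (proj₂ (inverses (T-+ a*T a₀*T) w≢0))
          ws≡ : ws ≡ a - λ′ * (a * a) * b
          ws≡ = sym (begin
            a - λ′ * (a * a) * b                            ≡⟨ cong (_- λ′ * (a * a) * b)
              (trans (sym (*-identityˡ a)) (cong (_* a) (sym b̃-eq))) ⟩
            λ′ * b * b̃ * a - λ′ * (a * a) * b               ≡⟨ solve 4
              (λ l a b t → l :* b :* t :* a :- l :* (a :* a) :* b := l :* b :* (a :* (t :- a)) :* :1) refl λ′ a b b̃ ⟩
            λ′ * b * (a * a₀) * 1#                          ≡⟨ cong (λ′ * b * (a * a₀) *_) ws-eq ⟨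
            λ′ * b * (a * a₀) * (λ′ * w * ws)               ≡⟨ solve 5
              (λ l b p w s → l :* b :* p :* (l :* w :* s) := l :* b :* (l :* p :* w) :* s) refl λ′ b (a * a₀) w ws ⟩
            λ′ * b * (λ′ * (a * a₀) * w) * ws               ≡⟨ cong (λ t → λ′ * b * t * ws) w-eq ⟩
            λ′ * b * b̃ * ws                                 ≡⟨ cong (_* ws) b̃-eq ⟩
            1# * ws                                         ≡⟨ *-identityˡ ws ⟩
            ws ∎)
            where open ≡-Reasoning
          final : a - ws ≡ λ′ * (a * a) * b
          final = trans (cong (λ t → a - t) ws≡) (solve 2 (λ a z → a :- (a :- z) := z) refl a (λ′ * (a * a) * b))
      by-b : a ≢ 0# → Dec (b ≡ 0#) → Goal
      by-b a≢0 (yes b0) = subst InT (sym (trans (cong (λ′ * (a * a) *_) b0) (zeroʳ _))) T-0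
      by-b a≢0 (no b≢0) = nonzero a≢0 b≢0
      by-a : Dec (a ≡ 0#) → Goal
      by-a (yes a0) = subst InT (sym (trans (cong (λ t → λ′ * (t * t) * b) a0)
        (solve 2 (λ l b → l :* (:0 :* :0) :* b := :0) refl λ′ b))) T-0
      by-a (no a≢0) = by-b a≢0 (b ≟ 0#)

    absurd : ⊥
    absurd = λ≢0 (trans (sym (-‿involutive λ′)) (trans (cong -_ linear) -0#≈0#))
      where
      h₀ = proj₁ T-nonzero
      h₀T = proj₁ (proj₂ T-nonzero)
      h₀≢0 = proj₂ (proj₂ T-nonzero)
      λ≢0 : λ′ ≢ 0#
      λ≢0 e = 0≢1 (trans (solve 2 (λ h h′ → :0 := :0 :* h :* h′) refl h₀ _)
        (trans (cong (λ t → t * h₀ * proj₁ (inverses h₀T h₀≢0)) (sym e)) (proj₂ (proj₂ (inverses h₀T h₀≢0)))))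
      -- The condition (λ′x²)^r = λ′x², divided by x, becomes λ′^r x^(2r-1) = λ′x; the length 2r of
      -- f is at most r² = |T|.
      d = r ℕ.+ (r ∸ 1)
      f = addP (0# ∷ - λ′ ∷ []) (scaleP (λ′ ^ r) (mono d))
      lf : length f ≤ length Ts
      lf = subst (length f ≤_) (sym length-Ts) (ℕₚ.≤-trans (length-addP (0# ∷ - λ′ ∷ []) (scaleP (λ′ ^ r) (mono d))
          (s≤s (ℕₚ.≤-trans (pw>0 k) (ℕₚ.m≤m+n r _))) (length-scaleP (λ′ ^ r) (mono d) (ℕₚ.≤-reflexive (length-mono d))))
        (ℕₚ.≤-trans (ℕₚ.≤-reflexive (trans (sym (ℕₚ.+-suc r (r ∸ 1)))
          (cong (r ℕ.+_) (trans (suc-pred-pw k) (sym (ℕₚ.+-identityʳ r)))))) (ℕₚ.*-monoˡ-≤ r 1<r)))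
      ef : ∀ x → eval f x ≡ λ′ ^ r * (x ^ r * x ^ (r ∸ 1)) - λ′ * x
      ef x = trans (eval-addP (0# ∷ - λ′ ∷ []) (scaleP (λ′ ^ r) (mono d)) x) (trans (cong (eval (0# ∷ - λ′ ∷ []) x +_)
        (trans (eval-scaleP (λ′ ^ r) (mono d) x) (cong (λ′ ^ r *_) (trans (eval-mono d x) (^-+ x r (r ∸ 1))))))
        (solve 3 (λ l x y → (:0 :+ x :* (:- l :+ x :* :0)) :+ y := y :- l :* x) refl λ′ x _))
      root : ∀ {x} → x ∈ Ts → eval f x ≡ 0#
      root {x} x∈ = by-cases (x ≟ 0#)
        where
        by-cases : Dec (x ≡ 0#) → eval f x ≡ 0#
        by-cases (yes x0) = trans (cong (eval f) x0)
          (trans (ef 0#) (trans (cong (λ t → λ′ ^ r * (t * 0# ^ (r ∸ 1)) - λ′ * 0#) (0^ r (pw>0 k)))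
          (solve 3 (λ a b l → a :* (:0 :* b) :- l :* :0 := :0) refl (λ′ ^ r) (0# ^ (r ∸ 1)) λ′)))
        by-cases (no x≢0) = *-zero-r x≢0 (begin
          eval f x * x                                         ≡⟨ cong (_* x) (ef x) ⟩
          (λ′ ^ r * (x ^ r * x ^ (r ∸ 1)) - λ′ * x) * x        ≡⟨ solve 5
            (λ a b c l x → (a :* (b :* c) :- l :* x) :* x := a :* (b :* (x :* c)) :- l :* (x :* x)) refl (λ′ ^ r)
            (x ^ r) (x ^ (r ∸ 1)) λ′ x ⟩
          λ′ ^ r * (x ^ r * x ^ suc (r ∸ 1)) - λ′ * (x * x)    ≡⟨ cong (λ n → λ′ ^ r * (x ^ r * x ^ n) - λ′ * (x * x))
            (suc-pred-pw k) ⟩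
          λ′ ^ r * (x ^ r * x ^ r) - λ′ * (x * x)              ≡⟨ cong (_- λ′ * (x * x))
            (trans (cong (λ′ ^ r *_) (sym (^-mul x x r))) (sym (^-mul λ′ (x * x) r))) ⟩
          (λ′ * (x * x)) ^ r - λ′ * (x * x)                    ≡⟨ ≡⇒-‿0
            (eq (T-stable⇒Fr (λ′ * (x * x)) (aba∈T (∈Ts⁻ x∈)))) ⟩
          0# ∎)
          where open ≡-Reasoning
      linear : - λ′ ≡ 0#
      linear = begin
        - λ′                                    ≡⟨ +-identityʳ (- λ′) ⟨
        - λ′ + 0#                               ≡⟨ cong (- λ′ +_)
          (trans (coef-scaleP (λ′ ^ r) (mono d) 1) (trans (cong (λ′ ^ r *_) (coef-mono-≢ d 1≢d)) (zeroʳ _))) ⟨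
        - λ′ + coef (scaleP (λ′ ^ r) (mono d)) 1  ≡⟨ coef-addP (0# ∷ - λ′ ∷ []) (scaleP (λ′ ^ r) (mono d)) 1 ⟨
        coef f 1                                ≡⟨ roots⇒Zero f Ts-unique root lf 1 ⟩
        0# ∎
        where
        open ≡-Reasoning
        1≢d : 1 ≢ d
        1≢d = ℕₚ.<⇒≢ (ℕₚ.≤-trans 1<r (ℕₚ.m≤m+n r _))

  -- The freedom in choosing a basis for a given slope set: β scales the whole clique, ν is absorbed
  -- by T, and τ moves u along cT inside the clique.
  record Rescaled (c u c′ u′ : Carrier) : Set where
    field
      β ν τ : Carrier
      β∈K : InK β
      β≢0 : β ≢ 0#
      ν∈Fr : InFr ν
      ν≢0 : ν ≢ 0#
      τ∈T : InT τ
      c′≡ : c′ ≡ c * (β * ν)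
      u′≡ : u′ ≡ comb c u (τ * β) β

  module SameDirs {c u c′ u′ : Carrier} (d : det c u ≢ 0#) (d′ : det c′ u′ ≢ 0#)
    (dirs⊆ : ∀ {s} → s ∈ dirsOf c′ u′ → s ∈ dirsOf c u) where

    private
      module B = Basis d
      module B′ = Basis d′

    dirs⊇ : ∀ {s} → s ∈ dirsOf c u → s ∈ dirsOf c′ u′
    dirs⊇ = unique-⊆-full _≟_ B′.dirsOf-unique dirs⊆ (ℕₚ.≤-reflexive (trans B.length-dirsOf (sym B′.length-dirsOf)))

    tail-dir : ∀ {c u s} → s ∈ dirsOf c u → s ≢ slope c → ∃[ h ] (InT h × s ≡ slope (comb c u h 1#))
    tail-dir (here e) ne = ⊥-elim (ne e)
    tail-dir {c} {u} (there s∈) _ = let (h , h∈ , e) = ∈-map⁻ (λ h → slope (comb c u h 1#)) s∈ in h , ∈Ts⁻ h∈ , e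

    -- If the heads differ, c′ is parallel to some u₁ = u + ch₀ and c to some u₁′ = u′ + c′h₁. For
    -- each nonzero h in T the slope of u₁ + ch is that of u₁′ + c′g with g in T; with c′ = u₁κ and
    -- u₁′ = cκ′ this says κhg = κ′. So T is closed under inversion up to a scalar, against
    -- `Hua.absurd`.
    head-unique : slope c′ ≡ slope c
    head-unique = by-cases (slope c′ ≟ slope c)
      where
      by-cases : Dec (slope c′ ≡ slope c) → slope c′ ≡ slope c
      by-cases (yes e) = e
      by-cases (no ne) = ⊥-elim (Hua.absurd λ′ inverses)
        where
        t₀ = tail-dir (dirs⊆ (here refl)) ne
        h₀ = proj₁ t₀
        h₀T = proj₁ (proj₂ t₀)
        u₁ = comb c u h₀ 1#
        t₁ = tail-dir (dirs⊇ (here refl)) (ne ∘ sym)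
        h₁ = proj₁ t₁
        h₁T = proj₁ (proj₂ t₁)
        u₁′ = comb c′ u′ h₁ 1#
        u₁≢0 : u₁ ≢ 0#
        u₁≢0 = B.comb≢0 (T⊆K h₀T) 1∈K 1≢0
        u₁′≢0 : u₁′ ≢ 0#
        u₁′≢0 = B′.comb≢0 (T⊆K h₁T) 1∈K 1≢0
        κ = inv u₁ * c′
        κ∈K : InK κ
        κ∈K = slope-quotient u₁≢0 B′.c≢0 (sym (proj₂ (proj₂ t₀)))
        κ′ = inv c * u₁′
        κ′∈K : InK κ′
        κ′∈K = slope-quotient B.c≢0 u₁′≢0 (proj₂ (proj₂ t₁))
        c′≡ : c′ ≡ u₁ * κ
        c′≡ = sym (*-inv-* c′ u₁≢0)
        u₁′≡ : u₁′ ≡ c * κ′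
        u₁′≡ = sym (*-inv-* u₁′ B.c≢0)
        κ≢0 : κ ≢ 0#
        κ≢0 = *-≢0 (inv≢0 u₁≢0) B′.c≢0
        κ′≢0 : κ′ ≢ 0#
        κ′≢0 = *-≢0 (inv≢0 B.c≢0) u₁′≢0
        λ′ = κ * inv κ′
        d₁ : det c u₁ ≢ 0#
        d₁ e = d (trans (sym (*-identityˡ _)) (trans (sym (det-c-comb c u (T⊆K h₀T) 1∈K)) e))
        module B₁ = Basis d₁
        inverses : ∀ {h} → InT h → h ≢ 0# → ∃[ h′ ] (InT h′ × λ′ * h * h′ ≡ 1#)
        inverses {h} hT h≢0 = h″ - h₁ , T-sub h″T h₁T , prod
          where
          pt = comb c u₁ h 1#
          pt≡ : pt ≡ comb c u (h + h₀) 1#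
          pt≡ = solve 4 (λ c u h h₀ → c :* h :+ (c :* h₀ :+ u :* :1) :* :1 := c :* (h :+ h₀) :+ u :* :1) refl c u h h₀
          pt∈ : slope pt ∈ dirsOf c′ u′
          pt∈ = dirs⊇ (subst (λ t → slope t ∈ dirsOf c u) (sym pt≡)
            (B.comb-slope (T-+ hT h₀T) (fixed-1 frob-r) (B.comb≢0 (T⊆K (T-+ hT h₀T)) 1∈K 1≢0)))
          u₁-comb : u₁ * κ ≡ comb c u₁ 0# κ
          u₁-comb = solve 3 (λ c u k → u :* k := c :* :0 :+ u :* k) refl c u₁ κ
          not-head : slope pt ≢ slope c′
          not-head e = h≢0 (trans (sym (*-identityʳ h))
            (*-zero-r κ≢0 (trans (cong (_* κ) (*-identityʳ h))
            (trans (B₁.slope-comb≡ (T⊆K hT) 1∈K 0∈Ks κ∈K 1≢0 κ≢0 (trans e (cong slope (trans c′≡ u₁-comb))))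
            (zeroʳ 1#)))))
          t₂ = tail-dir pt∈ not-head
          h″ = proj₁ t₂
          h″T = proj₁ (proj₂ t₂)
          target : comb c′ u′ h″ 1# ≡ comb c u₁ κ′ (κ * (h″ - h₁))
          target = begin
            c′ * h″ + u′ * 1#                                    ≡⟨ solve 4
              (λ c′ u′ h h₁ → c′ :* h :+ u′ :* :1 := (c′ :* h₁ :+ u′ :* :1) :+ c′ :* (h :- h₁)) refl c′ u′ h″ h₁ ⟩
            u₁′ + c′ * (h″ - h₁)                                 ≡⟨ cong₂ (λ s t → s + t * (h″ - h₁)) u₁′≡ c′≡ ⟩
            c * κ′ + u₁ * κ * (h″ - h₁)                          ≡⟨ cong (c * κ′ +_) (*-assoc _ _ _) ⟩
            c * κ′ + u₁ * (κ * (h″ - h₁)) ∎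
            where open ≡-Reasoning
          κh∈K : InK (κ * (h″ - h₁))
          κh∈K = fixed-* frob-q κ∈K (T⊆K (T-sub h″T h₁T))
          rel : (h * (κ * (h″ - h₁)) - 1# * κ′) ≡ 0#
          rel = *-zero-r d₁ (trans (sym (det-comb c u₁ (T⊆K hT) 1∈K κ′∈K κh∈K))
            (slope≡⇒det0 (B₁.comb≢0 (T⊆K hT) 1∈K 1≢0)
            (λ z → B′.comb≢0 (T⊆K h″T) 1∈K 1≢0 (trans target z)) (trans (proj₂ (proj₂ t₂)) (cong slope target))))
          prod : λ′ * h * (h″ - h₁) ≡ 1#
          prod = begin
            κ * inv κ′ * h * (h″ - h₁)        ≡⟨ solve 4 (λ κ i h g → κ :* i :* h :* g := i :* (h :* (κ :* g))) refl κ
              (inv κ′) h (h″ - h₁) ⟩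
            inv κ′ * (h * (κ * (h″ - h₁)))    ≡⟨ cong (inv κ′ *_) (-‿≡0 rel) ⟩
            inv κ′ * (1# * κ′)                ≡⟨ cong (inv κ′ *_) (*-identityˡ κ′) ⟩
            inv κ′ * κ′                       ≡⟨ inv-l κ′≢0 ⟩
            1# ∎
            where open ≡-Reasoning

    -- With equal heads c′ = cκ, and u′ is parallel to some u + cτ, which gives β. Matching the
    -- other slopes shows that (κ/β)h + τ lies in T for all h in T, so ν = κ/β stabilises T and lies
    -- in 𝔽_r.
    rescaled : Rescaled c u c′ u′
    rescaled = record { β = β ; ν = ν ; τ = τ ; β∈K = β∈K ; β≢0 = β≢0 ; ν∈Fr = ν∈Fr ; ν≢0 = ν≢0 ; τ∈T = τT ; c′≡ =
      c′≡βν ; u′≡ = u′≡ }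
      where
      κ = inv c * c′
      κ∈K : InK κ
      κ∈K = slope-quotient B.c≢0 B′.c≢0 (sym head-unique)
      κ≢0 : κ ≢ 0#
      κ≢0 = *-≢0 (inv≢0 B.c≢0) B′.c≢0
      c′≡ : c′ ≡ c * κ
      c′≡ = sym (*-inv-* c′ B.c≢0)
      tail : ∀ {h} → InT h → ∃[ h₂ ] (InT h₂ × slope (comb c′ u′ h 1#) ≡ slope (comb c u h₂ 1#))
      tail hT = tail-dir (dirs⊆ (there (∈-map⁺ (λ h → slope (comb c′ u′ h 1#)) (∈Ts hT)))) λ e →
        B′.slope-c≢ (T⊆K hT) 1∈K 1≢0 (trans head-unique (sym e))
      t₀ = tail T-0
      τ = proj₁ t₀
      τT = proj₁ (proj₂ t₀)
      uτ = comb c u τ 1#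
      uτ≢0 : uτ ≢ 0#
      uτ≢0 = B.comb≢0 (T⊆K τT) 1∈K 1≢0
      slope-u′ : slope u′ ≡ slope uτ
      slope-u′ = trans (cong slope (solve 2 (λ c u → u := c :* :0 :+ u :* :1) refl c′ u′)) (proj₂ (proj₂ t₀))
      β = inv uτ * u′
      β∈K : InK β
      β∈K = slope-quotient uτ≢0 B′.u≢0 (sym slope-u′)
      β≢0 : β ≢ 0#
      β≢0 = *-≢0 (inv≢0 uτ≢0) B′.u≢0
      u′≡ : u′ ≡ comb c u (τ * β) β
      u′≡ = trans (sym (*-inv-* u′ uτ≢0)) (solve 4 (λ c u t b → (c :* t :+ u :* :1) :* b := c :* (t :* b) :+ u :* b)
        refl c u τ β)
      ν = κ * inv β
      ν≢0 : ν ≢ 0#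
      ν≢0 = *-≢0 κ≢0 (inv≢0 β≢0)
      ν-stable : ∀ {h} → InT h → InT (ν * h)
      ν-stable {h} hT = subst InT νh (T-sub h₂T τT)
        where
        t₂ = tail hT
        h₂ = proj₁ t₂
        h₂T = proj₁ (proj₂ t₂)
        target : comb c′ u′ h 1# ≡ comb c u (κ * h + τ * β) β
        target = trans (cong₂ (λ s t → s * h + t * 1#) c′≡ u′≡)
          (solve 6 (λ c u k h t b → c :* k :* h :+ (c :* (t :* b) :+ u :* b) :* :1 := c :* (k :* h :+ t :* b) :+ u :*
          b) refl c u κ h τ β)
        rel : (κ * h + τ * β) * 1# ≡ β * h₂
        rel = B.slope-comb≡ (fixed-+ frob-q (fixed-* frob-q κ∈K (T⊆K hT)) (fixed-* frob-q (T⊆K τT) β∈K)) β∈K (T⊆K h₂T)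
          1∈K β≢0 1≢0
          (trans (cong slope (sym target)) (proj₂ (proj₂ t₂)))
        νh : h₂ - τ ≡ ν * h
        νh = *-cancelˡ β≢0 (begin
          β * (h₂ - τ)                      ≡⟨ solve 3 (λ b h t → b :* (h :- t) := b :* h :- t :* b) refl β h₂ τ ⟩
          β * h₂ - τ * β                    ≡⟨ cong (_- τ * β) rel ⟨
          (κ * h + τ * β) * 1# - τ * β      ≡⟨ solve 3 (λ a b k → (a :+ b) :* :1 :- b := :1 :* a) refl (κ * h) (τ * β)
            κ ⟩
          1# * (κ * h)                      ≡⟨ cong (_* (κ * h)) (inv-r β≢0) ⟨
          β * inv β * (κ * h)               ≡⟨ solve 4 (λ b i k h → b :* i :* (k :* h) := b :* (k :* i :* h)) refl β
            (inv β) κ h ⟩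
          β * (ν * h) ∎)
          where open ≡-Reasoning
      ν∈Fr : InFr ν
      ν∈Fr = T-stable⇒Fr ν ν-stable
      c′≡βν : c′ ≡ c * (β * ν)
      c′≡βν = trans c′≡ (cong (c *_) (sym (trans (solve 3 (λ b k i → b :* (k :* i) := k :* (b :* i)) refl β κ (inv β))
        (trans (cong (κ *_) (inv-r β≢0)) (*-identityʳ κ)))))

  module RescaledDirs {c u c′ u′ : Carrier} (d : det c u ≢ 0#) (R : Rescaled c u c′ u′) where
    open Rescaled R
    private module B = Basis d

    ν∈K : InK ν
    ν∈K = Fr⊆K ν∈Fr

    comb-rescaled : ∀ h f → comb c′ u′ h f ≡ comb c u (ν * h + τ * f) f * β
    comb-rescaled h f = trans (cong₂ (λ s t → s * h + t * f) c′≡ u′≡)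
      (solve 7 (λ c u b n t h f → c :* (b :* n) :* h :+ (c :* (t :* b) :+ u :* b) :* f :=
        (c :* (n :* h :+ t :* f) :+ u :* f) :* b) refl c u β ν τ h f)

    det≢0 : det c′ u′ ≢ 0#
    det≢0 e = *-≢0 (*-≢0 (*-≢0 β≢0 ν≢0) β≢0) d (trans (sym detβ) e)
      where
      detβ : det c′ u′ ≡ β * ν * β * det c u
      detβ = trans (cong₂ det (trans c′≡ (solve 3 (λ c u a → c :* a := c :* a :+ u :* :0) refl c u (β * ν))) u′≡)
        (trans (det-comb c u (fixed-* frob-q β∈K ν∈K) 0∈Ks (fixed-* frob-q (T⊆K τ∈T) β∈K) β∈K)
          (cong (_* det c u) (solve 3 (λ b n t → b :* n :* b :- :0 :* (t :* b) := b :* n :* b) refl β ν τ)))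

    dirs⊆ : ∀ {s} → s ∈ dirsOf c′ u′ → s ∈ dirsOf c u
    dirs⊆ (here refl) = here (trans (cong slope c′≡) (slope-scale (fixed-* frob-q β∈K ν∈K) (*-≢0 β≢0 ν≢0) B.c≢0))
    dirs⊆ (there s∈) = let (h , h∈ , e) = ∈-map⁻ (λ h → slope (comb c′ u′ h 1#)) s∈ in
      subst (_∈ dirsOf c u) (sym e) (go (∈Ts⁻ h∈))
      where
      go : ∀ {h} → InT h → slope (comb c′ u′ h 1#) ∈ dirsOf c u
      go {h} hT = subst (_∈ dirsOf c u) (sym (trans (cong slope (comb-rescaled h 1#)) (slope-scale β∈K β≢0 nz)))
        (B.comb-slope newT (fixed-1 frob-r) nz)
        where
        newT : InT (ν * h + τ * 1#)
        newT = T-+ (T-Fr ν∈Fr hT) (subst InT (sym (*-identityʳ τ)) τ∈T)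
        nz : comb c u (ν * h + τ * 1#) 1# ≢ 0#
        nz = B.comb≢0 (T⊆K newT) 1∈K 1≢0

  open Peisert F q renaming (_∈ˢ_ to infix 4 _∈ˢ_; _≈ˢ_ to infix 4 _≈ˢ_)

  -- Cliques in Peisert-type graphs

  does⇒ : {A : Set} (d : Dec A) → does d ≡ true → A
  does⇒ (yes a) _ = a

  setOf : List Carrier → Subset
  setOf xs x = does (x ∈? xs)

  ∈setOf : ∀ {xs x} → x ∈ xs → x ∈ˢ setOf xs
  ∈setOf {xs} {x} = dec-true (x ∈? xs)

  ∈setOf⁻ : ∀ {xs x} → x ∈ˢ setOf xs → x ∈ xs
  ∈setOf⁻ {xs} {x} = does⇒ (x ∈? xs)

  ≈ˢ-from : ∀ {P Q : Subset} → (∀ x → x ∈ˢ P → x ∈ˢ Q) → (∀ x → x ∈ˢ Q → x ∈ˢ P) → P ≈ˢ Q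
  ≈ˢ-from {P} {Q} f g x with P x in eP | Q x in eQ
  ... | true | true = refl
  ... | false | false = refl
  ... | true | false = trans (sym (f x eP)) eQ
  ... | false | true = trans (sym eP) (g x eQ)

  ≈ˢ-⊆ : ∀ {P Q : Subset} → P ≈ˢ Q → ∀ {x} → x ∈ˢ P → x ∈ˢ Q
  ≈ˢ-⊆ e {x} p = trans (sym (e x)) p

  ≈ˢ-sym : ∀ {P Q : Subset} → P ≈ˢ Q → Q ≈ˢ P
  ≈ˢ-sym e x = sym (e x)

  ≈ˢ-trans : ∀ {P Q R : Subset} → P ≈ˢ Q → Q ≈ˢ R → P ≈ˢ R
  ≈ˢ-trans e f x = trans (e x) (f x)

  members : Subset → List Carrier
  members P = filterᵇ P elements

  members-unique : ∀ P → Unique (members P)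
  members-unique P = filter⁺ _ unique

  ∈members : ∀ P {x} → x ∈ˢ P → x ∈ members P
  ∈members P {x} e = ∈-filter⁺ (T? ∘ P) (complete x) (subst Bool.T (sym e) _)

  ∈members⁻ : ∀ P {x} → x ∈ members P → x ∈ˢ P
  ∈members⁻ P {x} x∈ = T⇒≡ (proj₂ (∈-filter⁻ (T? ∘ P) {xs = elements} x∈))
    where
    T⇒≡ : ∀ {b} → Bool.T b → b ≡ true
    T⇒≡ {true} _ = refl

  size-setOf : ∀ {xs} → Unique xs → size (setOf xs) ≡ length xs
  size-setOf {xs} u = unique-⊆-length-≡ (members-unique (setOf xs)) u (∈setOf⁻ ∘ ∈members⁻ (setOf xs))
    (∈members (setOf xs) ∘ ∈setOf)

  slopeSet : List Carrier → Subset
  slopeSet zs x = does (¬? (x ≟ 0#) ×-dec (slope x ∈? zs))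

  ∈slopeSet : ∀ {zs x} → x ≢ 0# → slope x ∈ zs → x ∈ˢ slopeSet zs
  ∈slopeSet {zs} {x} n s = dec-true (¬? (x ≟ 0#) ×-dec (slope x ∈? zs)) (n , s)

  ∈slopeSet⁻ : ∀ {zs x} → x ∈ˢ slopeSet zs → x ≢ 0# × slope x ∈ zs
  ∈slopeSet⁻ {zs} {x} = does⇒ (¬? (x ≟ 0#) ×-dec (slope x ∈? zs))

  IsSlope : Carrier → Set
  IsSlope z = ∃[ y ] (y ≢ 0# × z ≡ slope y)

  -- A coset of K* consists of the nonzero elements of one slope, so a connection set is handled as
  -- a list of m slopes instead of a family of representatives.
  record SlopeForm (m : ℕ) (S : Subset) : Set where
    field
      m≤q : m ≤ q
      zs : List Carrier
      zs-length : length zs ≡ m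
      zs-unique : Unique zs
      zs-slopes : ∀ {z} → z ∈ zs → IsSlope z
      S⇒ : ∀ {x} → x ∈ˢ S → x ≢ 0# × slope x ∈ zs
      S⇐ : ∀ {x} → x ≢ 0# → slope x ∈ zs → x ∈ˢ S

  coset-slope : ∀ {c x} → c ≢ 0# → InCoset c x → x ≢ 0# × slope x ≡ slope c
  coset-slope c≢0 (t , (tK , t≢0) , refl) = *-≢0 c≢0 t≢0 , slope-scale (fixed tK) t≢0 c≢0

  slope-coset : ∀ {c x} → c ≢ 0# → x ≢ 0# → slope c ≡ slope x → InCoset c x
  slope-coset {c} {x} c≢0 x≢0 e = inv c * x , (eq (slope-quotient c≢0 x≢0 e) , *-≢0 (inv≢0 c≢0) x≢0) ,
    sym (*-inv-* x c≢0)

  slope⇒SameCoset : ∀ {c d} → c ≢ 0# → d ≢ 0# → slope c ≡ slope d → SameCoset c d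
  slope⇒SameCoset {c} {d} c≢0 d≢0 e x = mk⇔
    (λ xc → let (x≢0 , sx) = coset-slope c≢0 xc in slope-coset d≢0 x≢0 (trans (sym e) (sym sx)))
    (λ xd → let (x≢0 , sx) = coset-slope d≢0 xd in slope-coset c≢0 x≢0 (trans e (sym sx)))

  slopeForm : ∀ {m S} → PeisertType m S → SlopeForm m S
  slopeForm {m} {S} (m≤ , c , c≢0 , distinct , iff) = record
    { m≤q = m≤
    ; zs = zs
    ; zs-length = length-tabulate (slope ∘ c)
    ; zs-unique = tabulate⁺ (λ {i} {j} e → distinct i j (slope⇒SameCoset (c≢0 i) (c≢0 j) e))
    ; zs-slopes = λ z∈ → let (i , e) = ∈-tabulate⁻ z∈ in c i , c≢0 i , e
    ; S⇒ = λ {x} x∈ → let (i , xi) = Equivalence.to (iff x) x∈ ; (x≢0 , sx) = coset-slope (c≢0 i) xi in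
        x≢0 , subst (_∈ zs) (sym sx) (∈-tabulate⁺ {f = slope ∘ c} i)
    ; S⇐ = λ {x} x≢0 s∈ → let (i , e) = ∈-tabulate⁻ s∈ in Equivalence.from (iff x) (i , slope-coset (c≢0 i) x≢0 (sym e))
    }
    where
    zs = tabulate (slope ∘ c)

  lookup-injective : ∀ {xs : List Carrier} → Unique xs → ∀ i j → lookup xs i ≡ lookup xs j → i ≡ j
  lookup-injective {x ∷ xs} (x∉ ∷ u) Fin.zero Fin.zero _ = refl
  lookup-injective {x ∷ xs} (x∉ ∷ u) Fin.zero (Fin.suc j) e = ⊥-elim (All.lookup x∉ (∈-lookup j) e)
  lookup-injective {x ∷ xs} (x∉ ∷ u) (Fin.suc i) Fin.zero e = ⊥-elim (All.lookup x∉ (∈-lookup i) (sym e))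
  lookup-injective {x ∷ xs} (x∉ ∷ u) (Fin.suc i) (Fin.suc j) e = cong Fin.suc (lookup-injective u i j e)

  lookup-index : ∀ {xs : List Carrier} {x} → x ∈ xs → ∃[ i ] (x ≡ lookup xs i)
  lookup-index x∈ = Any.index x∈ , Anyₚ.lookup-index x∈

  slopeSet-PeisertType : ∀ zs → length zs ≤ q → Unique zs → (∀ {z} → z ∈ zs → IsSlope z) →
    PeisertType (length zs) (slopeSet zs)
  slopeSet-PeisertType zs le u sl = le , c , c≢0 , distinct , λ x → mk⇔ (to x) (from x)
    where
    rep : ∀ i → IsSlope (lookup zs i)
    rep i = sl (∈-lookup i)
    c : Fin (length zs) → Carrier
    c i = proj₁ (rep i)
    c≢0 : ∀ i → c i ≢ 0#
    c≢0 i = proj₁ (proj₂ (rep i))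
    c-slope : ∀ i → lookup zs i ≡ slope (c i)
    c-slope i = proj₂ (proj₂ (rep i))
    distinct : ∀ i j → SameCoset (c i) (c j) → i ≡ j
    distinct i j same = lookup-injective u i j
      (trans (c-slope i) (trans (proj₂
      (coset-slope (c≢0 j) (Equivalence.to (same (c i)) (slope-coset (c≢0 i) (c≢0 i) refl)))) (sym (c-slope j))))
    to : ∀ x → x ∈ˢ slopeSet zs → ∃[ i ] InCoset (c i) x
    to x x∈ = let (x≢0 , s∈) = ∈slopeSet⁻ {zs} x∈ ; (i , e) = lookup-index s∈ in i ,
      slope-coset (c≢0 i) x≢0 (trans (sym (c-slope i)) (sym e))
    from : ∀ x → ∃[ i ] InCoset (c i) x → x ∈ˢ slopeSet zs
    from x (i , xi) = let (x≢0 , sx) = coset-slope (c≢0 i) xi in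
      ∈slopeSet {zs} x≢0 (subst (_∈ zs) (trans (c-slope i) (sym sx)) (∈-lookup i))

  line : Carrier → List Carrier
  line y = map (y *_) Ks

  line-unique : ∀ {y} → y ≢ 0# → Unique (line y)
  line-unique y≢0 = map⁺ (*-cancelˡ y≢0) Ks-unique

  length-line : ∀ y → length (line y) ≡ q
  length-line y = trans (length-map (y *_) Ks) length-Ks

  ∈line : ∀ {y t} → InK t → y * t ∈ line y
  ∈line {y} tK = ∈-map⁺ (y *_) (∈Ks tK)

  ∈line⁻ : ∀ {y x} → x ∈ line y → ∃[ t ] (InK t × x ≡ y * t)
  ∈line⁻ {y} x∈ = let (t , t∈ , e) = ∈-map⁻ (y *_) x∈ in t , ∈Ks⁻ t∈ , e

  module InSlopeForm {m : ℕ} {S : Subset} (sf : SlopeForm m S) where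
    open SlopeForm sf

    free-slope : ∃[ y ] (y ≢ 0# × slope y ∉ zs)
    free-slope = by-cases (any? (λ z → ¬? (z ∈? zs)) slopes)
      where
      by-cases : Dec (Any (λ z → z ∉ zs) slopes) → ∃[ y ] (y ≢ 0# × slope y ∉ zs)
      by-cases (yes a) = let (z , z∈ , z∉) = find a ; (y , y≢0 , e) = ∈-slopes⁻ z∈ in y , y≢0 , subst (_∉ zs) e z∉
      by-cases (no ¬a) = ⊥-elim (ℕₚ.<⇒≱ (ℕₚ.≤-<-trans (subst (_≤ q) (sym zs-length) m≤q) q<slopes)
        (unique-⊆-length slopes-unique (λ {z} z∈ → in-zs z z∈ (z ∈? zs))))
        where
        in-zs : ∀ z → z ∈ slopes → Dec (z ∈ zs) → z ∈ zs
        in-zs z z∈ (yes p) = p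
        in-zs z z∈ (no n) = ⊥-elim (¬a (lose z∈ n))

    -- As m ≤ q, some slope is missing from S; projecting along it is injective on a clique and
    -- lands among the at most q roots of one X^q - ζX.
    clique-bound : ∀ C → IsClique S C → size C ≤ q
    clique-bound C clique = subst (_≤ q) (length-map (π z) (members C))
      (eigen-bound (- (z ^ q)) (map-unique-on (π z) inj (members-unique C)) eigen)
      where
      y = proj₁ free-slope
      y≢0 = proj₁ (proj₂ free-slope)
      z = slope y
      z∉ = proj₂ (proj₂ free-slope)
      inj : ∀ {u v} → u ∈ members C → v ∈ members C → π z u ≡ π z v → u ≡ v
      inj {u} {v} u∈ v∈ e = by-cases (u ≟ v)
        where
        by-cases : Dec (u ≡ v) → u ≡ v
        by-cases (yes eq) = eq
        by-cases (no ne) = ⊥-elim (z∉ (subst (_∈ zs) (π-slope ne e)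
          (proj₂ (S⇒ (clique u v (∈members⁻ C u∈) (∈members⁻ C v∈) ne)))))
      eigen : ∀ {v} → v ∈ map (π z) (members C) → v ^ q ≡ - (z ^ q) * v
      eigen v∈ = let (u , _ , e) = ∈-map⁻ (π z) v∈ in subst (λ v → v ^ q ≡ - (z ^ q) * v) (sym e)
        (π-eigen u (slope-^q y≢0))

    difference-clique : ∀ xs → (∀ {x y} → x ∈ xs → y ∈ xs → x - y ∈ xs) → (∀ {x} → x ∈ xs → x ≢ 0# → slope x ∈ zs) →
      IsClique S (setOf xs)
    difference-clique xs diff dirs x y x∈ y∈ x≢y = S⇐ (x≢y ∘ -‿≡0) (dirs (diff (∈setOf⁻ x∈) (∈setOf⁻ y∈)) (x≢y ∘ -‿≡0))

    q-clique-max : ∀ C → IsClique S C → size C ≡ q → IsMaxClique S C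
    q-clique-max C cl sz = cl , λ D clD → subst (size D ≤_) (sym sz) (clique-bound D clD)

    line-clique : ∀ {y} → y ≢ 0# → slope y ∈ zs → IsMaxClique S (setOf (line y))
    line-clique {y} y≢0 s∈ = q-clique-max (setOf (line y)) (difference-clique (line y) diff dirs)
      (trans (size-setOf (line-unique y≢0)) (length-line y))
      where
      diff : ∀ {a b} → a ∈ line y → b ∈ line y → a - b ∈ line y
      diff a∈ b∈ = let (s , sK , e) = ∈line⁻ a∈ ; (t , tK , e′) = ∈line⁻ b∈ in
        subst (_∈ line y) (trans (solve 3 (λ y s t → y :* (s :- t) := y :* s :- y :* t) refl y s t)
          (sym (cong₂ _-_ e e′))) (∈line (fixed-+ frob-q sK (fixed-neg frob-q tK)))
      dirs : ∀ {a} → a ∈ line y → a ≢ 0# → slope a ∈ zs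
      dirs a∈ a≢0 = let (s , sK , e) = ∈line⁻ a∈ in
        subst (λ a → slope a ∈ zs) (sym e)
          (subst (_∈ zs) (sym (slope-scale sK (λ s0 → a≢0 (trans e (trans (cong (y *_) s0) (zeroʳ y)))) y≢0)) s∈)

    max-size : 1 ≤ m → ∀ C → IsMaxClique S C → size C ≡ q
    max-size 1≤m C (cl , mx) = ℕₚ.≤-antisym (clique-bound C cl) (by-zs zs refl)
      where
      by-zs : ∀ ws → ws ≡ zs → q ≤ size C
      by-zs [] e = ⊥-elim (ℕₚ.<⇒≢ 1≤m (trans (cong length e) zs-length))
      by-zs (z ∷ _) e = let z∈ = subst (z ∈_) e (here refl) ; (y , y≢0 , ez) = zs-slopes z∈ ; L = line-clique y≢0 (subst (_∈ zs) ez z∈) in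
        subst (_≤ size C) (trans (size-setOf (line-unique y≢0)) (length-line y)) (mx (setOf (line y)) (proj₁ L))

    -- The clique contains 0, ch and u. If all of them lay on one translate of a K-line, ch and u
    -- would be dependent over K.
    not-canonical : ∀ {c u} → det c u ≢ 0# → ¬ IsCanonical S (setOf (clubClique c u))
    not-canonical {c} {u} d (x , c′ , _ , iff) = *-≢0 h≢0 d (trans (sym (det-comb-u c u (T⊆K hT) 0∈Ks)) dependent)
      where
      module B = Basis d
      h = proj₁ T-nonzero
      hT = proj₁ (proj₂ T-nonzero)
      h≢0 = proj₂ (proj₂ T-nonzero)
      point : ∀ {h f} → InT h → InFr f → ∃[ t ] (InK t × comb c u h f ≡ x + c′ * t)
      point hT fF = let (t , tK , e) = Equivalence.to (iff _) (∈setOf (B.∈-clubClique hT fF)) in t , fixed tK , e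
      0pt = point T-0 (fixed-0 frob-r)
      diff : ∀ {h f} (hT : InT h) (fF : InFr f) → comb c u h f ≡ c′ * (proj₁ (point hT fF) - proj₁ 0pt)
      diff {h} {f} hT fF = trans (solve 4 (λ c u h f → c :* h :+ u :* f := (c :* h :+ u :* f) :- (c :* :0 :+ u :* :0))
        refl c u h f)
        (trans (cong₂ _-_ (proj₂ (proj₂ (point hT fF))) (proj₂ (proj₂ 0pt)))
          (solve 4 (λ x c s t → (x :+ c :* s) :- (x :+ c :* t) := c :* (s :- t)) refl x c′ _ _))
      diffK : ∀ {h f} (hT : InT h) (fF : InFr f) → InK (proj₁ (point hT fF) - proj₁ 0pt)
      diffK hT fF = fixed-+ frob-q (proj₁ (proj₂ (point hT fF))) (fixed-neg frob-q (proj₁ (proj₂ 0pt)))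
      dependent : det (comb c u h 0#) u ≡ 0#
      dependent = begin
        det (comb c u h 0#) u      ≡⟨ cong₂ det (trans (diff hT (fixed-0 frob-r)) (pad _))
          (trans (solve 2 (λ c u → u := c :* :0 :+ u :* :1) refl c u) (trans (diff T-0 (fixed-1 frob-r)) (pad _))) ⟩
        det (comb c′ 0# s 0#) (comb c′ 0# t 0#)  ≡⟨ det-comb c′ 0# (diffK hT (fixed-0 frob-r)) 0∈Ks
          (diffK T-0 (fixed-1 frob-r)) 0∈Ks ⟩
        (s * 0# - 0# * t) * det c′ 0#            ≡⟨ solve 3 (λ s t e → (s :* :0 :- :0 :* t) :* e := :0) refl s t
          (det c′ 0#) ⟩
        0# ∎
        where
        open ≡-Reasoning
        s = proj₁ (point hT (fixed-0 frob-r)) - proj₁ 0pt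
        t = proj₁ (point T-0 (fixed-1 frob-r)) - proj₁ 0pt
        pad : ∀ s → c′ * s ≡ comb c′ 0# s 0#
        pad s = solve 2 (λ c s → c :* s := c :* s :+ :0 :* :0) refl c′ s

    club-NonCanonical : ∀ {c u} → det c u ≢ 0# → (∀ {s} → s ∈ dirsOf c u → s ∈ zs) →
      IsNonCanonical S (setOf (clubClique c u))
    club-NonCanonical {c} {u} d ⊆zs = q-clique-max (setOf (clubClique c u))
        (difference-clique (clubClique c u) (Basis.clubClique-- d) (λ x∈ x≢0 → ⊆zs (Basis.clubClique-slope d x∈ x≢0)))
        (trans (size-setOf (Basis.clubClique-unique d)) (Basis.length-clubClique d)) , not-canonical d

    record ClubAt (C : Subset) (x₀ : Carrier) : Set where
      field
        c u : Carrier
        det≢0 : det c u ≢ 0#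
        C⇒ : ∀ {x} → x ∈ˢ C → x - x₀ ∈ clubClique c u
        C⇐ : ∀ {x} → x - x₀ ∈ clubClique c u → x ∈ˢ C
        m≡ : m ≡ suc (r ℕ.* r)
        S≈ : S ≈ˢ slopeSet (dirsOf c u)

    -- After translation by x₀ the clique is an 𝔽_r-subspace by `Direction` and hence a line or a
    -- club by `Structure`. A club brings r² + 1 slopes of its own, so m can be no smaller and S has
    -- no others.
    classify : 1 ≤ m → m ≤ suc (r ℕ.* r) → ∀ C → IsMaxClique S C → ∀ x₀ → x₀ ∈ˢ C → IsCanonical S C ⊎ ClubAt C x₀
    classify 1≤m m≤rr C mx x₀ x₀∈ = by-cases (Structure.line-or-club us us-unique length-us 0∈us sub zs few us-slopes)
      where
      us = map (_- x₀) (members C)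
      us-unique : Unique us
      us-unique = map⁺ (λ {a} {b} e →
        -‿≡0 (trans (solve 3 (λ a b x → a :- b := (a :- x) :- (b :- x)) refl a b x₀) (≡⇒-‿0 e))) (members-unique C)
      length-us : length us ≡ q
      length-us = trans (length-map (_- x₀) (members C)) (max-size 1≤m C mx)
      ∈us : ∀ {x} → x ∈ˢ C → x - x₀ ∈ us
      ∈us x∈ = ∈-map⁺ (_- x₀) (∈members C x∈)
      ∈us⁻ : ∀ {x} → x ∈ us → x + x₀ ∈ˢ C
      ∈us⁻ x∈ = let (a , a∈ , e) = ∈-map⁻ (_- x₀) x∈ in
        subst (_∈ˢ C) (trans (solve 2 (λ a x → a := (a :- x) :+ x) refl a x₀) (cong (_+ x₀) (sym e))) (∈members⁻ C a∈)
      0∈us : 0# ∈ us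
      0∈us = subst (_∈ us) (-‿inverseʳ x₀) (∈us x₀∈)
      us-dirs : ∀ {u v} → u ∈ us → v ∈ us → u ≢ v → slope (u - v) ∈ zs
      us-dirs {u} {v} u∈ v∈ u≢v = subst (λ t → slope t ∈ zs) (solve 3 (λ u v x → (u :+ x) :- (v :+ x) := u :- v) refl u
        v x₀)
        (proj₂ (S⇒ (proj₁ mx _ _ (∈us⁻ u∈) (∈us⁻ v∈) λ e →
          u≢v (-‿≡0 (trans (solve 3 (λ u v x → u :- v := (u :+ x) :- (v :+ x)) refl u v x₀) (≡⇒-‿0 e))))))
      few : length zs ≤ suc (r ℕ.* r)
      few = subst (_≤ suc (r ℕ.* r)) (sym zs-length) m≤rr
      sub : RSubspace us
      sub = Direction.us-RSubspace us us-unique length-us 0∈us zs few us-dirs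
      us-slopes : ∀ {x} → x ∈ us → x ≢ 0# → slope x ∈ zs
      us-slopes {x} x∈ x≢0 = subst (λ t → slope t ∈ zs) (solve 1 (λ x → x :- :0 := x) refl x) (us-dirs x∈ 0∈us x≢0)
      shift : ∀ x → x - x₀ + x₀ ≡ x
      shift x = solve 2 (λ x y → x :- y :+ y := x) refl x x₀
      by-cases : _ → IsCanonical S C ⊎ ClubAt C x₀
      by-cases (inj₁ (c , c≢0 , s∈ , us⊆)) = inj₁ (x₀ , c , S⇐ c≢0 s∈ , λ y → mk⇔ (to y) (from y))
        where
        us⊆line : ∀ {x} → x ∈ us → x ∈ line c
        us⊆line x∈ = let (t , tK , e) = us⊆ x∈ in subst (_∈ line c) (sym e) (∈line tK)
        line⊆us : ∀ {x} → x ∈ line c → x ∈ us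
        line⊆us = unique-⊆-full _≟_ us-unique us⊆line (ℕₚ.≤-reflexive (trans (length-line c) (sym length-us)))
        to : ∀ y → y ∈ˢ C → ∃[ t ] (InFq t × y ≡ x₀ + c * t)
        to y y∈ = let (t , tK , e) = us⊆ (∈us y∈) in t , eq tK ,
          trans (sym (shift y)) (trans (+-comm _ _) (cong (x₀ +_) e))
        from : ∀ y → ∃[ t ] (InFq t × y ≡ x₀ + c * t) → y ∈ˢ C
        from y (t , tK , e) = subst (_∈ˢ C) (trans (+-comm _ _) (sym e)) (∈us⁻ (line⊆us (∈line (fixed tK))))
      by-cases (inj₂ (c , u , d , us⊆ , us⊇)) = inj₂ record
        { c = c ; u = u ; det≢0 = d ; C⇒ = us⊆ ∘ ∈us ; C⇐ = λ {x} x∈ → subst (_∈ˢ C) (shift x) (∈us⁻ (us⊇ x∈))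
        ; m≡ = ℕₚ.≤-antisym m≤rr (subst₂ _≤_ B.length-dirsOf zs-length (unique-⊆-length B.dirsOf-unique dirs⊆))
        ; S≈ = ≈ˢ-from (λ x x∈ → let (x≢0 , s∈) = S⇒ x∈ in ∈slopeSet x≢0 (dirs⊇ s∈))
          (λ x x∈ → let (x≢0 , s∈) = ∈slopeSet⁻ x∈ in S⇐ x≢0 (dirs⊆ s∈)) }
        where
        module B = Basis d
        dirs⊆ : ∀ {s} → s ∈ dirsOf c u → s ∈ zs
        -- The head c itself need not lie in the clique, so its slope is taken from ch with h
        -- nonzero in T.
        dirs⊆ (here refl) = let (h , hT , h≢0) = T-nonzero in
          subst (_∈ zs) (slope-scale (T⊆K hT) h≢0 B.c≢0)
            (us-slopes (us⊇ (subst (_∈ clubClique c u) (solve 3 (λ c u h → c :* h :+ u :* :0 := c :* h) refl c u h)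
            (B.∈-clubClique hT (fixed-0 frob-r)))) (*-≢0 B.c≢0 h≢0))
        dirs⊆ (there s∈) = let (h , h∈ , e) = ∈-map⁻ (λ h → slope (comb c u h 1#)) s∈ in
          subst (_∈ zs) (sym e) (us-slopes (us⊇ (B.∈-clubClique (∈Ts⁻ h∈) (fixed-1 frob-r)))
            (B.comb≢0 (T⊆K (∈Ts⁻ h∈)) 1∈K 1≢0))
        dirs⊇ : ∀ {s} → s ∈ zs → s ∈ dirsOf c u
        dirs⊇ = unique-⊆-full _≟_ B.dirsOf-unique dirs⊆ (ℕₚ.≤-trans few (ℕₚ.≤-reflexive (sym B.length-dirsOf)))

  -- Counting the extremal graphs

  nonempty-max : ∀ {m S} → SlopeForm m S → 1 ≤ m → ∀ C → IsMaxClique S C → ∃[ x ] (x ∈ˢ C)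
  nonempty-max sf 1≤m C mx = go (members C) (λ x∈ → ∈members⁻ C x∈)
    (subst (0 <_) (sym (InSlopeForm.max-size sf 1≤m C mx)) 0<q)
    where
    go : ∀ xs → (∀ {x} → x ∈ xs → x ∈ˢ C) → 0 < length xs → ∃[ x ] (x ∈ˢ C)
    go (x ∷ _) f _ = x , f (here refl)

  ∈-take-++ : ∀ (xs : List Carrier) {ys : List Carrier} {n s} → length xs ≤ n → s ∈ xs → s ∈ take n (xs ++ ys)
  ∈-take-++ (x ∷ xs) {n = suc n} (s≤s le) (here e) = here e
  ∈-take-++ (x ∷ xs) {n = suc n} (s≤s le) (there p) = there (∈-take-++ xs le p)

  club : Carrier → Carrier → Subset
  club c u = slopeSet (dirsOf c u)

  module _ {c u : Carrier} (d : det c u ≢ 0#) where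
    private module B = Basis d

    dirsOf-slopes : ∀ {s} → s ∈ dirsOf c u → IsSlope s
    dirsOf-slopes (here e) = c , B.c≢0 , e
    dirsOf-slopes (there s∈) = let (h , h∈ , e) = ∈-map⁻ (λ h → slope (comb c u h 1#)) s∈ in
      comb c u h 1# , B.comb≢0 (T⊆K (∈Ts⁻ h∈)) 1∈K 1≢0 , e

    club-PeisertType : PeisertType (suc (r ℕ.* r)) (club c u)
    club-PeisertType = subst (λ m → PeisertType m (club c u)) B.length-dirsOf
      (slopeSet-PeisertType (dirsOf c u) (subst (_≤ q) (sym B.length-dirsOf) rr<q) B.dirsOf-unique dirsOf-slopes)

    superset-not-EKR : ∀ {m S} (sf : SlopeForm m S) → (∀ {s} → s ∈ dirsOf c u → s ∈ SlopeForm.zs sf) → ¬ StrictEKR S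
    superset-not-EKR sf ⊆zs ekr = let (mx , nc) = InSlopeForm.club-NonCanonical sf d ⊆zs in nc (ekr _ mx)

    slopeForm-club⊆ : ∀ {m S} (sf : SlopeForm m S) → (∀ {x} → x ∈ˢ club c u → x ∈ˢ S) → ∀ {s} → s ∈ dirsOf c u →
      s ∈ SlopeForm.zs sf
    slopeForm-club⊆ sf sub s∈ = let (y , y≢0 , e) = dirsOf-slopes s∈ in
      subst (_∈ SlopeForm.zs sf) (sym e)
        (proj₂ (SlopeForm.S⇒ sf (sub (∈slopeSet {dirsOf c u} y≢0 (subst (_∈ dirsOf c u) e s∈)))))

    club-not-EKR : ¬ StrictEKR (club c u)
    club-not-EKR = superset-not-EKR (slopeForm club-PeisertType)
      (slopeForm-club⊆ (slopeForm club-PeisertType) (λ x∈ → x∈))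

    -- Beyond r² + 1 cosets the strict-EKR property already fails one coset earlier: enlarge a club.
    large-not-EKR : ∀ n → suc (r ℕ.* r) ≤ n → n ≤ q → ∃[ S ] (PeisertType n S × ¬ StrictEKR S)
    large-not-EKR n lo hi = slopeSet zs , pt , superset-not-EKR (slopeForm pt) λ s∈ → in-zs s∈
      where
      others = filter (λ z → ¬? (z ∈? dirsOf c u)) slopes
      all = dirsOf c u ++ others
      all-unique : Unique all
      all-unique = ++⁺ B.dirsOf-unique (filter⁺ _ slopes-unique)
        (λ (p , p′) → proj₂ (∈-filter⁻ (λ z → ¬? (z ∈? dirsOf c u)) {xs = slopes} p′) p)
      all-slope : ∀ {z} → z ∈ all → IsSlope z
      all-slope z∈ with ∈-++⁻ (dirsOf c u) z∈
      ... | inj₁ p = dirsOf-slopes p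
      ... | inj₂ p = ∈-slopes⁻ (proj₁ (∈-filter⁻ (λ z → ¬? (z ∈? dirsOf c u)) {xs = slopes} p))
      n≤all : n ≤ length all
      n≤all = begin
        n                                                ≤⟨ hi ⟩
        q                                                ≤⟨ ℕₚ.<⇒≤ q<slopes ⟩
        length slopes                                    ≡⟨ filter-count (_∈? dirsOf c u) slopes ⟨
        length (filter (_∈? dirsOf c u) slopes) ℕ.+ length others  ≤⟨ ℕₚ.+-monoˡ-≤ (length others)
          (unique-⊆-length (filter⁺ _ slopes-unique) (λ z∈ → proj₂ (∈-filter⁻ (_∈? dirsOf c u) {xs = slopes} z∈))) ⟩
        length (dirsOf c u) ℕ.+ length others            ≡⟨ length-++ (dirsOf c u) ⟨
        length all ∎
        where open ℕₚ.≤-Reasoning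
      zs = take n all
      zs-length : length zs ≡ n
      zs-length = trans (length-take n all) (ℕₚ.m≤n⇒m⊓n≡m n≤all)
      ∈take⁻ : ∀ n (xs : List Carrier) {z} → z ∈ take n xs → z ∈ xs
      ∈take⁻ (suc n) (x ∷ xs) (here e) = here e
      ∈take⁻ (suc n) (x ∷ xs) (there p) = there (∈take⁻ n xs p)
      pt : PeisertType n (slopeSet zs)
      pt = subst (λ m → PeisertType m (slopeSet zs)) zs-length
        (slopeSet-PeisertType zs (subst (_≤ q) (sym zs-length) hi) (take⁺ n all-unique)
        (λ z∈ → all-slope (∈take⁻ n all z∈)))
      in-zs : ∀ {s} → s ∈ dirsOf c u → s ∈ SlopeForm.zs (slopeForm pt)
      in-zs s∈ = let (y , y≢0 , e) = dirsOf-slopes s∈ in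
        subst (_∈ SlopeForm.zs (slopeForm pt)) (sym e) (proj₂ (SlopeForm.S⇒ (slopeForm pt) (∈slopeSet {zs} y≢0
          (subst (_∈ zs) e (∈-take-++ (dirsOf c u) (subst (_≤ n) (sym B.length-dirsOf) lo) s∈)))))

    -- With r² cosets the classification leaves only canonical cliques, because a club would force m
    -- = r² + 1.
    club-Extremal : Extremal (club c u)
    club-Extremal = r ℕ.* r , club-PeisertType , club-not-EKR , below
      where
      below : ∀ S′ → PeisertType (r ℕ.* r) S′ → StrictEKR S′
      below S′ pt C mx = by-cases (InSlopeForm.classify sf 1≤rr (ℕₚ.n≤1+n _) C mx (proj₁ ne) (proj₂ ne))
        where
        sf = slopeForm pt
        1≤rr : 1 ≤ r ℕ.* r
        1≤rr = ℕₚ.*-mono-≤ (pw>0 k) (pw>0 k)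
        ne = nonempty-max sf 1≤rr C mx
        by-cases : IsCanonical S′ C ⊎ InSlopeForm.ClubAt sf C (proj₁ ne) → IsCanonical S′ C
        by-cases (inj₁ can) = can
        by-cases (inj₂ cl) = ⊥-elim (ℕₚ.<⇒≢ (ℕₚ.n<1+n (r ℕ.* r)) (InSlopeForm.ClubAt.m≡ cl))

  validFor : Carrier → List Carrier
  validFor c = filter (λ u → ¬? (det c u ≟ 0#)) elements

  -- The ordered bases of F over K, (q² - 1)(q² - q) in number.
  pairs : List (Carrier × Carrier)
  pairs = pairsWith validFor elements*

  pairs⁻ : ∀ {c u} → (c , u) ∈ pairs → det c u ≢ 0#
  pairs⁻ {c} cu∈ = proj₂ (∈-filter⁻ (λ u → ¬? (det c u ≟ 0#)) {xs = elements}
    (proj₂ (∈-pairsWith⁻ validFor {elements*} cu∈)))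

  pairs⁺ : ∀ {c u} → det c u ≢ 0# → (c , u) ∈ pairs
  pairs⁺ {c} {u} d = ∈-pairsWith⁺ validFor (∈* (det≢0ˡ d)) (∈-filter⁺ (λ u → ¬? (det c u ≟ 0#)) (complete u) d)

  pairs-unique : Unique pairs
  pairs-unique = pairsWith-unique validFor (λ c → filter⁺ _ unique) unique*

  length-validFor : ∀ {c} → c ≢ 0# → length (validFor c) ℕ.+ q ≡ order
  length-validFor {c} c≢0 = trans (ℕₚ.+-comm _ q) (trans (cong (ℕ._+ length (validFor c)) (sym len-dep))
    (filter-count (λ u → det c u ≟ 0#) elements))
    where
    dependent : ∀ {u} → det c u ≡ 0# → u ∈ line c
    dependent {u} e = by-cases (u ≟ 0#)
      where
      by-cases : Dec (u ≡ 0#) → u ∈ line c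
      by-cases (yes u0) = subst (_∈ line c) (trans (zeroʳ c) (sym u0)) (∈line 0∈Ks)
      by-cases (no u≢0) = subst (_∈ line c) (*-inv-* u c≢0) (∈line (slope-quotient c≢0 u≢0 (det0⇒slope≡ c≢0 u≢0 e)))
    len-dep : length (filter (λ u → det c u ≟ 0#) elements) ≡ q
    len-dep = trans (unique-⊆-length-≡ (filter⁺ _ unique) (line-unique c≢0)
      (λ u∈ → dependent (proj₂ (∈-filter⁻ (λ u → det c u ≟ 0#) {xs = elements} u∈)))
      (λ {u} u∈ → ∈-filter⁺ (λ u → det c u ≟ 0#) (complete u) (on-line u∈))) (length-line c)
      where
      on-line : ∀ {u} → u ∈ line c → det c u ≡ 0#
      on-line u∈ = let (t , tK , e) = ∈line⁻ u∈ in
        trans (cong (det c) (trans e (solve 2 (λ c t → c :* t := c :* t :+ :0 :* :0) refl c t)))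
        (trans (det-c-comb c 0# tK 0∈Ks) (zeroˡ _))

  some-pair : ∃[ c ] ∃[ u ] (det c u ≢ 0#)
  some-pair = go (validFor 1#) (λ u∈ → proj₂ (∈-filter⁻ (λ u → ¬? (det 1# u ≟ 0#)) {xs = elements} u∈)) refl
    where
    go : ∀ us → (∀ {u} → u ∈ us → det 1# u ≢ 0#) → us ≡ validFor 1# → ∃[ c ] ∃[ u ] (det c u ≢ 0#)
    go (u ∷ _) f _ = 1# , u , f (here refl)
    go [] _ e = ⊥-elim (ℕₚ.<⇒≢ q<order (trans (cong (λ us → length us ℕ.+ q) e) (length-validFor 1≢0)))

  ≈ˢ? : ∀ P Q → Dec (P ≈ˢ Q)
  ≈ˢ? P Q with All.all? (λ x → P x Bool.≟ Q x) elements
  ... | yes a = yes λ x → All.lookup a (complete x)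
  ... | no ¬a = no λ e → ¬a (All.tabulate (λ {x} _ → e x))

  -- A failure of strict-EKR hands over no clique, so a club equal to P is sought among finitely
  -- many bases. If none fits and m ≤ r² + 1, `classify` proves strict-EKR for P; if m is larger,
  -- `large-not-EKR` contradicts the condition one coset lower.
  extremal⇒club : ∀ {P} → Extremal P → ∃[ c ] ∃[ u ] (det c u ≢ 0# × P ≈ˢ club c u)
  extremal⇒club {P} (n , pt , notEKR , below) = search (any? (λ (c , u) → ≈ˢ? P (club c u)) pairs)
    where
    search : Dec (Any (λ (c , u) → P ≈ˢ club c u) pairs) → ∃[ c ] ∃[ u ] (det c u ≢ 0# × P ≈ˢ club c u)
    search (yes a) = let ((c , u) , cu∈ , e) = find a in c , u , pairs⁻ cu∈ , e
    search (no none) = ⊥-elim (by-size (suc n ℕ.≤? suc (r ℕ.* r)))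
      where
      sf = slopeForm pt
      by-size : Dec (suc n ≤ suc (r ℕ.* r)) → ⊥
      by-size (yes le) = notEKR ekr
        where
        ekr : StrictEKR P
        ekr C mx = by-cases (InSlopeForm.classify sf (s≤s z≤n) le C mx (proj₁ ne) (proj₂ ne))
          where
          ne = nonempty-max sf (s≤s z≤n) C mx
          by-cases : IsCanonical P C ⊎ InSlopeForm.ClubAt sf C (proj₁ ne) → IsCanonical P C
          by-cases (inj₁ can) = can
          by-cases (inj₂ cl) = ⊥-elim (none (lose (pairs⁺ (InSlopeForm.ClubAt.det≢0 cl)) (InSlopeForm.ClubAt.S≈ cl)))
      by-size (no gt) = let (S , ptS , notS) = large-not-EKR (proj₂ (proj₂ some-pair)) n (ℕₚ.≤-pred (ℕₚ.≰⇒> gt)) (ℕₚ.≤-trans (ℕₚ.n≤1+n n) (proj₁ pt)) in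
        notS (below S ptS)

  private
    _SameClub_ : Carrier × Carrier → Carrier × Carrier → Set
    (c , u) SameClub (c′ , u′) = club c u ≈ˢ club c′ u′

    _sameClub?_ : ∀ x y → Dec (x SameClub y)
    (c , u) sameClub? (c′ , u′) = ≈ˢ? (club c u) (club c′ u′)

  club≈⇒dirs⊆ : ∀ {c u c′ u′} → det c′ u′ ≢ 0# → club c u ≈ˢ club c′ u′ → ∀ {s} → s ∈ dirsOf c′ u′ → s ∈ dirsOf c u
  club≈⇒dirs⊆ {c} {u} {c′} {u′} d′ e s∈ = let (y , y≢0 , es) = dirsOf-slopes d′ s∈ in
    subst (_∈ dirsOf c u) (sym es) (proj₂
      (∈slopeSet⁻ {dirsOf c u} (≈ˢ-⊆ (≈ˢ-sym {club c u} {club c′ u′} e)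
      (∈slopeSet {dirsOf c′ u′} y≢0 (subst (_∈ dirsOf c′ u′) es s∈)))))

  dirs⊆⇒club≈ : ∀ {c u c′ u′} → det c u ≢ 0# → det c′ u′ ≢ 0# → (∀ {s} → s ∈ dirsOf c′ u′ → s ∈ dirsOf c u) →
    club c u ≈ˢ club c′ u′
  dirs⊆⇒club≈ {c} {u} {c′} {u′} d d′ sub = ≈ˢ-from
    (λ x x∈ → let (x≢0 , s∈) = ∈slopeSet⁻ {dirsOf c u} x∈ in ∈slopeSet {dirsOf c′ u′} x≢0 (SameDirs.dirs⊇ d d′ sub s∈))
    (λ x x∈ → let (x≢0 , s∈) = ∈slopeSet⁻ {dirsOf c′ u′} x∈ in ∈slopeSet {dirsOf c u} x≢0 (sub s∈))

  Ks* Frs* : List Carrier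
  Ks* = nonzeros Ks
  Frs* = nonzeros Frs

  ∈Ks*⁻ : ∀ {x} → x ∈ Ks* → InK x × x ≢ 0#
  ∈Ks*⁻ x∈ = let (p , n) = ∈nonzeros⁻ {Ks} x∈ in ∈Ks⁻ p , n

  ∈Frs*⁻ : ∀ {x} → x ∈ Frs* → InFr x × x ≢ 0#
  ∈Frs*⁻ x∈ = let (p , n) = ∈nonzeros⁻ {Frs} x∈ in ∈Frs⁻ p , n

  length-Ks* : suc (length Ks*) ≡ q
  length-Ks* = trans (length-nonzeros Ks-unique (∈Ks 0∈Ks)) length-Ks

  length-Frs* : suc (length Frs*) ≡ r
  length-Frs* = trans (length-nonzeros Frs-unique (∈Frs (fixed-0 frob-r))) length-Frs

  rescale : Carrier → Carrier → Carrier → Carrier × Carrier → Carrier × Carrier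
  rescale c u β (ν , τ) = c * (β * ν) , comb c u (τ * β) β

  rescalings : Carrier → Carrier → List (Carrier × Carrier)
  rescalings c u = cartesianProductWith (rescale c u) Ks* (cartesianProduct Frs* Ts)

  length-rescalings : ∀ c u → length (rescalings c u) ≡ length Ks* ℕ.* (length Frs* ℕ.* (r ℕ.* r))
  length-rescalings c u = trans (length-cartesianProductWith (rescale c u) Ks* (cartesianProduct Frs* Ts))
    (cong (length Ks* ℕ.*_) (trans (length-cartesianProductWith _,_ Frs* Ts) (cong (length Frs* ℕ.*_) length-Ts)))

  module _ {c u : Carrier} (d : det c u ≢ 0#) where

    rescaling⇒ : ∀ {β ν τ} → β ∈ Ks* → ν ∈ Frs* → τ ∈ Ts → Rescaled c u (c * (β * ν)) (comb c u (τ * β) β)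
    rescaling⇒ {β} {ν} {τ} β∈ ν∈ τ∈ = record { β = β ; ν = ν ; τ = τ ; β∈K = proj₁ (∈Ks*⁻ β∈) ; β≢0 = proj₂ (∈Ks*⁻ β∈)
      ; ν∈Fr = proj₁ (∈Frs*⁻ ν∈) ; ν≢0 = proj₂ (∈Frs*⁻ ν∈) ; τ∈T = ∈Ts⁻ τ∈ ; c′≡ = refl ; u′≡ = refl }

    rescalings-unique : Unique (rescalings c u)
    rescalings-unique = cartesianProductWith-unique-on (rescale c u) Ks* (cartesianProduct Frs* Ts) inj
      (nonzeros-unique Ks-unique) (cartesianProduct⁺ (nonzeros-unique Frs-unique) Ts-unique)
      where
      module B = Basis d
      inj : ∀ {β x β′ x′} → β ∈ Ks* → x ∈ cartesianProduct Frs* Ts → β′ ∈ Ks* → x′ ∈ cartesianProduct Frs* Ts →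
        rescale c u β x ≡ rescale c u β′ x′ → β ≡ β′ × x ≡ x′
      inj {β} {ν , τ} {β′} {ν′ , τ′} β∈ x∈ β′∈ x′∈ e = β≡ , cong₂ _,_ ν≡ τ≡
        where
        R = rescaling⇒ β∈ (proj₁ (∈-cartesianProduct⁻ Frs* Ts x∈)) (proj₂ (∈-cartesianProduct⁻ Frs* Ts x∈))
        R′ = rescaling⇒ β′∈ (proj₁ (∈-cartesianProduct⁻ Frs* Ts x′∈)) (proj₂ (∈-cartesianProduct⁻ Frs* Ts x′∈))
        module R = Rescaled R
        module R′ = Rescaled R′
        coords = B.comb-injective (fixed-* frob-q (T⊆K R.τ∈T) R.β∈K) R.β∈K (fixed-* frob-q (T⊆K R′.τ∈T) R′.β∈K) R′.β∈K
          (cong proj₂ e)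
        β≡ : β ≡ β′
        β≡ = proj₂ coords
        τ≡ : τ ≡ τ′
        τ≡ = *-cancelˡ R.β≢0 (trans (*-comm β τ) (trans (proj₁ coords) (trans (cong (τ′ *_) (sym β≡)) (*-comm τ′ β))))
        ν≡ : ν ≡ ν′
        ν≡ = *-cancelˡ R.β≢0 (*-cancelˡ B.c≢0 (trans (cong proj₁ e) (cong (λ t → c * (t * ν′)) (sym β≡))))

    -- Bases with the same slopes are exactly the rescalings of one of them, and β, ν, τ can be
    -- recovered from the rescaled basis: (q - 1)(r - 1)r² bases.
    class-size : length (filter ((c , u) sameClub?_) pairs) ≡ length Ks* ℕ.* (length Frs* ℕ.* (r ℕ.* r))
    class-size = trans (unique-⊆-length-≡ (filter⁺ _ pairs-unique) rescalings-unique to from) (length-rescalings c u)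
      where
      to : ∀ {x} → x ∈ filter ((c , u) sameClub?_) pairs → x ∈ rescalings c u
      to {c′ , u′} x∈ = let (x∈p , e) = ∈-filter⁻ ((c , u) sameClub?_) {xs = pairs} x∈ in
        build (SameDirs.rescaled d (pairs⁻ x∈p) (club≈⇒dirs⊆ (pairs⁻ x∈p) e))
        where
        build : Rescaled c u c′ u′ → (c′ , u′) ∈ rescalings c u
        build R = subst (_∈ rescalings c u) (cong₂ _,_ (sym c′≡) (sym u′≡))
          (∈-cartesianProductWith⁺ (rescale c u) (∈nonzeros (∈Ks β∈K) β≢0)
          (∈-cartesianProduct⁺ (∈nonzeros (∈Frs ν∈Fr) ν≢0) (∈Ts τ∈T)))
          where open Rescaled R
      from : ∀ {x} → x ∈ rescalings c u → x ∈ filter ((c , u) sameClub?_) pairs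
      from x∈ = let (β , (ν , τ) , β∈ , ντ∈ , e) = ∈-cartesianProductWith⁻ (rescale c u) Ks* (cartesianProduct Frs* Ts) x∈ ; (ν∈ , τ∈) = ∈-cartesianProduct⁻ Frs* Ts ντ∈ in
        subst (_∈ filter ((c , u) sameClub?_) pairs) (sym e) (mem (rescaling⇒ β∈ ν∈ τ∈))
        where
        mem : ∀ {c′ u′} → Rescaled c u c′ u′ → (c′ , u′) ∈ filter ((c , u) sameClub?_) pairs
        mem R = ∈-filter⁺ ((c , u) sameClub?_) (pairs⁺ (RescaledDirs.det≢0 d R))
          (dirs⊆⇒club≈ d (RescaledDirs.det≢0 d R) (RescaledDirs.dirs⊆ d R))

  -- The quotient (q² - 1)(q² - q)/((q - 1)(r - 1)r²) with q = r³ simplifies to r(r⁶ - 1)/(r - 1).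
  -- The hypotheses pass predecessors as variables to avoid truncated subtraction.
  count-arith : ∀ n a s r q b e order → suc s ≡ r → q ≡ r ℕ.* (r ℕ.* r) → suc a ≡ q → order ≡ q ℕ.* q → suc b ≡ order →
    e ℕ.+ q ≡ order → 0 < a →
    n ℕ.* (a ℕ.* (s ℕ.* (r ℕ.* r))) ≡ b ℕ.* e → 0 < s →
    n ≡ r ℕ.* (r ℕ.^ 5 ℕ.+ r ℕ.^ 4 ℕ.+ r ℕ.^ 3 ℕ.+ r ℕ.^ 2 ℕ.+ r ℕ.+ 1)
  count-arith n a s r q b e order refl q≡ refl order≡ b≡ e≡ a>0 h s>0 =
    ℕₚ.*-cancelʳ-≡ n N (a ℕ.* (s ℕ.* (r ℕ.* r)))
      {{ℕ.>-nonZero (ℕₚ.*-mono-≤ a>0 (ℕₚ.*-mono-≤ s>0 (ℕₚ.*-mono-≤ {1} {r} (s≤s z≤n) (s≤s z≤n))))}} (begin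
    n ℕ.* (a ℕ.* (s ℕ.* (r ℕ.* r)))     ≡⟨ h ⟩
    b ℕ.* e                             ≡⟨ cong (b ℕ.*_) e-eq ⟩
    b ℕ.* (a ℕ.* suc a)                 ≡⟨ cong (λ t → b ℕ.* (a ℕ.* t)) q≡ ⟩
    b ℕ.* (a ℕ.* (r ℕ.* (r ℕ.* r)))     ≡⟨ cong (ℕ._* (a ℕ.* (r ℕ.* (r ℕ.* r)))) b-eq ⟩
    s ℕ.* M ℕ.* (a ℕ.* (r ℕ.* (r ℕ.* r)))  ≡⟨ lem s M a r ⟩
    r ℕ.* M ℕ.* (a ℕ.* (s ℕ.* (r ℕ.* r))) ∎)
    where
    open ≡-Reasoning
    M = r ℕ.^ 5 ℕ.+ r ℕ.^ 4 ℕ.+ r ℕ.^ 3 ℕ.+ r ℕ.^ 2 ℕ.+ r ℕ.+ 1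
    N = r ℕ.* M
    lem : ∀ s M a r → s ℕ.* M ℕ.* (a ℕ.* (r ℕ.* (r ℕ.* r))) ≡ r ℕ.* M ℕ.* (a ℕ.* (s ℕ.* (r ℕ.* r)))
    lem = solve-∀
    e-eq : e ≡ a ℕ.* suc a
    e-eq = ℕₚ.+-cancelʳ-≡ (suc a) e (a ℕ.* suc a) (trans e≡ (trans order≡ (ℕₚ.+-comm (suc a) (a ℕ.* suc a))))
    sixth : ∀ s → suc (s ℕ.* (suc s ℕ.* (suc s ℕ.* (suc s ℕ.* (suc s ℕ.* (suc s ℕ.* 1)))) ℕ.+ suc s ℕ.*
      (suc s ℕ.* (suc s ℕ.* (suc s ℕ.* 1))) ℕ.+ suc s ℕ.* (suc s ℕ.* (suc s ℕ.* 1)) ℕ.+ suc s ℕ.* (suc s ℕ.* 1) ℕ.+ suc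
      s ℕ.+ 1))
      ≡ (suc s ℕ.* (suc s ℕ.* suc s)) ℕ.* (suc s ℕ.* (suc s ℕ.* suc s))
    sixth = solve-∀
    b-eq : b ≡ s ℕ.* M
    b-eq = ℕₚ.suc-injective (trans b≡ (trans order≡ (trans (cong₂ ℕ._*_ q≡ q≡) (sym (sixth s)))))

  private
    module ClubClasses = Classes _sameClub?_ (λ (c , u) x → refl) (λ {x} {y} e z → sym (e z)) (λ {x} {y} {z} e f w →
      trans (e w) (f w))

  count-extremal : ExactlyN (r ℕ.* (r ℕ.^ 5 ℕ.+ r ℕ.^ 4 ℕ.+ r ℕ.^ 3 ℕ.+ r ℕ.^ 2 ℕ.+ r ℕ.+ 1)) Extremal
  count-extremal = map clubOf reps , trans (length-map clubOf reps) len
      , Allₚ.map⁺ (All.tabulate λ cu∈ → club-Extremal (pairs⁻ (reps⊆ cu∈)))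
      , AllPairsₚ.map⁺ distinct
      , λ P ex → let (c , u , d , e) = extremal⇒club ex in
        Anyₚ.map⁺ (Any.map (λ f → ≈ˢ-trans {P} {club c u} e f) (covers (pairs⁺ d)))
    where
    open ClubClasses.Representatives (ClubClasses.representatives (length Ks* ℕ.* (length Frs* ℕ.* (r ℕ.* r))) pairs λ
      x∈ → class-size (pairs⁻ x∈))
    clubOf : Carrier × Carrier → Subset
    clubOf (c , u) = club c u
    pairs-length : length pairs ≡ length elements* ℕ.* (order ∸ q)
    pairs-length = length-pairsWith validFor (order ∸ q) (λ {c} c∈ → trans (sym (ℕₚ.m+n∸n≡m (length (validFor c)) q))
      (cong (_∸ q) (length-validFor (∈*⁻ c∈))))
    len : length reps ≡ r ℕ.* (r ℕ.^ 5 ℕ.+ r ℕ.^ 4 ℕ.+ r ℕ.^ 3 ℕ.+ r ℕ.^ 2 ℕ.+ r ℕ.+ 1)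
    len = count-arith (length reps) (length Ks*) (length Frs*) r q (length elements*) (order ∸ q) order length-Frs* q≡
      length-Ks* order-qq length*
      (ℕₚ.m∸n+n≡m (ℕₚ.<⇒≤ q<order)) (ℕₚ.≤-pred (subst (2 ≤_) (sym length-Ks*) (ℕₚ.≤-trans (s≤s (s≤s z≤n)) q≥8)))
      (trans count pairs-length) (ℕₚ.≤-pred (subst (2 ≤_) (sym length-Frs*) 1<r))

  -- Isomorphisms and the cliques through 0

  -- The q-th power exchanges the two terms of the determinant, so a ratio of determinants is fixed
  -- by it and lies in K.
  det-^q : ∀ c u → det c u ^ q ≡ - det c u
  det-^q c u = begin
    (u ^ q * c - c ^ q * u) ^ q               ≡⟨ frob-sub frob-q _ _ ⟩
    (u ^ q * c) ^ q - (c ^ q * u) ^ q         ≡⟨ cong₂ _-_ (trans (^-mul (u ^ q) c q) (cong (_* c ^ q) (^qq u)))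
      (trans (^-mul (c ^ q) u q) (cong (_* u ^ q) (^qq c))) ⟩
    u * c ^ q - c * u ^ q                     ≡⟨ solve 4 (λ u c u′ c′ → u :* c′ :- c :* u′ := :- (u′ :* c :- c′ :* u))
      refl u c (u ^ q) (c ^ q) ⟩
    - det c u ∎
    where open ≡-Reasoning

  module Coordinates {c u : Carrier} (d : det c u ≢ 0#) where

    -- Cramer's rule for the coordinates with respect to the basis c, u.
    α β : Carrier → Carrier
    α x = det x u * inv (det c u)
    β x = det c x * inv (det c u)

    private
      ratio∈K : ∀ {a b} → a ^ q ≡ - a → b ≢ 0# → b ^ q ≡ - b → InK (a * inv b)
      ratio∈K {a} {b} ea b≢0 eb = fixed (*-cancelˡ (neg-≢0 b≢0) (begin
        - b * (a * inv b) ^ q        ≡⟨ cong (_* (a * inv b) ^ q) eb ⟨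
        b ^ q * (a * inv b) ^ q      ≡⟨ ^-mul b (a * inv b) q ⟨
        (b * (a * inv b)) ^ q        ≡⟨ cong (_^ q) cancel ⟩
        a ^ q                        ≡⟨ ea ⟩
        - a                          ≡⟨ cong -_ (sym cancel) ⟩
        - (b * (a * inv b))          ≡⟨ -‿distribˡ-* b (a * inv b) ⟩
        - b * (a * inv b) ∎))
        where
        open ≡-Reasoning
        cancel : b * (a * inv b) ≡ a
        cancel = trans (solve 3 (λ a b i → b :* (a :* i) := a :* (b :* i)) refl a b (inv b))
          (trans (cong (a *_) (inv-r b≢0)) (*-identityʳ a))

    α∈K : ∀ x → InK (α x)
    α∈K x = ratio∈K (det-^q x u) d (det-^q c u)

    β∈K : ∀ x → InK (β x)
    β∈K x = ratio∈K (det-^q c x) d (det-^q c u)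

    reconstruct : ∀ x → comb c u (α x) (β x) ≡ x
    reconstruct x = begin
      c * (det x u * i) + u * (det c x * i)      ≡⟨ solve 7 (λ c u x c′ u′ x′ i → c :* ((u′ :* x :- x′ :* u) :* i) :+ u
        :* ((x′ :* c :- c′ :* x) :* i) := x :* ((u′ :* c :- c′ :* u) :* i)) refl c u x (c ^ q) (u ^ q) (x ^ q) i ⟩
      x * (det c u * i)                          ≡⟨ cong (x *_) (inv-r d) ⟩
      x * 1#                                     ≡⟨ *-identityʳ x ⟩
      x ∎
      where
      open ≡-Reasoning
      i = inv (det c u)

    private
      cancelʳ : ∀ t → t * det c u * inv (det c u) ≡ t
      cancelʳ t = trans (*-assoc _ _ _) (trans (cong (t *_) (inv-r d)) (*-identityʳ t))

    α-comb : ∀ {a b} → InK a → InK b → α (comb c u a b) ≡ a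
    α-comb aK bK = trans (cong (_* inv (det c u)) (det-comb-u c u aK bK)) (cancelʳ _)

    β-comb : ∀ {a b} → InK a → InK b → β (comb c u a b) ≡ b
    β-comb aK bK = trans (cong (_* inv (det c u)) (det-c-comb c u aK bK)) (cancelʳ _)

    α-sub : ∀ x y → α (x - y) ≡ α x - α y
    α-sub x y = trans (cong (λ t → (u ^ q * (x - y) - t * u) * inv (det c u)) (frob-sub frob-q x y))
      (solve 7 (λ u u′ x y x′ y′ i → (u′ :* (x :- y) :- (x′ :- y′) :* u) :* i := (u′ :* x :- x′ :* u) :* i :-
        (u′ :* y :- y′ :* u) :* i) refl u (u ^ q) x y (x ^ q) (y ^ q) (inv (det c u)))

    β-sub : ∀ x y → β (x - y) ≡ β x - β y
    β-sub x y = trans (cong (λ t → (t * c - c ^ q * (x - y)) * inv (det c u)) (frob-sub frob-q x y))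
      (solve 7 (λ c c′ x y x′ y′ i → ((x′ :- y′) :* c :- c′ :* (x :- y)) :* i := (x′ :* c :- c′ :* x) :* i :-
        (y′ :* c :- c′ :* y) :* i) refl c (c ^ q) x y (x ^ q) (y ^ q) (inv (det c u)))

  -- f is the K-linear map with c ↦ c′ and u ↦ u′.
  module Transfer {c u c′ u′ : Carrier} (d : det c u ≢ 0#) (d′ : det c′ u′ ≢ 0#) where
    private
      module C = Coordinates d
      module C′ = Coordinates d′
      module B = Basis d
      module B′ = Basis d′

    f : Carrier → Carrier
    f x = comb c′ u′ (C.α x) (C.β x)

    f-sub : ∀ x y → f (x - y) ≡ f x - f y
    f-sub x y = trans (cong₂ (comb c′ u′) (C.α-sub x y) (C.β-sub x y))
      (solve 6 (λ c u a b s t → c :* (a :- b) :+ u :* (s :- t) := (c :* a :+ u :* s) :- (c :* b :+ u :* t)) refl c′ u′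
        (C.α x) (C.α y) (C.β x) (C.β y))

    f-inverse : ∀ x → comb c u (C′.α (f x)) (C′.β (f x)) ≡ x
    f-inverse x = trans (cong₂ (comb c u) (C′.α-comb (C.α∈K x) (C.β∈K x)) (C′.β-comb (C.α∈K x) (C.β∈K x)))
      (C.reconstruct x)

    -- A nonzero point with coordinates (a, b) belongs to the connection set exactly when b = 0 or
    -- a/b lies in T, a condition independent of the basis.
    f-club : ∀ {x} → x ∈ˢ club c u → f x ∈ˢ club c′ u′
    f-club {x} x∈ = ∈slopeSet {dirsOf c′ u′} fx≢0 (by-cases (C.β x ≟ 0#))
      where
      a = C.α x
      b = C.β x
      aK = C.α∈K x
      bK = C.β∈K x
      x≢0 : x ≢ 0#
      x≢0 = proj₁ (∈slopeSet⁻ {dirsOf c u} x∈)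
      s∈ : slope (comb c u a b) ∈ dirsOf c u
      s∈ = subst (λ t → slope t ∈ dirsOf c u) (sym (C.reconstruct x)) (proj₂ (∈slopeSet⁻ {dirsOf c u} x∈))
      zero-comb : ∀ c u → comb c u 0# 0# ≡ 0#
      zero-comb c u = solve 2 (λ c u → c :* :0 :+ u :* :0 := :0) refl c u
      fx≢0 : f x ≢ 0#
      fx≢0 e = x≢0 (trans (sym (C.reconstruct x)) (trans (cong₂ (comb c u) (proj₁ ab0) (proj₂ ab0)) (zero-comb c u)))
        where
        ab0 = B′.comb-injective aK bK 0∈Ks 0∈Ks (trans e (sym (zero-comb c′ u′)))
      by-cases : Dec (b ≡ 0#) → slope (comb c′ u′ a b) ∈ dirsOf c′ u′
      by-cases (yes b0) = here (trans
        (cong slope (trans (cong (comb c′ u′ a) b0) (solve 3 (λ c u a → c :* a :+ u :* :0 := c :* a) refl c′ u′ a)))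
        (slope-scale aK (λ a0 → fx≢0 (trans (cong₂ (comb c′ u′) a0 b0) (zero-comb c′ u′))) B′.c≢0))
      by-cases (no b≢0) = there (subst (_∈ map (λ h → slope (comb c′ u′ h 1#)) Ts) (sym (B′.slope-comb-1 aK bK b≢0))
        (∈-map⁺ (λ h → slope (comb c′ u′ h 1#)) (∈Ts aT)))
        -- Only `tail-dir` is taken from `SameDirs`, so the basis is compared with itself.
        where
        t = SameDirs.tail-dir d d (λ s → s) s∈ (λ e → B.slope-c≢ aK bK b≢0 (sym e))
        h = proj₁ t
        hT = proj₁ (proj₂ t)
        aT : InT (a * inv b)
        aT = subst InT (*-cancelˡ b≢0 (trans (sym (B.slope-comb≡ aK bK (T⊆K hT) 1∈K b≢0 1≢0 (proj₂ (proj₂ t))))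
          (trans (*-identityʳ a) (sym (trans (solve 3 (λ a b i → b :* (a :* i) := a :* (b :* i)) refl a b (inv b))
            (trans (cong (a *_) (inv-r b≢0)) (*-identityʳ a))))))) hT

  isomorphic : ∀ S S′ → Extremal S → Extremal S′ → Isomorphic S S′
  isomorphic S S′ ex ex′ = go (extremal⇒club ex) (extremal⇒club ex′)
    where
    go : ∃[ c ] ∃[ u ] (det c u ≢ 0# × S ≈ˢ club c u) → ∃[ c ] ∃[ u ] (det c u ≢ 0# × S′ ≈ˢ club c u) → Isomorphic S S′
    go (c , u , d , e) (c′ , u′ , d′ , e′) = T.f , T′.f , T.f-inverse , T′.f-inverse , λ x y → mk⇔ (to x y) (from x y)
      where
      module T = Transfer d d′
      module T′ = Transfer d′ d
      to : ∀ x y → (x - y) ∈ˢ S → (T.f x - T.f y) ∈ˢ S′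
      to x y p = ≈ˢ-⊆ {club c′ u′} {S′} (≈ˢ-sym {S′} {club c′ u′} e′)
        (subst (_∈ˢ club c′ u′) (T.f-sub x y) (T.f-club (≈ˢ-⊆ {S} {club c u} e p)))
      from : ∀ x y → (T.f x - T.f y) ∈ˢ S′ → (x - y) ∈ˢ S
      from x y p = ≈ˢ-⊆ {club c u} {S} (≈ˢ-sym {S} {club c u} e) (subst (_∈ˢ club c u)
        (trans (T′.f-sub (T.f x) (T.f y)) (cong₂ _-_ (T.f-inverse x) (T.f-inverse y)))
          (T′.f-club (≈ˢ-⊆ {S′} {club c′ u′} e′ p)))

  module CliquesThrough0 {S : Subset} (exS : Extremal S) {c u : Carrier} (d : det c u ≢ 0#) (e : S ≈ˢ club c u) where
    private module B = Basis d

    -- One point on each of the r² + 1 lines through 0.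
    generators : List Carrier
    generators = c ∷ map (λ h → comb c u h 1#) Ts

    generator≢0 : ∀ {y} → y ∈ generators → y ≢ 0#
    generator≢0 (here refl) = B.c≢0
    generator≢0 (there y∈) y0 = let (h , h∈ , ey) = ∈-map⁻ (λ h → comb c u h 1#) y∈ in B.comb≢0 (T⊆K (∈Ts⁻ h∈)) 1∈K 1≢0
      (trans (sym ey) y0)

    slope-generators : map slope generators ≡ dirsOf c u
    slope-generators = cong (slope c ∷_) (sym (map-∘ Ts))

    generator∈S : ∀ {y} → y ∈ generators → y ∈ˢ S
    generator∈S {y} y∈ = ≈ˢ-⊆ {club c u} {S} (≈ˢ-sym {S} {club c u} e)
      (∈slopeSet {dirsOf c u} (generator≢0 y∈) (subst (slope y ∈_) slope-generators (∈-map⁺ slope y∈)))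

    line-canonical : ∀ {y} → y ∈ˢ S → IsCanonical S (setOf (line y))
    line-canonical {y} y∈ = 0# , y , y∈ , λ x → mk⇔
      (λ x∈ → let (t , tK , ex) = ∈line⁻ (∈setOf⁻ {line y} x∈) in t , eq tK , trans ex (sym (+-identityˡ _)))
      (λ (t , tK , ex) → ∈setOf {line y} (subst (_∈ line y) (sym (trans ex (+-identityˡ _))) (∈line (fixed tK))))

    0∈line : ∀ y → 0# ∈ line y
    0∈line y = subst (_∈ line y) (zeroʳ y) (∈line 0∈Ks)

    line-slope : ∀ {y x} → y ≢ 0# → x ≢ 0# → x ∈ line y → slope x ≡ slope y
    line-slope {y} y≢0 x≢0 x∈ = let (t , tK , ex) = ∈line⁻ x∈ in
      trans (cong slope ex) (slope-scale tK (λ t0 → x≢0 (trans ex (trans (cong (y *_) t0) (zeroʳ y)))) y≢0)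

    slope-line : ∀ {y x} → y ≢ 0# → x ≢ 0# → slope y ≡ slope x → ∀ {z} → z ∈ line x → z ∈ line y
    slope-line {y} {x} y≢0 x≢0 sl z∈ = let (t , tK , ez) = ∈line⁻ z∈ in
      subst (_∈ line y) (trans (sym (*-assoc _ _ _)) (trans (cong (_* t) (*-inv-* x y≢0)) (sym ez)))
        (∈line (fixed-* frob-q (slope-quotient y≢0 x≢0 sl) tK))

    lines-distinct : ∀ ys → (∀ {y} → y ∈ ys → y ≢ 0#) → Unique (map slope ys) →
      AllPairs (λ P Q → ¬ (P ≈ˢ Q)) (map (setOf ∘ line) ys)
    lines-distinct [] _ _ = []
    lines-distinct (y ∷ ys) nz (y∉ ∷ uy) = Allₚ.map⁺ (All.tabulate λ {x} x∈ same → All.lookup y∉ (∈-map⁺ slope x∈)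
        (line-slope (nz (there x∈)) (nz (here refl))
          (∈setOf⁻ {line x} (≈ˢ-⊆ {setOf (line y)} {setOf (line x)} same
          (∈setOf {line y} (subst (_∈ line y) (*-identityʳ y) (∈line 1∈K)))))))
      ∷ lines-distinct ys (nz ∘ there) uy

    count-canonical : ExactlyN (r ℕ.^ 2 ℕ.+ 1) (λ C → IsCanonical S C × 0# ∈ˢ C)
    count-canonical = map (setOf ∘ line) generators , len
      , Allₚ.map⁺ (All.tabulate λ {y} y∈ → line-canonical (generator∈S y∈) , ∈setOf {line y} (0∈line y))
      , lines-distinct generators generator≢0 (subst Unique (sym slope-generators) B.dirsOf-unique)
      , complete-canonical
      where
      len : length (map (setOf ∘ line) generators) ≡ r ℕ.^ 2 ℕ.+ 1
      len = trans (length-map (setOf ∘ line) generators)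
        (trans (cong suc (trans (length-map (λ h → comb c u h 1#) Ts) length-Ts)) (lem r))
        where
        lem : ∀ r → suc (r ℕ.* r) ≡ r ℕ.* (r ℕ.* 1) ℕ.+ 1
        lem = solve-∀
      -- If 0 lies on x + yK then x lies on yK, so the clique is yK; only the slope of y matters.
      complete-canonical : ∀ P → IsCanonical S P × 0# ∈ˢ P → Any (λ Q → P ≈ˢ Q) (map (setOf ∘ line) generators)
      complete-canonical P ((x , y , y∈S , iff) , 0∈P) =
        Anyₚ.map⁺ (Any.map same (∈-map⁻′ (subst (slope y ∈_) (sym slope-generators) (proj₂ y∈club))))
        where
        y∈club = ∈slopeSet⁻ {dirsOf c u} (≈ˢ-⊆ {S} {club c u} e y∈S)
        y≢0 = proj₁ y∈club
        t₀ = Equivalence.to (iff 0#) 0∈P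
        x≡ : x ≡ - (y * proj₁ t₀)
        x≡ = +≡0⇒ (sym (proj₂ (proj₂ t₀)))
        t₀K : InK (proj₁ t₀)
        t₀K = fixed (proj₁ (proj₂ t₀))
        P⇒ : ∀ {z} → z ∈ˢ P → z ∈ line y
        P⇒ {z} z∈ = let (t , tK , ez) = Equivalence.to (iff z) z∈ in
          subst (_∈ line y) (sym (trans ez
            (trans (cong (_+ y * t) x≡) (solve 3 (λ y s t → :- (y :* s) :+ y :* t := y :* (t :- s)) refl y (proj₁ t₀)
            t)))) (∈line (fixed-+ frob-q (fixed tK) (fixed-neg frob-q t₀K)))
        P⇐ : ∀ {z} → z ∈ line y → z ∈ˢ P
        P⇐ {z} z∈ = let (t , tK , ez) = ∈line⁻ z∈ in
          Equivalence.from (iff z) (t + proj₁ t₀ , eq (fixed-+ frob-q tK t₀K) ,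
          trans ez (sym (trans (cong (_+ y * (t + proj₁ t₀)) x≡)
            (solve 3 (λ y s t → :- (y :* s) :+ y :* (t :+ s) := y :* t) refl y (proj₁ t₀) t))))
        ∈-map⁻′ : ∀ {s ys} → s ∈ map slope ys → Any (λ g → g ∈ ys × s ≡ slope g) ys
        ∈-map⁻′ {ys = g ∷ ys} (here e) = here (here refl , e)
        ∈-map⁻′ {ys = g ∷ ys} (there p) = there (Any.map (λ (m , e) → there m , e) (∈-map⁻′ p))
        same : ∀ {g} → g ∈ generators × slope y ≡ slope g → P ≈ˢ setOf (line g)
        same {g} (g∈ , sl) = ≈ˢ-from
          (λ z z∈ → ∈setOf {line g} (slope-line (generator≢0 g∈) y≢0 (sym sl) (P⇒ z∈)))
          (λ z z∈ → P⇐ (slope-line y≢0 (generator≢0 g∈) sl (∈setOf⁻ {line g} z∈)))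

    -- The multiple β(cT + u𝔽_r). With β in K* these turn out to be all non-canonical cliques
    -- through 0.
    scaled : Carrier → List Carrier
    scaled β = clubClique (c * β) (u * β)

    private
      _SameScaled_ : Carrier → Carrier → Set
      β SameScaled β′ = setOf (scaled β) ≈ˢ setOf (scaled β′)

      _sameScaled?_ : ∀ β β′ → Dec (β SameScaled β′)
      β sameScaled? β′ = ≈ˢ? (setOf (scaled β)) (setOf (scaled β′))

    module _ {β : Carrier} (βK : InK β) (β≢0 : β ≢ 0#) where

      scaling : Rescaled c u (c * β) (u * β)
      scaling = record { β = β ; ν = 1# ; τ = 0# ; β∈K = βK ; β≢0 = β≢0 ; ν∈Fr = fixed-1 frob-r ; ν≢0 = 1≢0 ; τ∈T = T-0
        ; c′≡ = cong (c *_) (sym (*-identityʳ β)) ; u′≡ = solve 3 (λ c u b → u :* b := c :* (:0 :* b) :+ u :* b) refl c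
          u β }

      det-scaled : det (c * β) (u * β) ≢ 0#
      det-scaled = RescaledDirs.det≢0 d scaling

    -- As νT = T and τ𝔽_r is contained in T, neither ν nor τ changes the clique; only β is visible
    -- in it.
    clubClique-rescaled : ∀ {c′ u′} (R : Rescaled c u c′ u′) →
      (∀ {x} → x ∈ clubClique c′ u′ → x ∈ scaled (Rescaled.β R)) × (∀ {x} → x ∈ scaled (Rescaled.β R) →
        x ∈ clubClique c′ u′)
    clubClique-rescaled {c′} {u′} R = into , unique-⊆-full _≟_ (Basis.clubClique-unique d′) into
      (ℕₚ.≤-reflexive (trans (Basis.length-clubClique ds) (sym (Basis.length-clubClique d′))))
      where
      open Rescaled R
      d′ : det c′ u′ ≢ 0#
      d′ = RescaledDirs.det≢0 d R
      ds : det (c * β) (u * β) ≢ 0#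
      ds = det-scaled β∈K β≢0
      into : ∀ {x} → x ∈ clubClique c′ u′ → x ∈ scaled β
      into x∈ = let (h , f , hT , fF , ex) = Basis.∈-clubClique⁻ d′ x∈ in
        subst (_∈ scaled β) (sym (trans ex
          (trans (RescaledDirs.comb-rescaled d R h f)
          (solve 5 (λ c u b s f → (c :* s :+ u :* f) :* b := c :* b :* s :+ u :* b :* f) refl c u β (ν * h + τ * f)
          f))))
          (Basis.∈-clubClique ds (T-+ (T-Fr ν∈Fr hT) (subst InT (*-comm f τ) (T-Fr fF τ∈T))) fF)

    -- Comparing the multiples of c in both cliques gives β′T inside βT, so β′/β stabilises T and
    -- lies in 𝔽_r by `T-stable⇒Fr`.
    sameScaled⇒ : ∀ {β β′} → β ∈ Ks* → β′ ∈ Ks* → β SameScaled β′ → β′ ∈ map (β *_) Frs*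
    sameScaled⇒ {β} {β′} β∈ β′∈ same = subst (_∈ map (β *_) Frs*) (*-inv-* β′ β≢0)
      (∈-map⁺ (β *_) (∈nonzeros (∈Frs (T-stable⇒Fr μ stable)) (*-≢0 (inv≢0 β≢0) β′≢0)))
      where
      βK = proj₁ (∈Ks*⁻ β∈)
      β≢0 = proj₂ (∈Ks*⁻ β∈)
      β′K = proj₁ (∈Ks*⁻ β′∈)
      β′≢0 = proj₂ (∈Ks*⁻ β′∈)
      μ = inv β * β′
      stable : ∀ {h} → InT h → InT (μ * h)
      stable {h} hT = let (h₁ , f₁ , h₁T , f₁F , ex) = Basis.∈-clubClique⁻ (det-scaled βK β≢0) point∈ in
        subst InT (*-cancelˡ β≢0 (trans
          (sym (proj₁ (B.comb-injective (fixed-* frob-q β′K (T⊆K hT)) 0∈Ks (fixed-* frob-q βK (T⊆K h₁T))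
          (fixed-* frob-q βK (Fr⊆K f₁F))
          (trans (solve 4 (λ c u b h → c :* (b :* h) :+ u :* :0 := c :* b :* h :+ u :* b :* :0) refl c u β′ h)
            (trans ex (solve 5 (λ c u b h f → c :* b :* h :+ u :* b :* f := c :* (b :* h) :+ u :* (b :* f)) refl c u β
            h₁ f₁))))))
          (sym (trans (sym (*-assoc β μ h)) (cong (_* h) (*-inv-* β′ β≢0)))))) h₁T
        where
        point∈ : comb (c * β′) (u * β′) h 0# ∈ scaled β
        point∈ = ∈setOf⁻ {scaled β} (≈ˢ-⊆ {setOf (scaled β′)} {setOf (scaled β)}
          (≈ˢ-sym {setOf (scaled β)} {setOf (scaled β′)} same)
          (∈setOf {scaled β′} (Basis.∈-clubClique (det-scaled β′K β′≢0) hT (fixed-0 frob-r))))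

    sameScaled⇐ : ∀ {β ν} → β ∈ Ks* → ν ∈ Frs* → β SameScaled (β * ν)
    sameScaled⇐ {β} {ν} β∈ ν∈ = ≈ˢ-from (λ x x∈ → ∈setOf {scaled (β * ν)} (back (∈setOf⁻ {scaled β} x∈)))
      (λ x x∈ → ∈setOf {scaled β} (into (∈setOf⁻ {scaled (β * ν)} x∈)))
      where
      βK = proj₁ (∈Ks*⁻ β∈)
      β≢0 = proj₂ (∈Ks*⁻ β∈)
      νF = proj₁ (∈Frs*⁻ ν∈)
      ν≢0 = proj₂ (∈Frs*⁻ ν∈)
      dν = det-scaled (fixed-* frob-q βK (Fr⊆K νF)) (*-≢0 β≢0 ν≢0)
      into : ∀ {x} → x ∈ scaled (β * ν) → x ∈ scaled β
      into x∈ = let (h , f , hT , fF , ex) = Basis.∈-clubClique⁻ dν x∈ in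
        subst (_∈ scaled β) (sym (trans ex
          (solve 6 (λ c u b n h f → c :* (b :* n) :* h :+ u :* (b :* n) :* f := c :* b :* (n :* h) :+ u :* b :*
          (n :* f)) refl c u β ν h f)))
          (Basis.∈-clubClique (det-scaled βK β≢0) (T-Fr νF hT) (fixed-* frob-r νF fF))
      back : ∀ {x} → x ∈ scaled β → x ∈ scaled (β * ν)
      back = unique-⊆-full _≟_ (Basis.clubClique-unique dν) into
        (ℕₚ.≤-reflexive (trans (Basis.length-clubClique (det-scaled βK β≢0)) (sym (Basis.length-clubClique dν))))

    scaled-class : ∀ {β} → β ∈ Ks* → length (filter (β sameScaled?_) Ks*) ≡ length Frs*
    scaled-class {β} β∈ = trans (unique-⊆-length-≡ (filter⁺ _ (nonzeros-unique Ks-unique))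
      (map⁺ (*-cancelˡ β≢0) (nonzeros-unique Frs-unique)) to from) (length-map (β *_) Frs*)
      where
      β≢0 = proj₂ (∈Ks*⁻ β∈)
      to : ∀ {x} → x ∈ filter (β sameScaled?_) Ks* → x ∈ map (β *_) Frs*
      to x∈ = let (x∈K , same) = ∈-filter⁻ (β sameScaled?_) {xs = Ks*} x∈ in sameScaled⇒ β∈ x∈K same
      from : ∀ {x} → x ∈ map (β *_) Frs* → x ∈ filter (β sameScaled?_) Ks*
      from x∈ = let (ν , ν∈ , ex) = ∈-map⁻ (β *_) x∈ in subst (_∈ filter (β sameScaled?_) Ks*) (sym ex)
        (∈-filter⁺ (β sameScaled?_) (∈nonzeros (∈Ks (fixed-* frob-q (proj₁ (∈Ks*⁻ β∈)) (Fr⊆K (proj₁ (∈Frs*⁻ ν∈)))))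
          (*-≢0 β≢0 (proj₂ (∈Frs*⁻ ν∈)))) (sameScaled⇐ β∈ ν∈))

    private
      module ScaledClasses = Classes _sameScaled?_ (λ β x → refl) (λ f x → sym (f x)) (λ f g x → trans (f x) (g x))

    sf : SlopeForm (suc (proj₁ exS)) S
    sf = slopeForm (proj₁ (proj₂ exS))

    module SF = SlopeForm sf

    dirs⊆zs : ∀ {s} → s ∈ dirsOf c u → s ∈ SF.zs
    dirs⊆zs = slopeForm-club⊆ d sf (≈ˢ-⊆ {club c u} {S} (≈ˢ-sym {S} {club c u} e))

    zs⊆dirs : ∀ {s} → s ∈ SF.zs → s ∈ dirsOf c u
    zs⊆dirs s∈ = let (y , y≢0 , es) = SF.zs-slopes s∈ in
      subst (_∈ dirsOf c u) (sym es) (proj₂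
        (∈slopeSet⁻ {dirsOf c u} (≈ˢ-⊆ {S} {club c u} e (SF.S⇐ y≢0 (subst (_∈ SF.zs) es s∈)))))

    few : suc (proj₁ exS) ≤ suc (r ℕ.* r)
    few = subst₂ _≤_ SF.zs-length B.length-dirsOf (unique-⊆-length SF.zs-unique zs⊆dirs)

    scaled-NonCanonical : ∀ {β} → β ∈ Ks* → IsNonCanonical S (setOf (scaled β))
    scaled-NonCanonical β∈ = InSlopeForm.club-NonCanonical sf (det-scaled βK β≢0)
      (dirs⊆zs ∘ RescaledDirs.dirs⊆ d (scaling βK β≢0))
      where
      βK = proj₁ (∈Ks*⁻ β∈)
      β≢0 = proj₂ (∈Ks*⁻ β∈)

    0∈scaled : ∀ {β} → β ∈ Ks* → 0# ∈ scaled β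
    0∈scaled {β} β∈ = subst (_∈ scaled β) (solve 2 (λ c u → c :* :0 :+ u :* :0 := :0) refl (c * β) (u * β))
      (Basis.∈-clubClique (det-scaled (proj₁ (∈Ks*⁻ β∈)) (proj₂ (∈Ks*⁻ β∈))) T-0 (fixed-0 frob-r))

    -- Classifying at x₀ = 0 gives a club on another basis with the same slopes. That basis is a
    -- rescaling of (c, u), and its clique depends on β alone.
    noncanonical⇒scaled : ∀ P → IsNonCanonical S P → 0# ∈ˢ P → ∃[ β ] (β ∈ Ks* × P ≈ˢ setOf (scaled β))
    noncanonical⇒scaled P (mx , nc) 0∈P = by-cases (InSlopeForm.classify sf (s≤s z≤n) few P mx 0# 0∈P)
      where
      by-cases : IsCanonical S P ⊎ InSlopeForm.ClubAt sf P 0# → ∃[ β ] (β ∈ Ks* × P ≈ˢ setOf (scaled β))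
      by-cases (inj₁ can) = ⊥-elim (nc can)
      by-cases (inj₂ cl) = β , ∈nonzeros (∈Ks β∈K) β≢0 , ≈ˢ-from
          (λ x x∈ → ∈setOf {scaled β} (proj₁ same (subst (_∈ clubClique A.c A.u) (minus0 x) (A.C⇒ x∈))))
          (λ x x∈ → A.C⇐ (subst (_∈ clubClique A.c A.u) (sym (minus0 x)) (proj₂ same (∈setOf⁻ {scaled β} x∈))))
        where
        module A = InSlopeForm.ClubAt cl
        minus0 : ∀ x → x - 0# ≡ x
        minus0 x = solve 1 (λ x → x :- :0 := x) refl x
        R : Rescaled c u A.c A.u
        R = SameDirs.rescaled d A.det≢0
          (club≈⇒dirs⊆ A.det≢0 (≈ˢ-trans {club c u} {S} {club A.c A.u} (≈ˢ-sym {S} {club c u} e) A.S≈))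
        open Rescaled R
        same = clubClique-rescaled R

    -- The q - 1 scalars β fall into classes of size r - 1, the cosets of 𝔽_r*, and (r³ - 1)/(r - 1)
    -- = r² + r + 1.
    count-noncanonical : ExactlyN (r ℕ.^ 2 ℕ.+ r ℕ.+ 1) (λ C → IsNonCanonical S C × 0# ∈ˢ C)
    count-noncanonical = map (setOf ∘ scaled) reps , trans (length-map (setOf ∘ scaled) reps) len
      , Allₚ.map⁺ (All.tabulate λ {β} β∈ → scaled-NonCanonical (reps⊆ β∈) , ∈setOf {scaled β} (0∈scaled (reps⊆ β∈)))
      , AllPairsₚ.map⁺ distinct
      , λ P (nc , 0∈P) → let (β , β∈ , same) = noncanonical⇒scaled P nc 0∈P in
          Anyₚ.map⁺ (Any.map (λ {β′} f → ≈ˢ-trans {P} {setOf (scaled β)} {setOf (scaled β′)} same f) (covers β∈))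
      where
      open ScaledClasses.Representatives (ScaledClasses.representatives (length Frs*) Ks* scaled-class)
      arith : ∀ n s r → suc s ≡ r → 0 < s → suc (n ℕ.* s) ≡ r ℕ.* (r ℕ.* r) → n ≡ r ℕ.^ 2 ℕ.+ r ℕ.+ 1
      arith n s r refl s>0 h = ℕₚ.*-cancelʳ-≡ n _ s {{ℕ.>-nonZero s>0}} (ℕₚ.suc-injective (trans h (cube s)))
        where
        cube : ∀ s → suc s ℕ.* (suc s ℕ.* suc s) ≡ suc ((suc s ℕ.* (suc s ℕ.* 1) ℕ.+ suc s ℕ.+ 1) ℕ.* s)
        cube = solve-∀
      len : length reps ≡ r ℕ.^ 2 ℕ.+ r ℕ.+ 1
      len = arith (length reps) (length Frs*) r length-Frs* (ℕₚ.≤-pred (subst (2 ≤_) (sym length-Frs*) 1<r))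
        (trans (cong suc count) (trans length-Ks* q≡))

  cliques-through-0 : ∀ S → Extremal S →
    ExactlyN (r ℕ.^ 2 ℕ.+ 1) (λ C → IsCanonical S C × 0# ∈ˢ C) × ExactlyN (r ℕ.^ 2 ℕ.+ r ℕ.+ 1)
      (λ C → IsNonCanonical S C × 0# ∈ˢ C)
  cliques-through-0 S ex = let (c , u , d , e) = extremal⇒club ex in
    CliquesThrough0.count-canonical {S} ex {c} {u} d e , CliquesThrough0.count-noncanonical {S} ex {c} {u} d e

-- The theorem in terms of r

-- As p^(2j) is the square of p^j, the exponent k is odd; in this form the hypothesis on r excludes
-- m² = q in the lacunary argument.
odd-exponent : ∀ p k → ¬ IsSquare (p ℕ.^ k) → ∀ j → k ≢ j ℕ.+ j
odd-exponent p k nonsquare j refl = nonsquare (p ℕ.^ j , ℕₚ.^-distribˡ-+-* p j j)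

cube : ∀ p k → (p ℕ.^ k) ℕ.^ 3 ≡ p ℕ.^ (k ℕ.+ (k ℕ.+ k))
cube p k = trans (ℕₚ.^-*-assoc p k 3) (cong (p ℕ.^_) (thrice k))
  where
  thrice : ∀ k → k ℕ.* 3 ≡ k ℕ.+ (k ℕ.+ k)
  thrice = solve-∀

open import Data.Nat using (_+_; _*_; _^_)

theorem1p5 : (r : ℕ) → IsPrimePower r → ¬ IsSquare r →
    (F : FiniteField) → FiniteField.order F ≡ (r ^ 3) * (r ^ 3) →
    let open Peisert F (r ^ 3) in
    ExactlyN (r * (r ^ 5 + r ^ 4 + r ^ 3 + r ^ 2 + r + 1)) Extremal ×
    (∀ S S' → Extremal S → Extremal S' → Isomorphic S S') ×
    (∀ S → Extremal S →
    ExactlyN (r ^ 2 + 1)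
    (λ C → IsCanonical S C × (FiniteField.0# F) ∈ˢ C) ×
    ExactlyN (r ^ 2 + r + 1)
    (λ C → IsNonCanonical S C × (FiniteField.0# F) ∈ˢ C))
theorem1p5 r (p , k , pp , k>0 , refl) nonsquare F order≡ = at (r ^ 3) (cube p k)
  where
  q = p ^ (k + (k + k))
  order≡′ : FiniteField.order F ≡ p ^ ((k + (k + k)) + (k + (k + k)))
  order≡′ = trans order≡ (trans (cong₂ _*_ (cube p k) (cube p k))
    (sym (ℕₚ.^-distribˡ-+-* p (k + (k + k)) (k + (k + k)))))
  module C = CubeOrder F p k pp k>0 (odd-exponent p k nonsquare) order≡′
  -- The numbers `r ^ 3` and `q` are equal only propositionally; generalising the first to `Q` lets
  -- a match on `refl` identify the graphs of the statement with those treated in `C`.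
  at : ∀ Q → Q ≡ q →
    let open Peisert F Q in
    ExactlyN (r * (r ^ 5 + r ^ 4 + r ^ 3 + r ^ 2 + r + 1)) Extremal ×
    (∀ S S' → Extremal S → Extremal S' → Isomorphic S S') ×
    (∀ S → Extremal S →
    ExactlyN (r ^ 2 + 1) (λ C → IsCanonical S C × (FiniteField.0# F) ∈ˢ C) ×
    ExactlyN (r ^ 2 + r + 1) (λ C → IsNonCanonical S C × (FiniteField.0# F) ∈ˢ C))
  at _ refl = C.count-extremal , C.isomorphic , C.cliques-through-0
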